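{- If $|q|<1$ and $a\neq -q^{ -2N}$ for any integer $N>0$, then $$\sum_{n=0}^{\infty}\frac{a^nq^{n^2+n}}{(q;q)_n}=(-aq^2;q^2)_{\infty}\sum_{n=0}^{\infty}\frac{a^nq^{n^2+2n}}{(q^2;q^2)_n(-aq^2;q^2)_n}=(-aq^3;q^2)_{\infty}\sum_{n=0}^{\infty}\frac{a^nq^{n^2+n}}{(q^2;q^2)_n(-aq^3;q^2)_n}.$$
   Context: Here $a$ and $q$ are complex numbers. Notation: $(x;q)_0=1$, $(x;q)_n=\prod_{j=0}^{n-1}(1-xq^{j})$ for $n\ge 1$, and $(x;q)_\infty=\prod_{j=0}^{\infty}(1-xq^{j})$ (and likewise with base $q^2$ in place of $q$).
   Formalization: The second equality is stated for a ≠ -q^{ -(2N+1)} for every integer N>0 (no condition if q=0); otherwise some (-aq^3;q^2)_n is zero and the third expression is undefined, e.g. q=1/2, a=-8. -}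

module Defs where

open import Algebra.Bundles using (RawRing)
import Algebra.Definitions.RawSemiring as RawSemiringDefs
open import Data.Integer.Base as ℤ using (+_; -[1+_])
import Data.Integer.Properties as ℤ
open import Data.Nat.Base as ℕ using (ℕ; zero; suc)
import Data.Nat.Coprimality as Coprimality
import Data.Nat.Properties as ℕ
open import Data.Product.Base using (Σ-syntax; ∃-syntax; _×_; _,_)
open import Data.Rational.Base as ℚ using (ℚ; 0ℚ; 1ℚ; ½; mkℚ; *≤*; *<*)
import Data.Rational.Properties as ℚ
open import Data.Rational.Solver using (module +-*-Solver)
import Data.Rational.Unnormalised.Base as ℚᵘ
import Data.Rational.Unnormalised.Properties as ℚᵘ
open import Data.Sum.Base as Sum using (_⊎_; inj₁; inj₂)
open import Level using (0ℓ)
open import Relation.Binary.PropositionalEquality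
  using (_≡_; _≢_; refl; sym; trans; cong; cong₂; subst; subst₂)
open import Relation.Nullary.Decidable using (Dec; yes; no)
open import Relation.Nullary.Negation using (¬_; contradiction)

------------------------------------------------------------------------
-- Rational arithmetic

pos* : ∀ {p q} → 0ℚ ℚ.< p → 0ℚ ℚ.< q → 0ℚ ℚ.< p ℚ.* q
pos* {p} {q} 0<p 0<q = ℚ.positive⁻¹ (p ℚ.* q)
  {{ℚ.pos*pos⇒pos p {{ℚ.positive 0<p}} q {{ℚ.positive 0<q}}}}

pos+ : ∀ {p q} → 0ℚ ℚ.< p → 0ℚ ℚ.≤ q → 0ℚ ℚ.< p ℚ.+ q
pos+ {p} {q} 0<p 0≤q =
  subst (ℚ._< p ℚ.+ q) (ℚ.+-identityˡ 0ℚ) (ℚ.+-mono-<-≤ 0<p 0≤q)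

nonNeg+ : ∀ {p q} → 0ℚ ℚ.≤ p → 0ℚ ℚ.≤ q → 0ℚ ℚ.≤ p ℚ.+ q
nonNeg+ {p} {q} 0≤p 0≤q =
  subst (ℚ._≤ p ℚ.+ q) (ℚ.+-identityˡ 0ℚ) (ℚ.+-mono-≤ 0≤p 0≤q)

*-mono-nonNeg-≤ : ∀ {p q r s} → 0ℚ ℚ.≤ p → 0ℚ ℚ.≤ s →
           p ℚ.≤ q → r ℚ.≤ s → p ℚ.* r ℚ.≤ q ℚ.* s
*-mono-nonNeg-≤ {p} {q} {r} {s} 0≤p 0≤s p≤q r≤s = ℚ.≤-trans
  (ℚ.*-monoˡ-≤-nonNeg p {{ℚ.nonNegative 0≤p}} r≤s)
  (ℚ.*-monoʳ-≤-nonNeg s {{ℚ.nonNegative 0≤s}} p≤q)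

nonNeg* : ∀ {p q} → 0ℚ ℚ.≤ p → 0ℚ ℚ.≤ q → 0ℚ ℚ.≤ p ℚ.* q
nonNeg* {p} {q} 0≤p 0≤q = subst (ℚ._≤ p ℚ.* q) (ℚ.*-zeroˡ 0ℚ)
  (*-mono-nonNeg-≤ ℚ.≤-refl 0≤q 0≤p 0≤q)

*-mono-nonNeg-< : ∀ {p q r s} → 0ℚ ℚ.< q → 0ℚ ℚ.≤ r →
             p ℚ.≤ q → r ℚ.< s → p ℚ.* r ℚ.< q ℚ.* s
*-mono-nonNeg-< {p} {q} {r} {s} 0<q 0≤r p≤q r<s = ℚ.≤-<-trans
  (ℚ.*-monoʳ-≤-nonNeg r {{ℚ.nonNegative 0≤r}} p≤q)
  (ℚ.*-monoʳ-<-pos q {{ℚ.positive 0<q}} r<s)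

0<½ : 0ℚ ℚ.< ½
0<½ = ℚ.positive⁻¹ ½

0<1 : 0ℚ ℚ.< 1ℚ
0<1 = ℚ.positive⁻¹ 1ℚ

½+½ : ∀ p → ½ ℚ.* p ℚ.+ ½ ℚ.* p ≡ p
½+½ p = trans (sym (ℚ.*-distribʳ-+ p ½ ½)) (ℚ.*-identityˡ p)

p≤∣p∣ : ∀ p → p ℚ.≤ ℚ.∣ p ∣
p≤∣p∣ p with ℚ.≤-total 0ℚ p
... | inj₁ 0≤p = ℚ.≤-reflexive (sym (ℚ.0≤p⇒∣p∣≡p 0≤p))
... | inj₂ p≤0 = ℚ.≤-trans p≤0 (ℚ.0≤∣p∣ p)

-p≤∣p∣ : ∀ p → ℚ.- p ℚ.≤ ℚ.∣ p ∣
-p≤∣p∣ p = subst (ℚ.- p ℚ.≤_) (ℚ.∣-p∣≡∣p∣ p) (p≤∣p∣ (ℚ.- p))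

∣∣-< : ∀ {p ε} → p ℚ.< ε → ℚ.- p ℚ.< ε → ℚ.∣ p ∣ ℚ.< ε
∣∣-< {p} {ε} p<ε -p<ε with ℚ.∣p∣≡p∨∣p∣≡-p p
... | inj₁ e = subst (ℚ._< ε) (sym e) p<ε
... | inj₂ e = subst (ℚ._< ε) (sym e) -p<ε

∣p∣²≡p² : ∀ p → ℚ.∣ p ∣ ℚ.* ℚ.∣ p ∣ ≡ p ℚ.* p
∣p∣²≡p² p with ℚ.∣p∣≡p∨∣p∣≡-p p
... | inj₁ e = cong₂ ℚ._*_ e e
... | inj₂ e = trans (cong₂ ℚ._*_ e e)
  (solve 1 (λ x → (:- x) :* (:- x) := x :* x) refl p)
  where open +-*-Solver

0≤p² : ∀ p → 0ℚ ℚ.≤ p ℚ.* p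
0≤p² p = subst (0ℚ ℚ.≤_) (∣p∣²≡p² p) (nonNeg* (ℚ.0≤∣p∣ p) (ℚ.0≤∣p∣ p))

sq-mono-≤ : ∀ {p q} → 0ℚ ℚ.≤ p → p ℚ.≤ q → p ℚ.* p ℚ.≤ q ℚ.* q
sq-mono-≤ 0≤p p≤q = *-mono-nonNeg-≤ 0≤p (ℚ.≤-trans 0≤p p≤q) p≤q p≤q

sq-cancel-< : ∀ {p q} → 0ℚ ℚ.≤ q → p ℚ.* p ℚ.< q ℚ.* q → p ℚ.< q
sq-cancel-< {p} {q} 0≤q p²<q² = ℚ.≰⇒> λ q≤p →
  ℚ.<-irrefl refl (ℚ.<-≤-trans p²<q² (sq-mono-≤ 0≤q q≤p))

p-q<ε⇒p<q+ε : ∀ {p q ε} → p ℚ.- q ℚ.< ε → p ℚ.< q ℚ.+ ε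
p-q<ε⇒p<q+ε {p} {q} {ε} h = subst (ℚ._< q ℚ.+ ε)
  (solve 2 (λ x y → y :+ (x :- y) := x) refl p q)
  (ℚ.+-monoʳ-< q h)
  where open +-*-Solver

p<q+ε⇒p-q<ε : ∀ {p q ε} → p ℚ.< q ℚ.+ ε → p ℚ.- q ℚ.< ε
p<q+ε⇒p-q<ε {p} {q} {ε} h = subst (p ℚ.- q ℚ.<_)
  (solve 2 (λ x y → (y :+ x) :- y := x) refl ε q)
  (ℚ.+-monoˡ-< (ℚ.- q) h)
  where open +-*-Solver

-- The inverse of a rational number, extended by inv 0 = 0.
inv : ℚ → ℚ
inv p with p ℚ.≟ 0ℚ
... | yes _  = 0ℚ
... | no p≢0 = (ℚ.1/ p) {{ℚ.≢-nonZero p≢0}}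

*-inv : ∀ {p} → p ≢ 0ℚ → p ℚ.* inv p ≡ 1ℚ
*-inv {p} p≢0 with p ℚ.≟ 0ℚ
... | yes p≡0 = contradiction p≡0 p≢0
... | no p≢0′ = ℚ.*-inverseʳ p {{ℚ.≢-nonZero p≢0′}}

>⇒≢ : ∀ {p} → 0ℚ ℚ.< p → p ≢ 0ℚ
>⇒≢ 0<p p≡0 = ℚ.<⇒≢ 0<p (sym p≡0)

*-inv-pos : ∀ {p} → 0ℚ ℚ.< p → p ℚ.* inv p ≡ 1ℚ
*-inv-pos 0<p = *-inv (>⇒≢ 0<p)

0<inv : ∀ {p} → 0ℚ ℚ.< p → 0ℚ ℚ.< inv p
0<inv {p} 0<p = ℚ.*-cancelˡ-<-nonNeg p {{ℚ.nonNegative (ℚ.<⇒≤ 0<p)}}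
  (subst₂ ℚ._<_ (sym (ℚ.*-zeroʳ p)) (sym (*-inv-pos 0<p)) 0<1)

∣inv∣≤ : ∀ {p δ} → 0ℚ ℚ.< δ → δ ℚ.≤ ℚ.∣ p ∣ → ℚ.∣ inv p ∣ ℚ.≤ inv δ
∣inv∣≤ {p} {δ} 0<δ δ≤∣p∣ =
  ℚ.*-cancelˡ-≤-pos δ {{ℚ.positive 0<δ}} (ℚ.≤-trans
    (ℚ.*-monoʳ-≤-nonNeg ℚ.∣ inv p ∣ {{ℚ.∣-∣-nonNeg (inv p)}} δ≤∣p∣)
    (ℚ.≤-reflexive (trans (sym (ℚ.∣p*q∣≡∣p∣*∣q∣ p (inv p)))
      (trans (cong ℚ.∣_∣ (*-inv {p} p≢0)) (sym (*-inv-pos 0<δ))))))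
  where
  p≢0 : p ≢ 0ℚ
  p≢0 refl = ℚ.<-irrefl refl (ℚ.<-≤-trans 0<δ δ≤∣p∣)

inv-diff : ∀ {p q} → p ≢ 0ℚ → q ≢ 0ℚ →
           inv p ℚ.- inv q ≡ (q ℚ.- p) ℚ.* (inv p ℚ.* inv q)
inv-diff {p} {q} p≢0 q≢0 = sym (trans
  (solve 4 (λ x y x′ y′ →
      (y :- x) :* (x′ :* y′) := x′ :* (y :* y′) :- y′ :* (x :* x′))
    refl p q (inv p) (inv q))
  (cong₂ ℚ._-_
    (trans (cong (inv p ℚ.*_) (*-inv {q} q≢0)) (ℚ.*-identityʳ (inv p)))
    (trans (cong (inv q ℚ.*_) (*-inv {p} p≢0)) (ℚ.*-identityʳ (inv q)))))
  where open +-*-Solver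

fromℕ : ℕ → ℚ
fromℕ n = mkℚ (+ n) 0 (Coprimality.sym (Coprimality.1-coprimeTo n))

-- 1/[1+ n ] is 1/(n+1).
1/[1+_] : ℕ → ℚ
1/[1+ n ] = ℚ.1/ fromℕ (suc n)

fromℕ-suc : ∀ n → fromℕ (suc n) ≡ fromℕ n ℚ.+ 1ℚ
fromℕ-suc n = ℚ.toℚᵘ-injective (ℚᵘ.≃-trans
  (ℚᵘ.*≡* (cong (ℤ._* + 1) (trans (cong +_ (ℕ.+-comm 1 n))
    (cong (ℤ._+ + 1) (sym (ℤ.*-identityʳ (+ n)))))))
  (ℚᵘ.≃-sym (ℚ.toℚᵘ-homo-+ (fromℕ n) 1ℚ)))

0≤fromℕ : ∀ n → 0ℚ ℚ.≤ fromℕ n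
0≤fromℕ n = ℚ.nonNegative⁻¹ (fromℕ n)

0<1/ : ∀ n → 0ℚ ℚ.< 1/[1+ n ]
0<1/ n = ℚ.positive⁻¹ 1/[1+ n ]

≤-fromℕ : ∀ p → p ℚ.≤ fromℕ ℤ.∣ ℚ.↥ p ∣
≤-fromℕ (mkℚ (+ n) d _) = *≤* (subst₂ ℤ._≤_
  (sym (ℤ.*-identityʳ (+ n))) (ℤ.pos-* n (suc d))
  (ℤ.+≤+ (ℕ.m≤m*n n (suc d))))
≤-fromℕ p@(mkℚ -[1+ n ] d _) = ℚ.≤-trans
  (ℚ.<⇒≤ (ℚ.negative⁻¹ p)) (0≤fromℕ (suc n))

1/-small : ∀ {ε} → 0ℚ ℚ.< ε →
           ∃[ N ] (∀ n → N ℕ.≤ n → 1/[1+ n ] ℚ.< ε)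
1/-small {ε} 0<ε = N , λ n N≤n →
  ℚ.*-cancelˡ-<-nonNeg (fromℕ (suc n))
    (subst (ℚ._< fromℕ (suc n) ℚ.* ε)
      (trans (ℚ.*-comm (inv ε) ε) (trans (*-inv-pos 0<ε)
        (sym (ℚ.*-inverseʳ (fromℕ (suc n))))))
      (ℚ.*-monoˡ-<-pos ε {{ℚ.positive 0<ε}}
        (ℚ.≤-<-trans (≤-fromℕ (inv ε)) (fromℕ-mono-< (ℕ.s≤s N≤n)))))
  where
  N : ℕ
  N = ℤ.∣ ℚ.↥ inv ε ∣
  fromℕ-mono-< : ∀ {m n} → m ℕ.< n → fromℕ m ℚ.< fromℕ n
  fromℕ-mono-< {m} {n} m<n = *<* (subst₂ ℤ._<_
    (sym (ℤ.*-identityʳ (+ m))) (sym (ℤ.*-identityʳ (+ n)))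
    (ℤ.+<+ m<n))

------------------------------------------------------------------------
-- Real numbers: Cauchy sequences of rationals, with a modulus

IsCauchy : (ℕ → ℚ) → Set
IsCauchy x = ∀ ε → 0ℚ ℚ.< ε →
  ∃[ N ] (∀ m n → N ℕ.≤ m → N ℕ.≤ n → ℚ.∣ x m ℚ.- x n ∣ ℚ.< ε)

record ℝ : Set where
  constructor mkℝ
  field
    seq      : ℕ → ℚ
    isCauchy : IsCauchy seq

open ℝ public

infix 4 _≈ᴿ_ _<ᴿ_ _#ᴿ_

_≈ᴿ_ : ℝ → ℝ → Set
x ≈ᴿ y = ∀ ε → 0ℚ ℚ.< ε →
  ∃[ N ] (∀ n → N ℕ.≤ n → ℚ.∣ seq x n ℚ.- seq y n ∣ ℚ.< ε)

_<ᴿ_ : ℝ → ℝ → Set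
x <ᴿ y = ∃[ ε ] 0ℚ ℚ.< ε ×
  ∃[ N ] (∀ n → N ℕ.≤ n → seq x n ℚ.+ ε ℚ.≤ seq y n)

_#ᴿ_ : ℝ → ℝ → Set
x #ᴿ y = x <ᴿ y ⊎ y <ᴿ x

const-cauchy : ∀ p → IsCauchy (λ _ → p)
const-cauchy p ε 0<ε = 0 , λ _ _ _ _ →
  subst (λ r → ℚ.∣ r ∣ ℚ.< ε) (sym (ℚ.+-inverseʳ p)) 0<ε

+-cauchy : ∀ {x y} → IsCauchy x → IsCauchy y → IsCauchy (λ n → x n ℚ.+ y n)
+-cauchy {x} {y} cx cy ε 0<ε
  with N₁ , h₁ ← cx (½ ℚ.* ε) (pos* 0<½ 0<ε)
     | N₂ , h₂ ← cy (½ ℚ.* ε) (pos* 0<½ 0<ε)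
  = N₁ ℕ.⊔ N₂ , λ m n N≤m N≤n → ℚ.≤-<-trans
      (subst (λ r → ℚ.∣ r ∣ ℚ.≤ ℚ.∣ x m ℚ.- x n ∣ ℚ.+ ℚ.∣ y m ℚ.- y n ∣)
        (solve 4 (λ a b c d → (a :- c) :+ (b :- d) := (a :+ b) :- (c :+ d))
          refl (x m) (y m) (x n) (y n))
        (ℚ.∣p+q∣≤∣p∣+∣q∣ (x m ℚ.- x n) (y m ℚ.- y n)))
      (subst (ℚ.∣ x m ℚ.- x n ∣ ℚ.+ ℚ.∣ y m ℚ.- y n ∣ ℚ.<_) (½+½ ε)
        (ℚ.+-mono-<
          (h₁ m n (ℕ.m⊔n≤o⇒m≤o N₁ N₂ N≤m) (ℕ.m⊔n≤o⇒m≤o N₁ N₂ N≤n))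
          (h₂ m n (ℕ.m⊔n≤o⇒n≤o N₁ N₂ N≤m) (ℕ.m⊔n≤o⇒n≤o N₁ N₂ N≤n))))
  where open +-*-Solver

neg-cauchy : ∀ {x} → IsCauchy x → IsCauchy (λ n → ℚ.- x n)
neg-cauchy {x} cx ε 0<ε with N , h ← cx ε 0<ε = N , λ m n N≤m N≤n →
  subst (λ r → ℚ.∣ r ∣ ℚ.< ε)
    (solve 2 (λ a b → a :- b := (:- b) :- (:- a)) refl (x n) (x m))
    (h n m N≤n N≤m)
  where open +-*-Solver

cauchy-bound : ∀ {x} → IsCauchy x →
  ∃[ B ] 0ℚ ℚ.< B × ∃[ N ] (∀ n → N ℕ.≤ n → ℚ.∣ x n ∣ ℚ.≤ B)
cauchy-bound {x} cx with N , h ← cx 1ℚ 0<1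
  = 1ℚ ℚ.+ ℚ.∣ x N ∣ , pos+ 0<1 (ℚ.0≤∣p∣ (x N)) , N , λ n N≤n →
    ℚ.≤-trans
      (subst (λ r → ℚ.∣ r ∣ ℚ.≤ ℚ.∣ x n ℚ.- x N ∣ ℚ.+ ℚ.∣ x N ∣)
        (solve 2 (λ a b → (a :- b) :+ b := a) refl (x n) (x N))
        (ℚ.∣p+q∣≤∣p∣+∣q∣ (x n ℚ.- x N) (x N)))
      (ℚ.+-monoˡ-≤ ℚ.∣ x N ∣ (ℚ.<⇒≤ (h n N N≤n ℕ.≤-refl)))
  where open +-*-Solver

*-close : ∀ {B C η} p q r s → 0ℚ ℚ.< B → 0ℚ ℚ.< C →
          ℚ.∣ p ∣ ℚ.≤ B → ℚ.∣ s ∣ ℚ.≤ C →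
          ℚ.∣ q ℚ.- s ∣ ℚ.< η → ℚ.∣ p ℚ.- r ∣ ℚ.< η →
          ℚ.∣ p ℚ.* q ℚ.- r ℚ.* s ∣ ℚ.< (B ℚ.+ C) ℚ.* η
*-close {B} {C} {η} p q r s 0<B 0<C ∣p∣≤B ∣s∣≤C ∣q-s∣<η ∣p-r∣<η = begin-strict
  ℚ.∣ p ℚ.* q ℚ.- r ℚ.* s ∣
    ≡⟨ cong ℚ.∣_∣ (solve 4 (λ p q r s →
         p :* q :- r :* s := p :* (q :- s) :+ s :* (p :- r)) refl p q r s) ⟩
  ℚ.∣ p ℚ.* (q ℚ.- s) ℚ.+ s ℚ.* (p ℚ.- r) ∣
    ≤⟨ ℚ.∣p+q∣≤∣p∣+∣q∣ (p ℚ.* (q ℚ.- s)) (s ℚ.* (p ℚ.- r)) ⟩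
  ℚ.∣ p ℚ.* (q ℚ.- s) ∣ ℚ.+ ℚ.∣ s ℚ.* (p ℚ.- r) ∣
    ≡⟨ cong₂ ℚ._+_ (ℚ.∣p*q∣≡∣p∣*∣q∣ p (q ℚ.- s)) (ℚ.∣p*q∣≡∣p∣*∣q∣ s (p ℚ.- r)) ⟩
  ℚ.∣ p ∣ ℚ.* ℚ.∣ q ℚ.- s ∣ ℚ.+ ℚ.∣ s ∣ ℚ.* ℚ.∣ p ℚ.- r ∣
    <⟨ ℚ.+-mono-< (*-mono-nonNeg-< 0<B (ℚ.0≤∣p∣ (q ℚ.- s)) ∣p∣≤B ∣q-s∣<η)
                  (*-mono-nonNeg-< 0<C (ℚ.0≤∣p∣ (p ℚ.- r)) ∣s∣≤C ∣p-r∣<η) ⟩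
  B ℚ.* η ℚ.+ C ℚ.* η
    ≡⟨ ℚ.*-distribʳ-+ η B C ⟨
  (B ℚ.+ C) ℚ.* η ∎
  where
  open ℚ.≤-Reasoning
  open +-*-Solver

*-inv-cancel : ∀ {p} → 0ℚ ℚ.< p → ∀ ε → p ℚ.* (ε ℚ.* inv p) ≡ ε
*-inv-cancel {p} 0<p ε = trans
  (solve 3 (λ p e i → p :* (e :* i) := e :* (p :* i)) refl p ε (inv p))
  (trans (cong (ε ℚ.*_) (*-inv-pos 0<p)) (ℚ.*-identityʳ ε))
  where open +-*-Solver

*-cauchy : ∀ {x y} → IsCauchy x → IsCauchy y → IsCauchy (λ n → x n ℚ.* y n)
*-cauchy {x} {y} cx cy ε 0<ε =
  let B , 0<B , M₁ , bx = cauchy-bound {x} cx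
      C , 0<C , M₂ , by = cauchy-bound {y} cy
      0<K     = pos+ 0<B (ℚ.<⇒≤ 0<C)
      η       = ε ℚ.* inv (B ℚ.+ C)
      0<η     = pos* 0<ε (0<inv 0<K)
      N₁ , h₁ = cx η 0<η
      N₂ , h₂ = cy η 0<η
      M       = M₁ ℕ.⊔ M₂
      N       = N₁ ℕ.⊔ N₂
  in M ℕ.⊔ N , λ m n L≤m L≤n →
    let M≤m = ℕ.m⊔n≤o⇒m≤o M N L≤m
        M≤n = ℕ.m⊔n≤o⇒m≤o M N L≤n
        N≤m = ℕ.m⊔n≤o⇒n≤o M N L≤m
        N≤n = ℕ.m⊔n≤o⇒n≤o M N L≤n
    in subst (ℚ.∣ x m ℚ.* y m ℚ.- x n ℚ.* y n ∣ ℚ.<_) (*-inv-cancel 0<K ε)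
      (*-close (x m) (y m) (x n) (y n) 0<B 0<C
        (bx m (ℕ.m⊔n≤o⇒m≤o M₁ M₂ M≤m)) (by n (ℕ.m⊔n≤o⇒n≤o M₁ M₂ M≤n))
        (h₂ m n (ℕ.m⊔n≤o⇒n≤o N₁ N₂ N≤m) (ℕ.m⊔n≤o⇒n≤o N₁ N₂ N≤n))
        (h₁ m n (ℕ.m⊔n≤o⇒m≤o N₁ N₂ N≤m) (ℕ.m⊔n≤o⇒m≤o N₁ N₂ N≤n)))

inv-close : ∀ {δ ε} p q → 0ℚ ℚ.< δ → δ ℚ.≤ ℚ.∣ p ∣ → δ ℚ.≤ ℚ.∣ q ∣ →
            ℚ.∣ q ℚ.- p ∣ ℚ.< ε ℚ.* (δ ℚ.* δ) → ℚ.∣ inv p ℚ.- inv q ∣ ℚ.< ε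
inv-close {δ} {ε} p q 0<δ δ≤∣p∣ δ≤∣q∣ ∣q-p∣< = begin-strict
  ℚ.∣ inv p ℚ.- inv q ∣
    ≡⟨ cong ℚ.∣_∣ (inv-diff (≢0 δ≤∣p∣) (≢0 δ≤∣q∣)) ⟩
  ℚ.∣ (q ℚ.- p) ℚ.* (inv p ℚ.* inv q) ∣
    ≡⟨ cong ℚ.∣_∣ (ℚ.*-comm (q ℚ.- p) (inv p ℚ.* inv q)) ⟩
  ℚ.∣ inv p ℚ.* inv q ℚ.* (q ℚ.- p) ∣
    ≡⟨ ℚ.∣p*q∣≡∣p∣*∣q∣ (inv p ℚ.* inv q) (q ℚ.- p) ⟩
  ℚ.∣ inv p ℚ.* inv q ∣ ℚ.* ℚ.∣ q ℚ.- p ∣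
    <⟨ *-mono-nonNeg-< (pos* (0<inv 0<δ) (0<inv 0<δ)) (ℚ.0≤∣p∣ (q ℚ.- p))
         ∣inv∣²≤ ∣q-p∣< ⟩
  inv δ ℚ.* inv δ ℚ.* (ε ℚ.* (δ ℚ.* δ))
    ≡⟨ solve 3 (λ e d i →
         (i :* i) :* (e :* (d :* d)) := e :* ((d :* i) :* (d :* i))) refl ε δ (inv δ) ⟩
  ε ℚ.* ((δ ℚ.* inv δ) ℚ.* (δ ℚ.* inv δ))
    ≡⟨ cong (λ r → ε ℚ.* (r ℚ.* r)) (*-inv-pos 0<δ) ⟩
  ε ℚ.* 1ℚ
    ≡⟨ ℚ.*-identityʳ ε ⟩
  ε ∎
  where
  open ℚ.≤-Reasoning
  open +-*-Solver
  ≢0 : ∀ {p} → δ ℚ.≤ ℚ.∣ p ∣ → p ≢ 0ℚ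
  ≢0 δ≤ refl = ℚ.<-irrefl refl (ℚ.<-≤-trans 0<δ δ≤)
  ∣inv∣²≤ : ℚ.∣ inv p ℚ.* inv q ∣ ℚ.≤ inv δ ℚ.* inv δ
  ∣inv∣²≤ = subst (ℚ._≤ inv δ ℚ.* inv δ) (sym (ℚ.∣p*q∣≡∣p∣*∣q∣ (inv p) (inv q)))
    (*-mono-nonNeg-≤ (ℚ.0≤∣p∣ (inv p)) (ℚ.<⇒≤ (0<inv 0<δ))
      (∣inv∣≤ {p} 0<δ δ≤∣p∣) (∣inv∣≤ {q} 0<δ δ≤∣q∣))

BoundedAway : (ℕ → ℚ) → Set
BoundedAway x = ∃[ δ ] 0ℚ ℚ.< δ × ∃[ M ] (∀ n → M ℕ.≤ n → δ ℚ.≤ ℚ.∣ x n ∣)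

inv-cauchy : ∀ {x} → IsCauchy x → BoundedAway x → IsCauchy (λ n → inv (x n))
inv-cauchy {x} cx (δ , 0<δ , M , b) ε 0<ε =
  let N , h = cx (ε ℚ.* (δ ℚ.* δ)) (pos* 0<ε (pos* 0<δ 0<δ))
  in M ℕ.⊔ N , λ m n L≤m L≤n →
    inv-close (x m) (x n) 0<δ
      (b m (ℕ.m⊔n≤o⇒m≤o M N L≤m)) (b n (ℕ.m⊔n≤o⇒m≤o M N L≤n))
      (h n m (ℕ.m⊔n≤o⇒n≤o M N L≤n) (ℕ.m⊔n≤o⇒n≤o M N L≤m))

fromℚ : ℚ → ℝ
fromℚ p = mkℝ (λ _ → p) (const-cauchy p)

0ᴿ 1ᴿ : ℝ
0ᴿ = fromℚ 0ℚ
1ᴿ = fromℚ 1ℚ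

infixl 6 _+ᴿ_ _-ᴿ_
infixl 7 _*ᴿ_
infix  8 -ᴿ_

_+ᴿ_ : ℝ → ℝ → ℝ
mkℝ x cx +ᴿ mkℝ y cy = mkℝ (λ n → x n ℚ.+ y n) (+-cauchy {x} {y} cx cy)

-ᴿ_ : ℝ → ℝ
-ᴿ mkℝ x cx = mkℝ (λ n → ℚ.- x n) (neg-cauchy {x} cx)

_-ᴿ_ : ℝ → ℝ → ℝ
x -ᴿ y = x +ᴿ -ᴿ y

_*ᴿ_ : ℝ → ℝ → ℝ
mkℝ x cx *ᴿ mkℝ y cy = mkℝ (λ n → x n ℚ.* y n) (*-cauchy {x} {y} cx cy)

#⇒bounded : ∀ x → x #ᴿ 0ᴿ → BoundedAway (seq x)
#⇒bounded x (inj₁ (ε , 0<ε , N , h)) = ε , 0<ε , N , λ n N≤n → ℚ.≤-trans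
  (subst₂ ℚ._≤_
    (solve 2 (λ a e → (a :+ e) :- a := e) refl (seq x n) ε)
    (ℚ.+-identityˡ (ℚ.- seq x n))
    (ℚ.+-monoˡ-≤ (ℚ.- seq x n) (h n N≤n)))
  (-p≤∣p∣ (seq x n))
  where open +-*-Solver
#⇒bounded x (inj₂ (ε , 0<ε , N , h)) = ε , 0<ε , N , λ n N≤n → ℚ.≤-trans
  (subst (ℚ._≤ seq x n) (ℚ.+-identityˡ ε) (h n N≤n))
  (p≤∣p∣ (seq x n))

-- The n-th rational is inverted wherever it is nonzero, which holds from some
-- index on.
invᴿ : (x : ℝ) → x #ᴿ 0ᴿ → ℝ
invᴿ x x#0 =
  mkℝ (λ n → inv (seq x n)) (inv-cauchy {seq x} (isCauchy x) (#⇒bounded x x#0))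

------------------------------------------------------------------------
-- Square roots

-- Starting from k = 0, moves from k to k + 1 when P (k + 1) holds.
step : ∀ {Q : Set} → ℕ → Dec Q → ℕ
step k (yes _) = suc k
step k (no  _) = k

search : ∀ {P : ℕ → Set} → (∀ k → Dec (P k)) → (fuel : ℕ) → ℕ
search P? zero    = 0
search P? (suc f) = step (search P? f) (P? (suc (search P? f)))

search-lower : ∀ {P : ℕ → Set} (P? : ∀ k → Dec (P k)) f →
               search P? f ≡ 0 ⊎ P (search P? f)
search-lower P? zero    = inj₁ refl
search-lower P? (suc f) with P? (suc (search P? f))
... | yes p = inj₂ p
... | no _  = search-lower P? f

search-upper : ∀ {P : ℕ → Set} (P? : ∀ k → Dec (P k)) f →
               ¬ P (suc (search P? f)) ⊎ search P? f ≡ f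
search-upper P? zero    = inj₂ refl
search-upper P? (suc f) with P? (suc (search P? f))
... | no ¬p = inj₁ ¬p
... | yes p with search-upper P? f
...   | inj₁ ¬p = contradiction p ¬p
...   | inj₂ e  = inj₂ (cong suc e)

sq : ℚ → ℚ
sq p = p ℚ.* p

grid : ℕ → ℕ → ℚ
grid n k = fromℕ k ℚ.* 1/[1+ n ]

fuel : ℕ → ℚ → ℕ
fuel n v = ℤ.∣ ℚ.↥ ((1ℚ ℚ.+ ℚ.∣ v ∣) ℚ.* fromℕ (suc n)) ∣

grid²≤? : ∀ n v k → Dec (sq (grid n k) ℚ.≤ v)
grid²≤? n v k = sq (grid n k) ℚ.≤? v

-- For v ≥ 0, rootℚ n v is the largest multiple s of δ = 1/(n+1) with s² ≤ v;
-- for v < 0 it is 0.  The search runs through 0, δ, 2δ, …, and its fuel is at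
-- least (1 + ∣v∣)/δ, so that it stops before running out.
rootℚ : ℕ → ℚ → ℚ
rootℚ n v = grid n (search (grid²≤? n v) (fuel n v))

grid-suc : ∀ n k → grid n (suc k) ≡ grid n k ℚ.+ 1/[1+ n ]
grid-suc n k = trans (cong (ℚ._* 1/[1+ n ]) (fromℕ-suc k))
  (trans (ℚ.*-distribʳ-+ 1/[1+ n ] (fromℕ k) 1ℚ)
    (cong (grid n k ℚ.+_) (ℚ.*-identityˡ 1/[1+ n ])))

0≤grid : ∀ n k → 0ℚ ℚ.≤ grid n k
0≤grid n k = nonNeg* (0≤fromℕ k) (ℚ.<⇒≤ (0<1/ n))

fuel-enough : ∀ n v → 1ℚ ℚ.+ ℚ.∣ v ∣ ℚ.≤ grid n (fuel n v)
fuel-enough n v = subst (ℚ._≤ grid n (fuel n v))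
  (trans (ℚ.*-assoc w (fromℕ (suc n)) 1/[1+ n ])
    (trans (cong (w ℚ.*_) (ℚ.*-inverseʳ (fromℕ (suc n)))) (ℚ.*-identityʳ w)))
  (ℚ.*-monoʳ-≤-nonNeg 1/[1+ n ] {{ℚ.nonNegative (ℚ.<⇒≤ (0<1/ n))}}
    (≤-fromℕ (w ℚ.* fromℕ (suc n))))
  where
  w : ℚ
  w = 1ℚ ℚ.+ ℚ.∣ v ∣

v<sq : ∀ {v w} → 1ℚ ℚ.+ ℚ.∣ v ∣ ℚ.≤ w → v ℚ.< sq w
v<sq {v} {w} 1+∣v∣≤w = ℚ.<-≤-trans v<w
  (subst (ℚ._≤ sq w) (ℚ.*-identityˡ w)
    (ℚ.*-monoʳ-≤-nonNeg w {{ℚ.nonNegative (ℚ.≤-trans (ℚ.<⇒≤ 0<1) 1≤w)}} 1≤w))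
  where
  1≤w : 1ℚ ℚ.≤ w
  1≤w = ℚ.≤-trans
    (subst (ℚ._≤ 1ℚ ℚ.+ ℚ.∣ v ∣) (ℚ.+-identityʳ 1ℚ) (ℚ.+-monoʳ-≤ 1ℚ (ℚ.0≤∣p∣ v)))
    1+∣v∣≤w
  v<w : v ℚ.< w
  v<w = ℚ.<-≤-trans
    (subst (ℚ._< 1ℚ ℚ.+ ℚ.∣ v ∣) (ℚ.+-identityˡ v) (ℚ.+-mono-<-≤ 0<1 (p≤∣p∣ v)))
    1+∣v∣≤w

0≤rootℚ : ∀ n v → 0ℚ ℚ.≤ rootℚ n v
0≤rootℚ n v = 0≤grid n (search (grid²≤? n v) (fuel n v))

rootℚ-lower : ∀ n v → rootℚ n v ≡ 0ℚ ⊎ sq (rootℚ n v) ℚ.≤ v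
rootℚ-lower n v = Sum.map₁
  (λ e → trans (cong (grid n) e) (ℚ.*-zeroˡ 1/[1+ n ]))
  (search-lower (grid²≤? n v) (fuel n v))

rootℚ-upper : ∀ n v → v ℚ.< sq (rootℚ n v ℚ.+ 1/[1+ n ])
rootℚ-upper n v = subst (λ r → v ℚ.< sq r) (grid-suc n k)
  (Sum.[ ℚ.≰⇒> , stopped ]′ (search-upper (grid²≤? n v) (fuel n v)))
  where
  k : ℕ
  k = search (grid²≤? n v) (fuel n v)
  stopped : k ≡ fuel n v → v ℚ.< sq (grid n (suc k))
  stopped e = v<sq {v} {grid n (suc k)} (ℚ.≤-trans (fuel-enough n v)
    (subst₂ ℚ._≤_
      (trans (ℚ.+-identityʳ (grid n k)) (cong (grid n) e)) (sym (grid-suc n k))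
      (ℚ.+-monoʳ-≤ (grid n k) (ℚ.<⇒≤ (0<1/ n)))))

root-close : ∀ {s u b v ε} → s ≡ 0ℚ ⊎ sq s ℚ.≤ u → 0ℚ ℚ.≤ b → v ℚ.< sq b →
             0ℚ ℚ.< ε → u ℚ.< v ℚ.+ sq ε → s ℚ.< b ℚ.+ ε
root-close {b = b} {ε = ε} (inj₁ refl) 0≤b _ 0<ε _ =
  subst (0ℚ ℚ.<_) (ℚ.+-comm ε b) (pos+ 0<ε 0≤b)
root-close {b = b} {ε = ε} (inj₂ s²≤u) 0≤b v<b² 0<ε u<v+ε² =
  sq-cancel-< (nonNeg+ 0≤b (ℚ.<⇒≤ 0<ε))
    (ℚ.≤-<-trans s²≤u (ℚ.<-trans u<v+ε² (ℚ.<-≤-trans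
      (ℚ.+-monoˡ-< (sq ε) v<b²)
      (subst₂ ℚ._≤_ (ℚ.+-identityʳ (sq b ℚ.+ sq ε))
        (solve 2 (λ b e → (b :* b :+ e :* e) :+ (b :* e :+ b :* e)
            := (b :+ e) :* (b :+ e)) refl b ε)
        (ℚ.+-monoʳ-≤ (sq b ℚ.+ sq ε) (nonNeg+ 0≤bε 0≤bε))))))
  where
  open +-*-Solver
  0≤bε : 0ℚ ℚ.≤ b ℚ.* ε
  0≤bε = nonNeg* 0≤b (ℚ.<⇒≤ 0<ε)

rootℚ-close : ∀ m n u v {ε} → 0ℚ ℚ.< ε → 1/[1+ n ] ℚ.< ε → u ℚ.< v ℚ.+ sq ε →
              rootℚ m u ℚ.- rootℚ n v ℚ.< ε ℚ.+ ε
rootℚ-close m n u v {ε} 0<ε δ<ε u<v+ε² = p<q+ε⇒p-q<ε (ℚ.<-trans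
  (root-close (rootℚ-lower m u) (nonNeg+ (0≤rootℚ n v) (ℚ.<⇒≤ (0<1/ n)))
    (rootℚ-upper n v) 0<ε u<v+ε²)
  (subst (rootℚ n v ℚ.+ 1/[1+ n ] ℚ.+ ε ℚ.<_)
    (ℚ.+-assoc (rootℚ n v) ε ε)
    (ℚ.+-monoˡ-< ε (ℚ.+-monoʳ-< (rootℚ n v) δ<ε))))

∣-∣-< : ∀ p q {ε} → p ℚ.- q ℚ.< ε → q ℚ.- p ℚ.< ε → ℚ.∣ p ℚ.- q ∣ ℚ.< ε
∣-∣-< p q {ε} h₁ h₂ = ∣∣-< h₁ (subst (ℚ._< ε)
  (solve 2 (λ p q → q :- p := :- (p :- q)) refl p q) h₂)
  where open +-*-Solver

root-cauchy : ∀ {x} → IsCauchy x → IsCauchy (λ n → rootℚ n (x n))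
root-cauchy {x} cx ε 0<ε =
  let 0<η     = pos* 0<½ 0<ε
      N₁ , h₁ = cx (sq (½ ℚ.* ε)) (pos* 0<η 0<η)
      N₂ , h₂ = 1/-small 0<η
      close m n L≤m L≤n = subst (rootℚ m (x m) ℚ.- rootℚ n (x n) ℚ.<_) (½+½ ε)
        (rootℚ-close m n (x m) (x n) 0<η
          (h₂ n (ℕ.m⊔n≤o⇒n≤o N₁ N₂ L≤n))
          (p-q<ε⇒p<q+ε (ℚ.≤-<-trans (p≤∣p∣ (x m ℚ.- x n))
            (h₁ m n (ℕ.m⊔n≤o⇒m≤o N₁ N₂ L≤m) (ℕ.m⊔n≤o⇒m≤o N₁ N₂ L≤n)))))
  in N₁ ℕ.⊔ N₂ , λ m n L≤m L≤n →
    ∣-∣-< (rootℚ m (x m)) (rootℚ n (x n)) (close m n L≤m L≤n) (close n m L≤n L≤m)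

-- √ x is 0 for x ≤ 0.
√ : ℝ → ℝ
√ x = mkℝ (λ n → rootℚ n (seq x n)) (root-cauchy {seq x} (isCauchy x))

------------------------------------------------------------------------
-- Complex numbers

record ℂ : Set where
  constructor _+i_
  field
    re im : ℝ

open ℂ public

infix  4 _≈_ _#_
infixl 6 _+_ _-_
infixl 7 _*_ _/_[_]
infix  8 -_
infix  9 _⁻¹[_]

_≈_ : ℂ → ℂ → Set
z ≈ w = re z ≈ᴿ re w × im z ≈ᴿ im w

-- Inequality of real and of complex numbers is read as apartness; a number can
-- be inverted only if it is known to be apart from 0.
_#_ : ℂ → ℂ → Set
z # w = re z #ᴿ re w ⊎ im z #ᴿ im w

0ℂ 1ℂ : ℂ
0ℂ = 0ᴿ +i 0ᴿ
1ℂ = 1ᴿ +i 0ᴿ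

_+_ : ℂ → ℂ → ℂ
(x +i y) + (u +i v) = (x +ᴿ u) +i (y +ᴿ v)

-_ : ℂ → ℂ
- (x +i y) = (-ᴿ x) +i (-ᴿ y)

_-_ : ℂ → ℂ → ℂ
z - w = z + - w

_*_ : ℂ → ℂ → ℂ
(x +i y) * (u +i v) = (x *ᴿ u -ᴿ y *ᴿ v) +i (x *ᴿ v +ᴿ y *ᴿ u)

ℂ-rawRing : RawRing 0ℓ 0ℓ
ℂ-rawRing = record
  { Carrier = ℂ ; _≈_ = _≈_ ; _+_ = _+_ ; _*_ = _*_ ; -_ = -_ ; 0# = 0ℂ ; 1# = 1ℂ }

open RawSemiringDefs (RawRing.rawSemiring ℂ-rawRing) public using (_^_)

normSq : ℂ → ℝ
normSq (x +i y) = x *ᴿ x +ᴿ y *ᴿ y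

∣_∣ : ℂ → ℝ
∣ z ∣ = √ (normSq z)

sq-bound : ∀ {δ} p → 0ℚ ℚ.< δ → δ ℚ.≤ ℚ.∣ p ∣ → sq δ ℚ.≤ sq p
sq-bound {δ} p 0<δ δ≤∣p∣ =
  subst (sq δ ℚ.≤_) (∣p∣²≡p² p) (sq-mono-≤ (ℚ.<⇒≤ 0<δ) δ≤∣p∣)

normSq>0 : ∀ z → z # 0ℂ → 0ᴿ <ᴿ normSq z
normSq>0 (x +i y) (inj₁ x#0) =
  let δ , 0<δ , M , b = #⇒bounded x x#0
  in sq δ , pos* 0<δ 0<δ , M , λ n M≤n →
    subst (ℚ._≤ sq (seq x n) ℚ.+ sq (seq y n)) (ℚ.+-comm (sq δ) 0ℚ)
      (ℚ.+-mono-≤ (sq-bound (seq x n) 0<δ (b n M≤n)) (0≤p² (seq y n)))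
normSq>0 (x +i y) (inj₂ y#0) =
  let δ , 0<δ , M , b = #⇒bounded y y#0
  in sq δ , pos* 0<δ 0<δ , M , λ n M≤n →
    ℚ.+-mono-≤ (0≤p² (seq x n)) (sq-bound (seq y n) 0<δ (b n M≤n))

_⁻¹[_] : (z : ℂ) → z # 0ℂ → ℂ
z@(x +i y) ⁻¹[ z#0 ] = (x *ᴿ r) +i ((-ᴿ y) *ᴿ r)
  where
  r : ℝ
  r = invᴿ (normSq z) (inj₂ (normSq>0 z z#0))

_/_[_] : (z w : ℂ) → w # 0ℂ → ℂ
z / w [ w#0 ] = z * w ⁻¹[ w#0 ]

------------------------------------------------------------------------
-- Limits, series and q-shifted factorials

infix 4 _⟶_

_⟶_ : (ℕ → ℂ) → ℂ → Set
z ⟶ l = ∀ ε → 0ᴿ <ᴿ ε → ∃[ N ] (∀ n → N ℕ.≤ n → ∣ z n - l ∣ <ᴿ ε)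

partialSum : (ℕ → ℂ) → ℕ → ℂ
partialSum t zero    = 0ℂ
partialSum t (suc n) = partialSum t n + t n

-- All c n are nonzero, and ∑ b n / c n converges to s.
infix 4 ∑_/_⟶_

∑_/_⟶_ : (b c : ℕ → ℂ) → ℂ → Set
∑ b / c ⟶ s = Σ[ c#0 ∈ (∀ n → c n # 0ℂ) ]
  partialSum (λ n → b n / c n [ c#0 n ]) ⟶ s

-- (x; q)ₙ
poch : (x q : ℂ) → ℕ → ℂ
poch x q zero    = 1ℂ
poch x q (suc n) = poch x q n * (1ℂ - x * q ^ n)

-- (x; q)_∞ converges to p.
poch∞ : (x q : ℂ) → ℂ → Set
poch∞ x q p = poch x q ⟶ p

module Submission where

-- Write F(a) for the first series, and G(a), H(a) for the second and third
-- expressions, where the infinite product is moved into the sum and cancels the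
-- denominators (-aq²; q²)ₙ and (-aq³; q²)ₙ.  Comparing terms gives
--   F(a) = F(aq) + aq² F(aq²),
--   G(a) = H(aq) + aq² G(aq²),
--   H(a) = G(aq) + aq² H(aq²),
-- already for truncated sums, up to a factor that tends to 1.  Hence e(a) = F(a) - G(a)
-- and e'(a) = F(a) - H(a) satisfy e(a) = e'(aq) + aq² e(aq²) and
-- e'(a) = e(aq) + aq² e'(aq²).  All three functions are 1 + O(qᵏ) at aqᵏ, so iterating
-- these recurrences shows that e and e' vanish.
--
-- Constructively, for each N either ∣ q ∣ is so small that ∣ a q^(2N) ∣ ≤ 1/2, or
-- q # 0 and the hypothesis applies; in both cases 1 + a q^(2N) is apart from 0.

open import Defs hiding (_≈_; _#_; _+_; _-_; _*_; -_; _^_; _⁻¹[_]; _/_[_]; poch; partialSum)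

open import Algebra.Bundles using (CommutativeRing; CommutativeSemiring)
import Algebra.Solver.Ring.NaturalCoefficients.Default as NaturalSolver
open import Algebra.Structures using (IsMagma; IsSemigroup; IsMonoid; IsGroup; IsRing)
open import Data.Bool.Base using (Bool; true; false; not; if_then_else_)
open import Data.Integer.Base as ℤ using (+_)
import Data.Integer.Properties as ℤ
open import Data.Nat.Base as ℕ using (ℕ; zero; suc)
import Data.Nat.Properties as ℕ
import Data.Nat.Solver as ℕ
open import Data.Product.Base using (∃-syntax; _×_; _,_; proj₁; proj₂)
open import Data.Rational.Base as ℚ using (ℚ; 0ℚ; 1ℚ; ½; *≤*)
import Data.Rational.Properties as ℚ
open import Data.Rational.Solver using () renaming (module +-*-Solver to ℚS)
open import Algebra.Definitions.RawSemiring ℚ.+-*-rawSemiring using () renaming (_^_ to _^ℚ_)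
open import Data.Sum.Base as Sum using (_⊎_; inj₁; inj₂)
open import Level using (0ℓ)
open import Relation.Binary.PropositionalEquality as ≡
  using (_≡_; cong; cong₂; subst; subst₂)
import Relation.Binary.Reasoning.Setoid as SetoidReasoning
open import Relation.Binary.Structures using (IsEquivalence)
open import Relation.Nullary.Decidable using (yes; no)

-- Recurrences between truncated series

-- Once the products are moved into the sums, no denominator depends on `a`, so the common limit of
-- `F`, `G` and `H` is a statement without division by such terms. The condition on `a` enters where
-- the limit of `G` or `H` is factored into product times series; there the equality comes from
-- uniqueness of limits, and the infinite product is never inverted. Two equalities occur. Algebra
-- uses the equality of the ring, while limits are determined only up to `_≋_`, and a bound crosses
-- `_≋_` only at the price of a positive slack. Iterating the recurrences for e and e' pays this
-- price at every step, so the slack is chosen proportional to the bound being proved and absorbed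
-- into the majorant `growth`. The iteration needs one constant L that bounds e and e' at a qᵏ by L
-- rᵏ for all k at once. For this reason all three sequences go through a single convergence
-- estimate that is linear in the size of the perturbation.

module Recurrences (R : CommutativeSemiring 0ℓ 0ℓ)
  (q : CommutativeSemiring.Carrier R)
  (p : ℕ → CommutativeSemiring.Carrier R)
  (p-zero : CommutativeSemiring._≈_ R (p 0) (CommutativeSemiring.1# R))
  (p-suc : ∀ n → CommutativeSemiring._≈_ R (p (suc n)) (CommutativeSemiring._*_ R q (p n)))
  where

  open CommutativeSemiring R
  open NaturalSolver R
  open SetoidReasoning setoid

  -- power n x = xⁿ q^(n²), where p n = qⁿ
  power : ℕ → Carrier → Carrier
  power zero    x = 1#
  power (suc n) x = x * (q * (p n * p n)) * power n x

  -- With f n = 1 / (q; q)ₙ and d n = 1 / (q²; q²)ₙ, F f n a is a partial sum of the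
  -- first series, and G d n a and H d n a are (-aq²; q²)ₙ and (-aq³; q²)ₙ times the
  -- partial sums of the second and the third.
  F G H : (ℕ → Carrier) → ℕ → Carrier → Carrier
  F f zero    x = 1#
  F f (suc n) x = F f n x + power (suc n) x * p (suc n) * f (suc n)
  G d zero    x = 1#
  G d (suc n) x = (1# + x * (p (suc n) * p (suc n))) * G d n x
                  + power (suc n) x * (p (suc n) * p (suc n)) * d (suc n)
  H d zero    x = 1#
  H d (suc n) x = (1# + x * q * (p (suc n) * p (suc n))) * H d n x
                  + power (suc n) x * p (suc n) * d (suc n)

  power-shift : ∀ n x → power n (x * q) ≈ p n * power n x
  power-shift zero    x = sym (trans (*-identityʳ (p 0)) p-zero)
  power-shift (suc n) x = begin
    x * q * (q * (p n * p n)) * power n (x * q)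
      ≈⟨ *-congˡ (power-shift n x) ⟩
    x * q * (q * (p n * p n)) * (p n * power n x)
      ≈⟨ solve 4 (λ x q p a → x :* q :* (q :* (p :* p)) :* (p :* a)
           := q :* p :* (x :* (q :* (p :* p)) :* a)) refl x q (p n) (power n x) ⟩
    q * p n * power (suc n) x
      ≈⟨ *-congʳ (p-suc n) ⟨
    p (suc n) * power (suc n) x ∎

  -- (n + 1)² = n² + 2n + 1: the argument x q² supplies the 2n, the prefactor x q the 1.
  power-suc : ∀ n x → x * q * power n (x * q * q) ≈ power (suc n) x
  power-suc n x = begin
    x * q * power n (x * q * q)
      ≈⟨ *-congˡ (trans (power-shift n (x * q)) (*-congˡ (power-shift n x))) ⟩
    x * q * (p n * (p n * power n x))
      ≈⟨ solve 4 (λ x q p a → x :* q :* (p :* (p :* a)) := x :* (q :* (p :* p)) :* a)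
           refl x q (p n) (power n x) ⟩
    power (suc n) x ∎

  -- The hypothesis on `f` is 1/(q; q)ₙ₊₁ = 1/(q; q)ₙ + q^(n+1)/(q; q)ₙ₊₁. In term n + 1 at x the
  -- last part gives term n + 1 at x q, the other one x q² times term n at x q²; hence the lower
  -- truncation of the last sum.
  F-shift : ∀ f → f 0 ≈ 1# → (∀ n → f (suc n) ≈ f n + p (suc n) * f (suc n)) →
            ∀ n x → F f (suc n) x ≈ F f (suc n) (x * q) + x * q * q * F f n (x * q * q)
  F-shift f f-zero f-suc = go
    where
    term : ∀ n x → power (suc n) x * p (suc n) * f (suc n)
           ≈ power (suc n) (x * q) * p (suc n) * f (suc n)
             + x * q * q * (power n (x * q * q) * p n * f n)
    term n x = begin
      power (suc n) x * p (suc n) * f (suc n)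
        ≈⟨ *-congˡ (f-suc n) ⟩
      power (suc n) x * p (suc n) * (f n + p (suc n) * f (suc n))
        ≈⟨ solve 4 (λ a b c d → a :* b :* (c :+ b :* d)
             := b :* a :* b :* d :+ a :* b :* c)
             refl (power (suc n) x) (p (suc n)) (f n) (f (suc n)) ⟩
      p (suc n) * power (suc n) x * p (suc n) * f (suc n)
        + power (suc n) x * p (suc n) * f n
        ≈⟨ +-cong (*-congʳ (*-congʳ (sym (power-shift (suc n) x))))
             (*-congʳ (*-cong (sym (power-suc n x)) (p-suc n))) ⟩
      power (suc n) (x * q) * p (suc n) * f (suc n)
        + x * q * power n (x * q * q) * (q * p n) * f n
        ≈⟨ +-congˡ (solve 5 (λ x q a b c → x :* q :* a :* (q :* b) :* c
             := x :* q :* q :* (a :* b :* c))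
             refl x q (power n (x * q * q)) (p n) (f n)) ⟩
      power (suc n) (x * q) * p (suc n) * f (suc n)
        + x * q * q * (power n (x * q * q) * p n * f n) ∎
    go : ∀ n x → F f (suc n) x ≈ F f (suc n) (x * q) + x * q * q * F f n (x * q * q)
    go zero x = begin
      1# + power 1 x * p 1 * f 1
        ≈⟨ +-congˡ (term 0 x) ⟩
      1# + (power 1 (x * q) * p 1 * f 1 + x * q * q * (1# * p 0 * f 0))
        ≈⟨ +-congˡ (+-congˡ (*-congˡ (trans (*-cong (trans (*-identityˡ _) p-zero) f-zero)
             (*-identityˡ 1#)))) ⟩
      1# + (power 1 (x * q) * p 1 * f 1 + x * q * q * 1#)
        ≈⟨ +-assoc _ _ _ ⟨
      1# + power 1 (x * q) * p 1 * f 1 + x * q * q * 1# ∎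
    go (suc n) x = begin
      F f (suc n) x + power (suc (suc n)) x * p (suc (suc n)) * f (suc (suc n))
        ≈⟨ +-cong (go n x) (term (suc n) x) ⟩
      (F f (suc n) (x * q) + y * F f n (x * q * q))
        + (power (suc (suc n)) (x * q) * p (suc (suc n)) * f (suc (suc n))
           + y * (power (suc n) (x * q * q) * p (suc n) * f (suc n)))
        ≈⟨ solve 5 (λ a b c d y → (a :+ y :* b) :+ (c :+ y :* d)
             := a :+ c :+ y :* (b :+ d)) refl _ _ _ _ y ⟩
      F f (suc (suc n)) (x * q) + y * F f (suc n) (x * q * q) ∎
      where
      y : Carrier
      y = x * q * q

  module _ (d : ℕ → Carrier) (d-zero : d 0 ≈ 1#)
    (d-suc : ∀ n → d (suc n) ≈ d n + p (suc n) * p (suc n) * d (suc n)) where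

    -- The terms split as in `F-shift`, with base q². Moreover, the factor 1 + x q^(2n+3) that
    -- enters `H` at x in step n + 1 enters `G` at x q in the same step and `H` at x q² one step
    -- earlier, so it distributes over both summands.
    H-shift : ∀ n x → H d (suc n) x ≈ G d (suc n) (x * q) + x * q * q * H d n (x * q * q)
    H-shift n x = begin
      (1# + g n) * H d n x + power (suc n) x * p (suc n) * d (suc n)
        ≈⟨ +-congˡ (term n) ⟩
      (1# + g n) * H d n x + (power (suc n) (x * q) * (p (suc n) * p (suc n)) * d (suc n)
        + y * (power n (x * q * q) * p n * d n))
        ≈⟨ rest n ⟩
      G d (suc n) (x * q) + y * H d n (x * q * q) ∎
      where
      y : Carrier
      y = x * q * q
      g : ℕ → Carrier
      g n = x * q * (p (suc n) * p (suc n))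
      g-suc : ∀ n → g (suc n) ≈ y * q * (p (suc n) * p (suc n))
      g-suc n = trans (*-congˡ (*-cong (p-suc (suc n)) (p-suc (suc n))))
        (solve 3 (λ x q p → x :* q :* (q :* p :* (q :* p)) := x :* q :* q :* q :* (p :* p))
          refl x q (p (suc n)))
      term : ∀ n → power (suc n) x * p (suc n) * d (suc n)
             ≈ power (suc n) (x * q) * (p (suc n) * p (suc n)) * d (suc n)
               + y * (power n (x * q * q) * p n * d n)
      term n = begin
        power (suc n) x * p (suc n) * d (suc n)
          ≈⟨ *-congˡ (d-suc n) ⟩
        power (suc n) x * p (suc n) * (d n + p (suc n) * p (suc n) * d (suc n))
          ≈⟨ solve 4 (λ a b c d → a :* b :* (c :+ b :* b :* d)
               := b :* a :* (b :* b) :* d :+ a :* b :* c)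
               refl (power (suc n) x) (p (suc n)) (d n) (d (suc n)) ⟩
        p (suc n) * power (suc n) x * (p (suc n) * p (suc n)) * d (suc n)
          + power (suc n) x * p (suc n) * d n
          ≈⟨ +-cong (*-congʳ (*-congʳ (sym (power-shift (suc n) x))))
               (*-congʳ (*-cong (sym (power-suc n x)) (p-suc n))) ⟩
        power (suc n) (x * q) * (p (suc n) * p (suc n)) * d (suc n)
          + x * q * power n (x * q * q) * (q * p n) * d n
          ≈⟨ +-congˡ (solve 5 (λ x q a b c → x :* q :* a :* (q :* b) :* c
               := x :* q :* q :* (a :* b :* c))
               refl x q (power n (x * q * q)) (p n) (d n)) ⟩
        power (suc n) (x * q) * (p (suc n) * p (suc n)) * d (suc n)
          + y * (power n (x * q * q) * p n * d n) ∎
      rest : ∀ n → (1# + g n) * H d n x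
             + (power (suc n) (x * q) * (p (suc n) * p (suc n)) * d (suc n)
               + y * (power n (x * q * q) * p n * d n))
             ≈ G d (suc n) (x * q) + y * H d n (x * q * q)
      rest zero = begin
        (1# + g 0) * 1# + (power 1 (x * q) * (p 1 * p 1) * d 1 + y * (1# * p 0 * d 0))
          ≈⟨ +-congˡ (+-congˡ (*-congˡ (trans (*-cong (trans (*-identityˡ _) p-zero) d-zero)
               (*-identityˡ 1#)))) ⟩
        (1# + g 0) * 1# + (power 1 (x * q) * (p 1 * p 1) * d 1 + y * 1#)
          ≈⟨ +-assoc _ _ _ ⟨
        G d 1 (x * q) + y * 1# ∎
      rest (suc n) = begin
        (1# + g (suc n)) * H d (suc n) x
          + (power (suc (suc n)) (x * q) * (p (suc (suc n)) * p (suc (suc n))) * d (suc (suc n))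
            + y * (power (suc n) (x * q * q) * p (suc n) * d (suc n)))
          ≈⟨ +-congʳ (*-congˡ (trans (+-congˡ (term n)) (rest n))) ⟩
        (1# + g (suc n)) * (G d (suc n) (x * q) + y * H d n (x * q * q))
          + (power (suc (suc n)) (x * q) * (p (suc (suc n)) * p (suc (suc n))) * d (suc (suc n))
            + y * (power (suc n) (x * q * q) * p (suc n) * d (suc n)))
          ≈⟨ solve 6 (λ g a h b c y → (con 1 :+ g) :* (a :+ y :* h) :+ (b :+ y :* c)
               := ((con 1 :+ g) :* a :+ b) :+ y :* ((con 1 :+ g) :* h :+ c))
               refl (g (suc n)) _ _ _ _ y ⟩
        G d (suc (suc n)) (x * q)
          + y * ((1# + g (suc n)) * H d n (x * q * q)
            + power (suc n) (x * q * q) * p (suc n) * d (suc n))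
          ≈⟨ +-congˡ (*-congˡ (+-congʳ (*-congʳ (+-congˡ (g-suc n))))) ⟩
        G d (suc (suc n)) (x * q) + y * H d (suc n) (x * q * q) ∎

  -- The factors in `H` at x q are those in `G` at x from the second on, so 1 + x q^(2n+2) has to be
  -- supplied on the left. When a new term of `G` is multiplied by such a factor 1 + c, the part 1
  -- gives the term of `H` at x q and the part c gives x q² times the term of `G` at x q².
  G-shift : ∀ d n x → (1# + x * (p (suc n) * p (suc n))) * G d n x
            ≈ H d n (x * q) + x * q * q * G d n (x * q * q)
  G-shift d zero x = begin
    (1# + x * (p 1 * p 1)) * 1#
      ≈⟨ *-congʳ (+-congˡ (*-congˡ (*-cong p-one p-one))) ⟩
    (1# + x * (q * q)) * 1#
      ≈⟨ solve 2 (λ x q → (con 1 :+ x :* (q :* q)) :* con 1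
           := con 1 :+ x :* q :* q :* con 1) refl x q ⟩
    1# + x * q * q * 1# ∎
    where
    p-one : p 1 ≈ q
    p-one = trans (p-suc 0) (trans (*-congˡ p-zero) (*-identityʳ q))
  G-shift d (suc n) x = begin
    (1# + c) * ((1# + x * (P * P)) * G d n x + a * (P * P) * d (suc n))
      ≈⟨ *-congˡ (+-congʳ (G-shift d n x)) ⟩
    (1# + c) * ((H d n (x * q) + y * G d n (x * q * q)) + a * (P * P) * d (suc n))
      ≈⟨ solve 5 (λ c h y g t → (con 1 :+ c) :* ((h :+ y :* g) :+ t)
           := ((con 1 :+ c) :* h :+ t) :+ (y :* ((con 1 :+ c) :* g) :+ c :* t))
           refl c _ y _ _ ⟩
    ((1# + c) * H d n (x * q) + a * (P * P) * d (suc n))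
      + (y * ((1# + c) * G d n (x * q * q)) + c * (a * (P * P) * d (suc n)))
      ≈⟨ +-cong (+-cong (*-congʳ (+-congˡ c-shift)) (*-congʳ (trans
             (solve 2 (λ a P → a :* (P :* P) := P :* a :* P) refl a P)
             (*-congʳ (sym (power-shift (suc n) x))))))
           (+-cong (*-congˡ (*-congʳ (+-congˡ c-shift))) tail) ⟩
    ((1# + x * q * q * (P * P)) * H d n (x * q) + power (suc n) (x * q) * P * d (suc n))
      + (y * ((1# + x * q * q * (P * P)) * G d n (x * q * q))
        + y * (power (suc n) (x * q * q) * (P * P) * d (suc n)))
      ≈⟨ +-congˡ (distribˡ y _ _) ⟨
    H d (suc n) (x * q) + y * G d (suc n) (x * q * q) ∎
    where
    P a c y : Carrier
    P = p (suc n)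
    a = power (suc n) x
    c = x * (p (suc (suc n)) * p (suc (suc n)))
    y = x * q * q
    c-shift : c ≈ x * q * q * (P * P)
    c-shift = trans (*-congˡ (*-cong (p-suc (suc n)) (p-suc (suc n))))
      (solve 3 (λ x q P → x :* (q :* P :* (q :* P)) := x :* q :* q :* (P :* P)) refl x q P)
    tail : c * (a * (P * P) * d (suc n))
           ≈ y * (power (suc n) (x * q * q) * (P * P) * d (suc n))
    tail = begin
      c * (a * (P * P) * d (suc n))
        ≈⟨ *-congʳ c-shift ⟩
      x * q * q * (P * P) * (a * (P * P) * d (suc n))
        ≈⟨ solve 4 (λ y P a d → y :* (P :* P) :* (a :* (P :* P) :* d)
             := y :* (P :* (P :* a) :* (P :* P) :* d)) refl y P a (d (suc n)) ⟩
      y * (P * (P * a) * (P * P) * d (suc n))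
        ≈⟨ *-congˡ (*-congʳ (*-congʳ (trans (power-shift (suc n) (x * q))
             (*-congˡ (power-shift (suc n) x))))) ⟨
      y * (power (suc n) (x * q * q) * (P * P) * d (suc n)) ∎

-- Rational estimates

2ℚ : ℚ
2ℚ = 1ℚ ℚ.+ 1ℚ

+⇒≤ : ∀ {p q} d → 0ℚ ℚ.≤ d → q ≡ p ℚ.+ d → p ℚ.≤ q
+⇒≤ {p} d 0≤d e = subst₂ ℚ._≤_ (ℚ.+-identityʳ p) (≡.sym e) (ℚ.+-monoʳ-≤ p 0≤d)

p≤q⇒0≤q-p : ∀ {p q} → p ℚ.≤ q → 0ℚ ℚ.≤ q ℚ.- p
p≤q⇒0≤q-p {p} {q} p≤q =
  subst (ℚ._≤ q ℚ.- p) (ℚ.+-inverseʳ p) (ℚ.+-monoˡ-≤ (ℚ.- p) p≤q)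

p<q⇒0<q-p : ∀ {p q} → p ℚ.< q → 0ℚ ℚ.< q ℚ.- p
p<q⇒0<q-p {p} {q} p<q =
  subst (ℚ._< q ℚ.- p) (ℚ.+-inverseʳ p) (ℚ.+-monoˡ-< (ℚ.- p) p<q)

*-monoˡ-≤ : ∀ {p q} r → 0ℚ ℚ.≤ r → p ℚ.≤ q → r ℚ.* p ℚ.≤ r ℚ.* q
*-monoˡ-≤ r 0≤r = ℚ.*-monoˡ-≤-nonNeg r {{ℚ.nonNegative 0≤r}}

*-monoʳ-≤ : ∀ {p q} r → 0ℚ ℚ.≤ r → p ℚ.≤ q → p ℚ.* r ℚ.≤ q ℚ.* r
*-monoʳ-≤ r 0≤r = ℚ.*-monoʳ-≤-nonNeg r {{ℚ.nonNegative 0≤r}}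

0≤1 : 0ℚ ℚ.≤ 1ℚ
0≤1 = ℚ.<⇒≤ 0<1

fromℕ-mono-≤ : ∀ {m n} → m ℕ.≤ n → fromℕ m ℚ.≤ fromℕ n
fromℕ-mono-≤ {m} {n} m≤n = *≤* (subst₂ ℤ._≤_
  (≡.sym (ℤ.*-identityʳ (+ m))) (≡.sym (ℤ.*-identityʳ (+ n))) (ℤ.+≤+ m≤n))

sq-cancel-≤ : ∀ {p q} → 0ℚ ℚ.≤ q → sq p ℚ.≤ sq q → p ℚ.≤ q
sq-cancel-≤ 0≤q p²≤q² = ℚ.≮⇒≥ λ q<p → ℚ.<-irrefl ≡.refl
  (ℚ.<-≤-trans (*-mono-nonNeg-< (ℚ.≤-<-trans 0≤q q<p) 0≤q (ℚ.<⇒≤ q<p) q<p) p²≤q²)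

-- This is (-D; r)ₙ, the majorant of `power`, of the sequences in `product-limit` and of the
-- iterated recurrence.
growth : ℚ → ℚ → ℕ → ℚ
growth r D zero    = 1ℚ
growth r D (suc n) = (1ℚ ℚ.+ D ℚ.* r ^ℚ n) ℚ.* growth r D n

-- Splitting off the first factor instead of the last replaces D by D r, which allows an induction
-- on how small D is.
growth-suc : ∀ r D n → growth r D (suc n) ≡ (1ℚ ℚ.+ D) ℚ.* growth r (D ℚ.* r) n
growth-suc r D zero    = ℚS.solve 1 (λ D →
  (ℚS.con 1ℚ ℚS.:+ D ℚS.:* ℚS.con 1ℚ) ℚS.:* ℚS.con 1ℚ
    ℚS.:= (ℚS.con 1ℚ ℚS.:+ D) ℚS.:* ℚS.con 1ℚ) ≡.refl D
growth-suc r D (suc n) =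
  ≡.trans (cong ((1ℚ ℚ.+ D ℚ.* (r ℚ.* r ^ℚ n)) ℚ.*_) (growth-suc r D n))
    (ℚS.solve 4 (λ r D p g →
      (ℚS.con 1ℚ ℚS.:+ D ℚS.:* (r ℚS.:* p)) ℚS.:* ((ℚS.con 1ℚ ℚS.:+ D) ℚS.:* g)
        ℚS.:= (ℚS.con 1ℚ ℚS.:+ D) ℚS.:* ((ℚS.con 1ℚ ℚS.:+ D ℚS.:* r ℚS.:* p) ℚS.:* g))
      ≡.refl r D (r ^ℚ n) (growth r (D ℚ.* r) n))

module Geometric {r : ℚ} (0<r : 0ℚ ℚ.< r) (r<1 : r ℚ.< 1ℚ) where

  open ℚS

  0≤r : 0ℚ ℚ.≤ r
  0≤r = ℚ.<⇒≤ 0<r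

  r≤1 : r ℚ.≤ 1ℚ
  r≤1 = ℚ.<⇒≤ r<1

  0<1-r : 0ℚ ℚ.< 1ℚ ℚ.- r
  0<1-r = p<q⇒0<q-p r<1

  0≤1-r : 0ℚ ℚ.≤ 1ℚ ℚ.- r
  0≤1-r = ℚ.<⇒≤ 0<1-r

  0<r^ : ∀ n → 0ℚ ℚ.< r ^ℚ n
  0<r^ zero    = 0<1
  0<r^ (suc n) = pos* 0<r (0<r^ n)

  0≤r^ : ∀ n → 0ℚ ℚ.≤ r ^ℚ n
  0≤r^ n = ℚ.<⇒≤ (0<r^ n)

  r*≤ : ∀ {p} → 0ℚ ℚ.≤ p → p ℚ.* r ℚ.≤ p
  r*≤ {p} 0≤p = subst (p ℚ.* r ℚ.≤_) (ℚ.*-identityʳ p) (*-monoˡ-≤ p 0≤p r≤1)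

  r^≤1 : ∀ n → r ^ℚ n ℚ.≤ 1ℚ
  r^≤1 zero    = ℚ.≤-refl
  r^≤1 (suc n) = ℚ.≤-trans (subst (ℚ._≤ r ^ℚ n) (ℚ.*-comm (r ^ℚ n) r) (r*≤ (0≤r^ n))) (r^≤1 n)

  -- A division-free weakening of Bernoulli's inequality for 1/r; the induction step loses (n + 1)
  -- (1 - r)² rⁿ.
  bernoulli : ∀ n → r ^ℚ n ℚ.* (1ℚ ℚ.+ fromℕ n ℚ.* (1ℚ ℚ.- r)) ℚ.≤ 1ℚ
  bernoulli zero    = ℚ.≤-reflexive
    (solve 1 (λ h → con 1ℚ :* (con 1ℚ :+ con 0ℚ :* h) := con 1ℚ) ≡.refl (1ℚ ℚ.- r))
  bernoulli (suc n) = ℚ.≤-trans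
    (+⇒≤ (r ^ℚ n ℚ.* ((fromℕ n ℚ.+ 1ℚ) ℚ.* sq (1ℚ ℚ.- r)))
      (nonNeg* (0≤r^ n) (nonNeg* (nonNeg+ (0≤fromℕ n) 0≤1) (0≤p² (1ℚ ℚ.- r))))
      (≡.trans (solve 3 (λ r p n → p :* (con 1ℚ :+ n :* (con 1ℚ :- r))
          := r :* p :* (con 1ℚ :+ (n :+ con 1ℚ) :* (con 1ℚ :- r))
             :+ p :* ((n :+ con 1ℚ) :* ((con 1ℚ :- r) :* (con 1ℚ :- r)))) ≡.refl r (r ^ℚ n) (fromℕ n))
        (cong (λ k → r ℚ.* r ^ℚ n ℚ.* (1ℚ ℚ.+ k ℚ.* (1ℚ ℚ.- r))
          ℚ.+ r ^ℚ n ℚ.* ((fromℕ n ℚ.+ 1ℚ) ℚ.* sq (1ℚ ℚ.- r))) (≡.sym (fromℕ-suc n)))))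
    (bernoulli n)

  r^-small : ∀ C {η} → 0ℚ ℚ.< η → ∃[ N ] (∀ n → N ℕ.≤ n → C ℚ.* r ^ℚ n ℚ.≤ η)
  r^-small C {η} 0<η = N , λ n N≤n → ℚ.≤-trans
    (*-monoʳ-≤ (r ^ℚ n) (0≤r^ n) (C≤ n N≤n))
    (+⇒≤ (η ℚ.* (1ℚ ℚ.- r ^ℚ n ℚ.* (1ℚ ℚ.+ fromℕ n ℚ.* (1ℚ ℚ.- r)) ℚ.+ r ^ℚ n))
      (nonNeg* (ℚ.<⇒≤ 0<η) (nonNeg+ (p≤q⇒0≤q-p (bernoulli n)) (0≤r^ n)))
      (solve 4 (λ n h e p → e := n :* (h :* e) :* p
          :+ e :* (con 1ℚ :- p :* (con 1ℚ :+ n :* h) :+ p))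
        ≡.refl (fromℕ n) (1ℚ ℚ.- r) η (r ^ℚ n)))
    where
    hη : ℚ
    hη = (1ℚ ℚ.- r) ℚ.* η
    0<hη : 0ℚ ℚ.< hη
    0<hη = pos* 0<1-r 0<η
    -- A rational is at most the absolute value of its numerator, so N ≥ C / ((1 - r) η).
    N : ℕ
    N = ℤ.∣ ℚ.↥ (C ℚ.* inv hη) ∣
    C≤ : ∀ n → N ℕ.≤ n → C ℚ.≤ fromℕ n ℚ.* hη
    C≤ n N≤n = subst (ℚ._≤ fromℕ n ℚ.* hη)
      (≡.trans (ℚ.*-comm (C ℚ.* inv hη) hη) (*-inv-cancel 0<hη C))
      (*-monoʳ-≤ hη (ℚ.<⇒≤ 0<hη) (ℚ.≤-trans (≤-fromℕ (C ℚ.* inv hη)) (fromℕ-mono-≤ N≤n)))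

  1≤growth : ∀ {D} → 0ℚ ℚ.≤ D → ∀ n → 1ℚ ℚ.≤ growth r D n
  1≤growth     0≤D zero    = ℚ.≤-refl
  1≤growth {D} 0≤D (suc n) = *-mono-nonNeg-≤ {1ℚ} {1ℚ ℚ.+ D ℚ.* r ^ℚ n} {1ℚ} {growth r D n}
    0≤1 (ℚ.≤-trans 0≤1 (1≤growth 0≤D n))
    (+⇒≤ (D ℚ.* r ^ℚ n) (nonNeg* 0≤D (0≤r^ n)) ≡.refl) (1≤growth 0≤D n)

  -- The slack rⁿ makes the induction close: with p = rⁿ, (1 + (1 - r) p / 2) (2 - p) falls short of
  -- 2 - r p by (1 - r) p² / 2.
  growth-small : ∀ {D} → 0ℚ ℚ.≤ D → D ℚ.≤ ½ ℚ.* (1ℚ ℚ.- r) →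
                 ∀ n → growth r D n ℚ.≤ 2ℚ ℚ.- r ^ℚ n
  growth-small     0≤D D≤ zero    = ℚ.≤-refl
  growth-small {D} 0≤D D≤ (suc n) = ℚ.≤-trans
    (*-mono-nonNeg-≤ (ℚ.≤-trans 0≤1 (+⇒≤ (D ℚ.* p) (nonNeg* 0≤D (0≤r^ n)) ≡.refl))
      (ℚ.≤-trans (ℚ.≤-trans 0≤1 (1≤growth 0≤D n)) (growth-small 0≤D D≤ n))
      (ℚ.+-monoʳ-≤ 1ℚ (*-monoʳ-≤ p (0≤r^ n) D≤))
      (growth-small 0≤D D≤ n))
    (+⇒≤ (½ ℚ.* (1ℚ ℚ.- r) ℚ.* (p ℚ.* p))
      (nonNeg* (nonNeg* (ℚ.<⇒≤ 0<½) 0≤1-r) (nonNeg* (0≤r^ n) (0≤r^ n)))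
      (solve 2 (λ r p → con 2ℚ :- r :* p
        := (con 1ℚ :+ con ½ :* (con 1ℚ :- r) :* p) :* (con 2ℚ :- p)
           :+ con ½ :* (con 1ℚ :- r) :* (p :* p)) ≡.refl r p))
    where
    p : ℚ
    p = r ^ℚ n

  -- After finitely many factors are removed in front, D rᴺ is small enough for `growth-small`; each
  -- removed factor is put back into the bound.
  growth-bounded : ∀ {D} → 0ℚ ℚ.≤ D → ∃[ K ] 1ℚ ℚ.≤ K × (∀ n → growth r D n ℚ.≤ K)
  growth-bounded {D} 0≤D =
    let N , small = r^-small D (pos* 0<½ 0<1-r)
    in go N D 0≤D (small N ℕ.≤-refl)
    where
    go : ∀ N D → 0ℚ ℚ.≤ D → D ℚ.* r ^ℚ N ℚ.≤ ½ ℚ.* (1ℚ ℚ.- r) →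
         ∃[ K ] 1ℚ ℚ.≤ K × (∀ n → growth r D n ℚ.≤ K)
    go zero D 0≤D D≤ = 2ℚ , +⇒≤ 1ℚ 0≤1 ≡.refl , λ n → ℚ.≤-trans
      (growth-small 0≤D (subst (ℚ._≤ ½ ℚ.* (1ℚ ℚ.- r)) (ℚ.*-identityʳ D) D≤) n)
      (+⇒≤ (r ^ℚ n) (0≤r^ n) (solve 1 (λ p → con 2ℚ := (con 2ℚ :- p) :+ p) ≡.refl (r ^ℚ n)))
    go (suc N) D 0≤D D≤ =
      let K , 1≤K , bound = go N (D ℚ.* r) (nonNeg* 0≤D 0≤r)
            (subst (ℚ._≤ ½ ℚ.* (1ℚ ℚ.- r)) (≡.sym (ℚ.*-assoc D r (r ^ℚ N))) D≤)
          0≤1+D = nonNeg+ 0≤1 0≤D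
          1≤K′ = ℚ.≤-trans 1≤K (+⇒≤ (D ℚ.* K) (nonNeg* 0≤D (ℚ.≤-trans 0≤1 1≤K))
            (solve 2 (λ D K → (con 1ℚ :+ D) :* K := K :+ D :* K) ≡.refl D K))
      in (1ℚ ℚ.+ D) ℚ.* K , 1≤K′ , λ where
        zero    → 1≤K′
        (suc n) → subst (ℚ._≤ (1ℚ ℚ.+ D) ℚ.* K) (≡.sym (growth-suc r D n))
          (*-monoˡ-≤ (1ℚ ℚ.+ D) 0≤1+D (bound n))

-- Limits in a complete normed ring

Eventually : (ℕ → Set) → Set
Eventually P = ∃[ N ] (∀ n → N ℕ.≤ n → P n)

ev-map : ∀ {P Q : ℕ → Set} → (∀ n → P n → Q n) → Eventually P → Eventually Q
ev-map f (N , p) = N , λ n N≤n → f n (p n N≤n)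

ev-map₂ : ∀ {P Q R : ℕ → Set} → (∀ n → P n → Q n → R n) → Eventually P → Eventually Q → Eventually R
ev-map₂ f (M , p) (N , q) = M ℕ.⊔ N , λ n L≤n →
  f n (p n (ℕ.m⊔n≤o⇒m≤o M N L≤n)) (q n (ℕ.m⊔n≤o⇒n≤o M N L≤n))

-- z ≼ r and z ≽ r play the roles of ∣ z ∣ ≤ r and ∣ z ∣ ≥ r.
record NormedRing : Set₁ where
  infix 4 _≼_ _≽_
  field
    commutativeRing : CommutativeRing 0ℓ 0ℓ
  open CommutativeRing commutativeRing public
  field
    _≼_ _≽_   : Carrier → ℚ → Set
    ≼⇒0≤      : ∀ {z r} → z ≼ r → 0ℚ ℚ.≤ r
    ≼-resp-≈  : ∀ {z w r} → z ≈ w → z ≼ r → w ≼ r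
    ≼-mono    : ∀ {z r s} → z ≼ r → r ℚ.≤ s → z ≼ s
    ≼-+       : ∀ {z w r s} → z ≼ r → w ≼ s → z + w ≼ r ℚ.+ s
    ≼-*       : ∀ {z w r s} → z ≼ r → w ≼ s → z * w ≼ r ℚ.* s
    ≼-neg     : ∀ {z r} → z ≼ r → - z ≼ r
    0≼        : ∀ {r} → 0ℚ ℚ.≤ r → 0# ≼ r
    1≼1       : 1# ≼ 1ℚ
    has-bound : ∀ z → ∃[ B ] 0ℚ ℚ.< B × z ≼ B
    ≽-resp-≈  : ∀ {z w r} → z ≈ w → z ≽ r → w ≽ r
    ≽-mono    : ∀ {z r s} → z ≽ r → 0ℚ ℚ.≤ s → s ℚ.≤ r → z ≽ s
    ≽-*       : ∀ {z w r s} → z ≽ r → w ≽ s → z * w ≽ r ℚ.* s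
    ≽-+       : ∀ {z w r s} → z ≽ r ℚ.+ s → w ≼ s → 0ℚ ℚ.≤ r → z + w ≽ r
    1≽1       : 1# ≽ 1ℚ
    inverse   : ∀ {z δ} → 0ℚ ℚ.< δ → z ≽ δ → ∃[ w ] z * w ≈ 1#
    inverse-≼ : ∀ {z w δ} → 0ℚ ℚ.< δ → z ≽ δ → z * w ≈ 1# → w ≼ inv δ
    -- The two ranges overlap, so a rational approximation can decide between them; this replaces
    -- the distinction between z = 0 and z ≠ 0.
    small-or-apart : ∀ z {s} → 0ℚ ℚ.< s → z ≼ s ⊎ z ≽ ½ ℚ.* s
    complete  : (z : ℕ → Carrier) →
      (∀ η → 0ℚ ℚ.< η → ∃[ N ] (∀ m n → N ℕ.≤ m → N ℕ.≤ n → z m - z n ≼ η)) →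
      ∃[ l ] (∀ η → 0ℚ ℚ.< η → Eventually λ n → z n - l ≼ η)

module Limits (𝓡 : NormedRing) where

  open NormedRing 𝓡
  open NaturalSolver commutativeSemiring

  infix 4 _≋_ _⇝_

  -- The equality of the ring may be finer than what limits determine; this is the coarser one. It
  -- is a record so that both sides can be inferred.
  record _≋_ (z w : Carrier) : Set where
    constructor mk≋
    field
      null : ∀ η → 0ℚ ℚ.< η → z - w ≼ η

  record _⇝_ (z : ℕ → Carrier) (l : Carrier) : Set where
    constructor mk⇝
    field
      close : ∀ η → 0ℚ ℚ.< η → Eventually λ n → z n - l ≼ η

  open _≋_ public
  open _⇝_ public

  ≼-resp-≡ : ∀ {z r s} → r ≡ s → z ≼ r → z ≼ s
  ≼-resp-≡ {z} = subst (z ≼_)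

  +-cancel : ∀ x y → x + (- y + y) ≈ x
  +-cancel x y = trans (+-congˡ (-‿inverseˡ y)) (+-identityʳ x)

  diff-+ : ∀ x y z → (x - y) + (y - z) ≈ x - z
  diff-+ x y z = trans
    (solve 4 (λ x y′ y z′ → (x :+ y′) :+ (y :+ z′) := (x :+ z′) :+ (y′ :+ y)) refl x (- y) y (- z))
    (+-cancel (x - z) y)

  neg-+ : ∀ x y → - (x + y) ≈ - x + - y
  neg-+ x y = sym (-‿+-comm x y)
    where open import Algebra.Properties.Ring ring using (-‿+-comm)

  neg-neg : ∀ x → - - x ≈ x
  neg-neg = -‿involutive
    where open import Algebra.Properties.Ring ring using (-‿involutive)

  *-neg : ∀ x y → x * - y ≈ - (x * y)
  *-neg x y = sym (-‿distribʳ-* x y)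
    where open import Algebra.Properties.Ring ring using (-‿distribʳ-*)

  diff-swap : ∀ x y → - (x - y) ≈ y - x
  diff-swap x y = trans (neg-+ x (- y)) (trans (+-congˡ (neg-neg y)) (+-comm (- x) y))

  diff-+-diff : ∀ x y x′ y′ → (x - x′) + (y - y′) ≈ (x + y) - (x′ + y′)
  diff-+-diff x y x′ y′ = trans
    (solve 4 (λ x m y n → (x :+ m) :+ (y :+ n) := (x :+ y) :+ (m :+ n)) refl x (- x′) y (- y′))
    (+-congˡ (sym (neg-+ x′ y′)))

  *-diff : ∀ x y z → x * (y - z) ≈ x * y - x * z
  *-diff x y z = trans (distribˡ x y (- z)) (+-congˡ (*-neg x z))

  self-diff : ∀ x y → x + y - x ≈ y
  self-diff x y = trans (solve 3 (λ x y m → x :+ y :+ m := y :+ (m :+ x)) refl x y (- x))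
    (+-cancel y x)

  ≼-diff-trans : ∀ {x y z r s} → x - y ≼ r → y - z ≼ s → x - z ≼ r ℚ.+ s
  ≼-diff-trans {x} {y} {z} h k = ≼-resp-≈ (diff-+ x y z) (≼-+ h k)

  ≼-diff-sym : ∀ {x y r} → x - y ≼ r → y - x ≼ r
  ≼-diff-sym {x} {y} h = ≼-resp-≈ (diff-swap x y) (≼-neg h)

  half : ∀ {η} → 0ℚ ℚ.< η → 0ℚ ℚ.< ½ ℚ.* η
  half = pos* 0<½

  ≈⇒≋ : ∀ {x y} → x ≈ y → x ≋ y
  ≈⇒≋ {x} {y} x≈y = mk≋ λ η 0<η → ≼-resp-≈
    (sym (trans (+-congʳ x≈y) (-‿inverseʳ y))) (0≼ (ℚ.<⇒≤ 0<η))

  ≋-sym : ∀ {x y} → x ≋ y → y ≋ x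
  ≋-sym h = mk≋ λ η 0<η → ≼-diff-sym (null h η 0<η)

  ≋-trans : ∀ {x y z} → x ≋ y → y ≋ z → x ≋ z
  ≋-trans h k = mk≋ λ η 0<η → ≼-resp-≡ (½+½ η)
    (≼-diff-trans (null h _ (half 0<η)) (null k _ (half 0<η)))

  ≋-+ : ∀ {x y x′ y′} → x ≋ x′ → y ≋ y′ → x + y ≋ x′ + y′
  ≋-+ {x} {y} {x′} {y′} h k = mk≋ λ η 0<η → ≼-resp-≡ (½+½ η)
    (≼-resp-≈ (diff-+-diff x y x′ y′) (≼-+ (null h _ (half 0<η)) (null k _ (half 0<η))))

  ≋-neg : ∀ {x y} → x ≋ y → - x ≋ - y
  ≋-neg {x} {y} h = mk≋ λ η 0<η → ≼-resp-≈ (neg-+ x (- y)) (≼-neg (null h η 0<η))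

  -- Arbitrarily small differences do not transfer the bound s itself, since `_≼_` need not be
  -- closed under limits; any positive slack suffices.
  ≼-resp-≋ : ∀ {x y s η} → x ≋ y → 0ℚ ℚ.< η → y ≼ s → x ≼ s ℚ.+ η
  ≼-resp-≋ {x} {y} {s} {η} h 0<η y≼s = ≼-resp-≡ (ℚ.+-comm η s)
    (≼-resp-≈ (trans (+-assoc x (- y) y) (+-cancel x y)) (≼-+ (null h η 0<η) y≼s))

  ⇝-unique : ∀ {z l m} → z ⇝ l → z ⇝ m → l ≋ m
  ⇝-unique {z} h k = mk≋ λ η 0<η →
    let M , h′ = close h _ (half 0<η)
        N , k′ = close k _ (half 0<η)
    in ≼-resp-≡ (½+½ η) (≼-diff-trans
         (≼-diff-sym (h′ (M ℕ.⊔ N) (ℕ.m≤m⊔n M N))) (k′ (M ℕ.⊔ N) (ℕ.m≤n⊔m M N)))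

  ⇝-resp-≈ : ∀ {z w l} → (∀ n → z n ≈ w n) → z ⇝ l → w ⇝ l
  ⇝-resp-≈ e h = mk⇝ λ η 0<η → ev-map (λ n → ≼-resp-≈ (+-congʳ (e n))) (close h η 0<η)

  ⇝-resp-≋ : ∀ {z l m} → l ≋ m → z ⇝ l → z ⇝ m
  ⇝-resp-≋ h k = mk⇝ λ η 0<η → ev-map (λ n z-l → ≼-resp-≡ (½+½ η)
    (≼-diff-trans z-l (null h _ (half 0<η)))) (close k _ (half 0<η))

  ⇝-const : ∀ l → (λ _ → l) ⇝ l
  ⇝-const l = mk⇝ λ η 0<η → 0 , λ _ _ → ≼-resp-≈ (sym (-‿inverseʳ l)) (0≼ (ℚ.<⇒≤ 0<η))

  ⇝-suc : ∀ {z l} → z ⇝ l → (λ n → z (suc n)) ⇝ l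
  ⇝-suc h = mk⇝ λ η 0<η → let N , h′ = close h η 0<η in
    N , λ n N≤n → h′ (suc n) (ℕ.m≤n⇒m≤1+n N≤n)

  ⇝-pred : ∀ {z l} → (λ n → z (suc n)) ⇝ l → z ⇝ l
  ⇝-pred {z} {l} h = mk⇝ λ η 0<η → suc (proj₁ (close h η 0<η)) , λ where
    (suc n) (ℕ.s≤s N≤n) → proj₂ (close h η 0<η) n N≤n

  ⇝-+ : ∀ {z w l m} → z ⇝ l → w ⇝ m → (λ n → z n + w n) ⇝ l + m
  ⇝-+ {z} {w} {l} {m} h k = mk⇝ λ η 0<η → ev-map₂
    (λ n a b → ≼-resp-≡ (½+½ η) (≼-resp-≈ (diff-+-diff (z n) (w n) l m) (≼-+ a b)))
    (close h _ (half 0<η)) (close k _ (half 0<η))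

  ⇝-* : ∀ {z w l m} → z ⇝ l → w ⇝ m → (λ n → z n * w n) ⇝ l * m
  ⇝-* {z} {w} {l} {m} h k =
    let B , 0<B , l≼B = has-bound l
        C , 0<C , m≼C = has-bound m
        -- `z n` is bounded by 1 + B once it is within 1 of l, so the two parts of the error are (1
        -- + B) ε and C ε.
        K = 1ℚ ℚ.+ B ℚ.+ C
        0<K = pos+ (pos+ 0<1 (ℚ.<⇒≤ 0<B)) (ℚ.<⇒≤ 0<C)
        z≼ = ev-map (λ n a → ≼-resp-≈ (trans (+-assoc (z n) (- l) l) (+-cancel (z n) l))
               (≼-+ a l≼B)) (close h 1ℚ 0<1)
    in mk⇝ λ η 0<η →
      let ε = η ℚ.* inv K
          0<ε = pos* 0<η (0<inv 0<K)
          sum≡ = ≡.trans (ℚS.solve 4 (λ i b c e →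
              (i ℚS.:+ b) ℚS.:* e ℚS.:+ c ℚS.:* e ℚS.:= (i ℚS.:+ b ℚS.:+ c) ℚS.:* e)
              ≡.refl 1ℚ B C ε) (*-inv-cancel 0<K η)
      in ev-map₂ (λ n (a , b) c → ≼-resp-≡ sum≡ (≼-resp-≈ (split (z n) (w n))
             (≼-+ (≼-* b c) (≼-* m≼C a))))
           (ev-map₂ (λ n a b → a , b) (close h ε 0<ε) z≼) (close k ε 0<ε)
    where
    split : ∀ x y → x * (y - m) + m * (x - l) ≈ x * y - l * m
    split x y = trans (+-cong (*-diff x y m) (trans (*-diff m x l)
      (+-cong (*-comm m x) (-‿cong (*-comm m l))))) (diff-+ (x * y) (x * m) (l * m))

  module _ {r : ℚ} (0<r : 0ℚ ℚ.< r) (r<1 : r ℚ.< 1ℚ) where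

    open Geometric 0<r r<1

    vanishing⇒⇝0 : ∀ {z : ℕ → Carrier} {C} → (∀ n → z n ≼ C ℚ.* r ^ℚ n) → z ⇝ 0#
    vanishing⇒⇝0 {z} {C} h = mk⇝ λ η 0<η → ev-map (λ n le →
        ≼-resp-≈ (sym (trans (+-congˡ -0#≈0#) (+-identityʳ (z n)))) (≼-mono (h n) le))
      (r^-small C 0<η)
      where open import Algebra.Properties.Ring ring using (-0#≈0#)

    -- With D = C / (1 - r), C rʲ = D (rʲ - rʲ⁺¹); keeping the difference in the bound makes the
    -- induction exact.
    telescope : ∀ {z : ℕ → Carrier} {C} → (∀ n → z (suc n) - z n ≼ C ℚ.* r ^ℚ n) →
                ∀ k n → z (k ℕ.+ n) - z n
                  ≼ C ℚ.* inv (1ℚ ℚ.- r) ℚ.* (r ^ℚ n ℚ.- r ^ℚ (k ℕ.+ n))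
    telescope {z} {C} h zero    n = ≼-resp-≈ (sym (-‿inverseʳ (z n))) (0≼ (ℚ.≤-reflexive
      (ℚS.solve 2 (λ D p → ℚS.con 0ℚ ℚS.:= D ℚS.:* (p ℚS.:- p)) ≡.refl
        (C ℚ.* inv (1ℚ ℚ.- r)) (r ^ℚ n))))
    telescope {z} {C} h (suc k) n = ≼-resp-≡ (≡.trans
        (cong (λ x → x ℚ.* R ℚ.+ D ℚ.* (r ^ℚ n ℚ.- R)) (≡.sym C≡))
        (ℚS.solve 4 (λ r D p t → (ℚS.con 1ℚ ℚS.:- r) ℚS.:* D ℚS.:* t ℚS.:+ D ℚS.:* (p ℚS.:- t)
          ℚS.:= D ℚS.:* (p ℚS.:- r ℚS.:* t)) ≡.refl r D (r ^ℚ n) R))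
      (≼-diff-trans {z (suc (k ℕ.+ n))} {z (k ℕ.+ n)} {z n} (h (k ℕ.+ n))
        (telescope {z} {C} h k n))
      where
      R D : ℚ
      R = r ^ℚ (k ℕ.+ n)
      D = C ℚ.* inv (1ℚ ℚ.- r)
      C≡ : (1ℚ ℚ.- r) ℚ.* D ≡ C
      C≡ = *-inv-cancel 0<1-r C

    -- The last bound passes through a late `z n`, whose distance from l is the η.
    geometric : ∀ {z : ℕ → Carrier} {C} → 0ℚ ℚ.≤ C → (∀ n → z (suc n) - z n ≼ C ℚ.* r ^ℚ n) →
                ∃[ l ] z ⇝ l × (∀ η → 0ℚ ℚ.< η → l - z 0 ≼ η ℚ.+ C ℚ.* inv (1ℚ ℚ.- r))
    geometric {z} {C} 0≤C h = l , mk⇝ z⇝l , near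
      where
      D : ℚ
      D = C ℚ.* inv (1ℚ ℚ.- r)
      0≤D : 0ℚ ℚ.≤ D
      0≤D = nonNeg* 0≤C (ℚ.<⇒≤ (0<inv 0<1-r))
      from : ∀ N m → N ℕ.≤ m → z m - z N ≼ D ℚ.* r ^ℚ N
      from N m N≤m = ≼-mono
        (subst (λ j → z j - z N ≼ D ℚ.* (r ^ℚ N ℚ.- r ^ℚ j)) (ℕ.m∸n+n≡m N≤m)
          (telescope {z} {C} h (m ℕ.∸ N) N))
        (*-monoˡ-≤ D 0≤D (+⇒≤ (r ^ℚ m) (0≤r^ m)
          (ℚS.solve 2 (λ a b → a ℚS.:= a ℚS.:- b ℚS.:+ b) ≡.refl (r ^ℚ N) (r ^ℚ m))))
      cauchy : ∀ η → 0ℚ ℚ.< η → ∃[ N ] (∀ m n → N ℕ.≤ m → N ℕ.≤ n → z m - z n ≼ η)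
      cauchy η 0<η = let N , small = r^-small D (half 0<η) in N , λ m n N≤m N≤n →
        ≼-resp-≡ (½+½ η) (≼-diff-trans (≼-mono (from N m N≤m) (small N ℕ.≤-refl))
          (≼-diff-sym (≼-mono (from N n N≤n) (small N ℕ.≤-refl))))
      l : Carrier
      l = proj₁ (complete z cauchy)
      z⇝l : ∀ η → 0ℚ ℚ.< η → Eventually λ n → z n - l ≼ η
      z⇝l = proj₂ (complete z cauchy)
      near : ∀ η → 0ℚ ℚ.< η → l - z 0 ≼ η ℚ.+ D
      near η 0<η = let N , h = z⇝l η 0<η in
        ≼-diff-trans (≼-diff-sym (h N ℕ.≤-refl))
          (≼-resp-≡ (ℚ.*-identityʳ D) (from 0 N ℕ.z≤n))

    -- L does not depend on the scale s of the perturbation, so that the limits at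
    -- x = a qᵏ are 1 + O(rᵏ).
    product-limit : ∀ {B C} → 0ℚ ℚ.≤ B → 0ℚ ℚ.≤ C →
      ∃[ L ] 0ℚ ℚ.< L × (∀ {W g t : ℕ → Carrier} {s} → 0ℚ ℚ.< s → s ℚ.≤ B → W 0 ≼ 1ℚ →
        (∀ n → W (suc n) ≈ (1# + g n) * W n + t n) →
        (∀ n → g n ≼ s ℚ.* r ^ℚ n) → (∀ n → t n ≼ C ℚ.* (s ℚ.* r ^ℚ n)) →
        ∃[ l ] W ⇝ l × l - W 0 ≼ L ℚ.* s)
    product-limit {B} {C} 0≤B 0≤C =
      L , pos+ 0<1 (nonNeg* 0≤K+C 0≤I) , λ {W} {g} {t} {s} → limit {W} {g} {t} {s}
      where
      -- The additive term is at most C B rⁿ and the majorant is at least 1, so `t` is absorbed by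
      -- enlarging the factor 1 + B rⁿ to 1 + E rⁿ.
      E : ℚ
      E = B ℚ.+ C ℚ.* B
      0≤E : 0ℚ ℚ.≤ E
      0≤E = nonNeg+ 0≤B (nonNeg* 0≤C 0≤B)
      K : ℚ
      K = proj₁ (growth-bounded 0≤E)
      0≤K : 0ℚ ℚ.≤ K
      0≤K = ℚ.≤-trans 0≤1 (proj₁ (proj₂ (growth-bounded 0≤E)))
      growth≤K : ∀ n → growth r E n ℚ.≤ K
      growth≤K = proj₂ (proj₂ (growth-bounded 0≤E))
      0≤K+C : 0ℚ ℚ.≤ K ℚ.+ C
      0≤K+C = nonNeg+ 0≤K 0≤C
      I : ℚ
      I = inv (1ℚ ℚ.- r)
      0≤I : 0ℚ ℚ.≤ I
      0≤I = ℚ.<⇒≤ (0<inv 0<1-r)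
      -- The summand 1 pays for the slack η of `geometric`, taken to be s.
      L : ℚ
      L = 1ℚ ℚ.+ (K ℚ.+ C) ℚ.* I
      limit : ∀ {W g t : ℕ → Carrier} {s} → 0ℚ ℚ.< s → s ℚ.≤ B → W 0 ≼ 1ℚ →
        (∀ n → W (suc n) ≈ (1# + g n) * W n + t n) →
        (∀ n → g n ≼ s ℚ.* r ^ℚ n) → (∀ n → t n ≼ C ℚ.* (s ℚ.* r ^ℚ n)) →
        ∃[ l ] W ⇝ l × l - W 0 ≼ L ℚ.* s
      limit {W} {g} {t} {s} 0<s s≤B W₀ W-suc g≼ t≼ =
        let l , W⇝l , near = geometric {W} {(K ℚ.+ C) ℚ.* s} (nonNeg* 0≤K+C 0≤s) increment
        in l , W⇝l , ≼-resp-≡ (ℚS.solve 3 (λ s k i →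
             s ℚS.:+ k ℚS.:* s ℚS.:* i ℚS.:= (ℚS.con 1ℚ ℚS.:+ k ℚS.:* i) ℚS.:* s)
             ≡.refl s (K ℚ.+ C) I) (near s 0<s)
        where
        0≤s : 0ℚ ℚ.≤ s
        0≤s = ℚ.<⇒≤ 0<s
        bound : ∀ n → W n ≼ growth r E n
        bound zero    = W₀
        bound (suc n) = ≼-mono
          (≼-resp-≈ (sym (W-suc n)) (≼-+ (≼-* (≼-+ 1≼1 (g≼ n)) (bound n)) (t≼ n)))
          (ℚ.≤-trans (ℚ.+-mono-≤
              (*-monoʳ-≤ u 0≤u (ℚ.+-monoʳ-≤ 1ℚ (*-monoʳ-≤ p (0≤r^ n) s≤B)))
              (*-monoˡ-≤ C 0≤C (*-monoʳ-≤ p (0≤r^ n) s≤B)))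
            (+⇒≤ (C ℚ.* (B ℚ.* p) ℚ.* (u ℚ.- 1ℚ))
              (nonNeg* (nonNeg* 0≤C (nonNeg* 0≤B (0≤r^ n))) (p≤q⇒0≤q-p (1≤growth 0≤E n)))
              (ℚS.solve 4 (λ B C p u →
                (ℚS.con 1ℚ ℚS.:+ (B ℚS.:+ C ℚS.:* B) ℚS.:* p) ℚS.:* u
                ℚS.:= ((ℚS.con 1ℚ ℚS.:+ B ℚS.:* p) ℚS.:* u ℚS.:+ C ℚS.:* (B ℚS.:* p))
                  ℚS.:+ C ℚS.:* (B ℚS.:* p) ℚS.:* (u ℚS.:- ℚS.con 1ℚ)) ≡.refl B C p u)))
          where
          p u : ℚ
          p = r ^ℚ n
          u = growth r E n
          0≤u : 0ℚ ℚ.≤ u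
          0≤u = ≼⇒0≤ (bound n)
        increment : ∀ n → W (suc n) - W n ≼ (K ℚ.+ C) ℚ.* s ℚ.* r ^ℚ n
        increment n = ≼-resp-≡ (ℚS.solve 4 (λ s p k c →
            s ℚS.:* p ℚS.:* k ℚS.:+ c ℚS.:* (s ℚS.:* p) ℚS.:= (k ℚS.:+ c) ℚS.:* s ℚS.:* p)
            ≡.refl s (r ^ℚ n) K C)
          (≼-resp-≈ (sym (trans (+-congʳ (trans (W-suc n)
              (solve 3 (λ g w t → (con 1 :+ g) :* w :+ t := w :+ (g :* w :+ t)) refl
                (g n) (W n) (t n)))) (self-diff (W n) (g n * W n + t n))))
            (≼-+ (≼-* (g≼ n) (≼-mono (bound n) (growth≤K n))) (t≼ n)))

growth-mono : ∀ {r D D′} → 0ℚ ℚ.< r → r ℚ.< 1ℚ → 0ℚ ℚ.≤ D → D ℚ.≤ D′ →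
              ∀ n → growth r D n ℚ.≤ growth r D′ n
growth-mono              0<r r<1 0≤D D≤D′ zero    = ℚ.≤-refl
growth-mono {r} {D} {D′} 0<r r<1 0≤D D≤D′ (suc n) = *-mono-nonNeg-≤
  (nonNeg+ 0≤1 (nonNeg* 0≤D (0≤r^ n)))
  (ℚ.≤-trans 0≤1 (1≤growth (ℚ.≤-trans 0≤D D≤D′) n))
  (ℚ.+-monoʳ-≤ 1ℚ (*-monoʳ-≤ (r ^ℚ n) (0≤r^ n) D≤D′)) (growth-mono 0<r r<1 0≤D D≤D′ n)
  where open Geometric 0<r r<1

positive-lower-bound : ∀ {p q} → 0ℚ ℚ.< p → 0ℚ ℚ.< q → ∃[ m ] 0ℚ ℚ.< m × m ℚ.≤ p × m ℚ.≤ q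
positive-lower-bound {p} {q} 0<p 0<q with ℚ.≤-total p q
... | inj₁ p≤q = p , 0<p , ℚ.≤-refl , p≤q
... | inj₂ q≤p = q , 0<q , q≤p , ℚ.≤-refl

-- Products bounded away from 0, and decay under the recurrences

module Products (𝓡 : NormedRing) where

  open NormedRing 𝓡
  open Limits 𝓡
  open NaturalSolver commutativeSemiring
  open SetoidReasoning setoid

  product : (ℕ → Carrier) → ℕ → Carrier
  product g zero    = 1#
  product g (suc n) = product g n * (1# + g n)

  sum : (ℕ → Carrier) → ℕ → Carrier
  sum t zero    = 0#
  sum t (suc n) = sum t n + t n

  product-suc : ∀ g n → product g (suc n) ≈ (1# + g 0) * product (λ j → g (suc j)) n
  product-suc g zero    = *-comm 1# (1# + g 0)
  product-suc g (suc n) = trans (*-congʳ (product-suc g n)) (*-assoc _ _ _)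

  inverse-unique : ∀ {z w w′} → z * w ≈ 1# → z * w′ ≈ 1# → w ≈ w′
  inverse-unique {z} {w} {w′} e e′ = begin
    w             ≈⟨ *-identityʳ w ⟨
    w * 1#        ≈⟨ *-congˡ e′ ⟨
    w * (z * w′)  ≈⟨ solve 3 (λ w z v → w :* (z :* v) := z :* w :* v) refl w z w′ ⟩
    z * w * w′    ≈⟨ *-congʳ e ⟩
    1# * w′       ≈⟨ *-identityˡ w′ ⟩
    w′            ∎

  module _ {g d : ℕ → Carrier} (inverses : ∀ n → product g n * d n ≈ 1#) where

    inverses-zero : d 0 ≈ 1#
    inverses-zero = inverse-unique (inverses 0) (*-identityˡ 1#)

    -- Both sides are inverses of `product g n`, since `d (suc n)` also inverts the next factor.
    inverses-suc : ∀ n → d n ≈ d (suc n) + g n * d (suc n)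
    inverses-suc n = inverse-unique (inverses n) (trans
      (solve 3 (λ P g d → P :* (d :+ g :* d) := P :* (con 1 :+ g) :* d) refl
        (product g n) (g n) (d (suc n)))
      (inverses (suc n)))

  BoundedBelow : (ℕ → Carrier) → Set
  BoundedBelow z = ∃[ δ ] 0ℚ ℚ.< δ × (∀ n → z n ≽ δ)

  module _ {r : ℚ} (0<r : 0ℚ ℚ.< r) (r<1 : r ℚ.< 1ℚ) where

    open Geometric 0<r r<1

    -- Again rⁿ is the slack of the induction: with p = rⁿ, (1 + p) (1 - (1 - r) p / 2) exceeds 1 +
    -- r p by (1 - r) p (1 - p) / 2.
    product-≽-small : ∀ {g C} → 0ℚ ℚ.≤ C → C ℚ.≤ ½ ℚ.* (1ℚ ℚ.- r) →
                      (∀ n → g n ≼ C ℚ.* r ^ℚ n) → ∀ n → product g n ≽ ½ ℚ.* (1ℚ ℚ.+ r ^ℚ n)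
    product-≽-small         0≤C C≤ g≼ zero    = 1≽1
    product-≽-small {g} {C} 0≤C C≤ g≼ (suc n) = ≽-mono
      (≽-* (product-≽-small 0≤C C≤ g≼ n) (≽-+ {r = 1ℚ ℚ.- h ℚ.* p}
        (subst (1# ≽_) (ℚS.solve 1 (λ x → ℚS.con 1ℚ ℚS.:= ℚS.con 1ℚ ℚS.:- x ℚS.:+ x) ≡.refl
          (h ℚ.* p)) 1≽1)
        (≼-mono (g≼ n) (*-monoʳ-≤ p (0≤r^ n) C≤)) 0≤1-hp))
      (nonNeg* (ℚ.<⇒≤ 0<½) (nonNeg+ 0≤1 (0≤r^ (suc n))))
      (+⇒≤ (½ ℚ.* h ℚ.* p ℚ.* (1ℚ ℚ.- p))
        (nonNeg* (nonNeg* (nonNeg* (ℚ.<⇒≤ 0<½) 0≤h) (0≤r^ n)) (p≤q⇒0≤q-p (r^≤1 n)))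
        (ℚS.solve 2 (λ r p → ℚS.con ½ ℚS.:* (ℚS.con 1ℚ ℚS.:+ p)
            ℚS.:* (ℚS.con 1ℚ ℚS.:- ℚS.con ½ ℚS.:* (ℚS.con 1ℚ ℚS.:- r) ℚS.:* p)
          ℚS.:= ℚS.con ½ ℚS.:* (ℚS.con 1ℚ ℚS.:+ r ℚS.:* p)
            ℚS.:+ ℚS.con ½ ℚS.:* (ℚS.con ½ ℚS.:* (ℚS.con 1ℚ ℚS.:- r)) ℚS.:* p
              ℚS.:* (ℚS.con 1ℚ ℚS.:- p)) ≡.refl r p))
      where
      p h : ℚ
      p = r ^ℚ n
      h = ½ ℚ.* (1ℚ ℚ.- r)
      0≤h : 0ℚ ℚ.≤ h
      0≤h = nonNeg* (ℚ.<⇒≤ 0<½) 0≤1-r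
      h≤1 : h ℚ.≤ 1ℚ
      h≤1 = +⇒≤ (½ ℚ.* (1ℚ ℚ.+ r)) (nonNeg* (ℚ.<⇒≤ 0<½) (nonNeg+ 0≤1 0≤r))
        (ℚS.solve 1 (λ r → ℚS.con 1ℚ ℚS.:= ℚS.con ½ ℚS.:* (ℚS.con 1ℚ ℚS.:- r)
          ℚS.:+ ℚS.con ½ ℚS.:* (ℚS.con 1ℚ ℚS.:+ r)) ≡.refl r)
      0≤1-hp : 0ℚ ℚ.≤ 1ℚ ℚ.- h ℚ.* p
      0≤1-hp = p≤q⇒0≤q-p (*-mono-nonNeg-≤ {h} {1ℚ} {p} {1ℚ} 0≤h 0≤1 h≤1 (r^≤1 n))

    -- Finitely many factors are split off in front and use their individual lower bounds; the
    -- remaining ones are so close to 1 that `product-≽-small` bounds all their products at once.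
    product-≽ : ∀ {g C} → 0ℚ ℚ.≤ C → (∀ n → g n ≼ C ℚ.* r ^ℚ n) →
                (∀ n → ∃[ δ ] 0ℚ ℚ.< δ × 1# + g n ≽ δ) → BoundedBelow (product g)
    product-≽ {g} {C} 0≤C g≼ factors =
      let N , small = r^-small C (half (0<1-r))
      in go N 0≤C (small N ℕ.≤-refl) g≼ factors
      where
      go : ∀ N {g C} → 0ℚ ℚ.≤ C → C ℚ.* r ^ℚ N ℚ.≤ ½ ℚ.* (1ℚ ℚ.- r) →
           (∀ n → g n ≼ C ℚ.* r ^ℚ n) → (∀ n → ∃[ δ ] 0ℚ ℚ.< δ × 1# + g n ≽ δ) →
           BoundedBelow (product g)
      go zero {g} {C} 0≤C C≤ g≼ factors = ½ , 0<½ , λ n → ≽-mono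
        (product-≽-small 0≤C (subst (ℚ._≤ ½ ℚ.* (1ℚ ℚ.- r)) (ℚ.*-identityʳ C) C≤) g≼ n)
        (ℚ.<⇒≤ 0<½)
        (+⇒≤ (½ ℚ.* r ^ℚ n) (nonNeg* (ℚ.<⇒≤ 0<½) (0≤r^ n))
          (ℚS.solve 1 (λ p → ℚS.con ½ ℚS.:* (ℚS.con 1ℚ ℚS.:+ p)
            ℚS.:= ℚS.con ½ ℚS.:+ ℚS.con ½ ℚS.:* p) ≡.refl (r ^ℚ n)))
      go (suc N) {g} {C} 0≤C C≤ g≼ factors =
        let δ₀ , 0<δ₀ , h₀ = factors 0
            δ₁ , 0<δ₁ , h₁ = go N {λ j → g (suc j)} {C ℚ.* r} (nonNeg* 0≤C 0≤r)
              (subst (ℚ._≤ ½ ℚ.* (1ℚ ℚ.- r)) (≡.sym (ℚ.*-assoc C r (r ^ℚ N))) C≤)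
              (λ n → ≼-resp-≡ (≡.sym (ℚ.*-assoc C r (r ^ℚ n))) (g≼ (suc n)))
              (λ n → factors (suc n))
            -- The minimum with 1 takes care of the empty product.
            δ , 0<δ , δ≤1 , δ≤ = positive-lower-bound 0<1 (pos* 0<δ₀ 0<δ₁)
        in δ , 0<δ , λ where
          zero    → ≽-mono 1≽1 (ℚ.<⇒≤ 0<δ) δ≤1
          (suc n) → ≽-resp-≈ (sym (product-suc g n))
            (≽-mono (≽-* h₀ (h₁ n)) (ℚ.<⇒≤ 0<δ) δ≤)

    bounded-inverses : ∀ {z} → BoundedBelow z →
      ∃[ d ] (∀ n → z n * d n ≈ 1#) × ∃[ K ] 0ℚ ℚ.< K × (∀ n → d n ≼ K)
    bounded-inverses (δ , 0<δ , z≽) =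
        (λ n → proj₁ (inverse 0<δ (z≽ n))) , (λ n → proj₂ (inverse 0<δ (z≽ n)))
      , inv δ , 0<inv 0<δ , λ n → inverse-≼ 0<δ (z≽ n) (proj₂ (inverse 0<δ (z≽ n)))

    -- Iterating N times gains a factor rᴺ over the assumed bound on `e`, while the coefficients
    -- accumulate to a value of `growth` that stays bounded in N. The Boolean handles two interlaced
    -- sequences at once.
    recurrence-null : ∀ {e : Bool → ℕ → Carrier} {c : ℕ → Carrier} {B L} →
      0ℚ ℚ.< B → 0ℚ ℚ.< L →
      (∀ b k → e b k ≋ e (not b) (suc k) + c k * e b (suc (suc k))) →
      (∀ k → c k ≼ B ℚ.* r ^ℚ k) → (∀ b k → e b k ≼ L ℚ.* r ^ℚ k) →
      ∀ b k η → 0ℚ ℚ.< η → e b k ≼ η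
    recurrence-null {e} {c} {B} {L} 0<B 0<L rec c≼ e≼ b k η 0<η =
      let K , 1≤K , growth≤K = growth-bounded (0≤D k)
          N , small = r^-small (L ℚ.* r ^ℚ k ℚ.* K) 0<η
      in ≼-mono (decay N b k) (ℚ.≤-trans
           (*-monoˡ-≤ (L ℚ.* r ^ℚ k ℚ.* r ^ℚ N)
             (nonNeg* (nonNeg* (ℚ.<⇒≤ 0<L) (0≤r^ k)) (0≤r^ N)) (growth≤K N))
           (subst (ℚ._≤ η) (ℚS.solve 4 (λ L s K p → L ℚS.:* s ℚS.:* K ℚS.:* p
             ℚS.:= L ℚS.:* s ℚS.:* p ℚS.:* K) ≡.refl L (r ^ℚ k) K (r ^ℚ N)) (small N ℕ.≤-refl)))
      where
      -- In `decay` the second summand of the recurrence contributes at most r η′ and the passage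
      -- through `_≋_` costs η′; the constant 2 B makes room for 2 η′.
      D : ℚ
      D = 2ℚ ℚ.* B
      0≤D : ∀ k → 0ℚ ℚ.≤ D ℚ.* r ^ℚ k
      0≤D k = nonNeg* (nonNeg* (ℚ.≤-trans 0≤1 (+⇒≤ 1ℚ 0≤1 ≡.refl)) (ℚ.<⇒≤ 0<B)) (0≤r^ k)
      decay : ∀ j b k → e b k ≼ L ℚ.* r ^ℚ k ℚ.* r ^ℚ j ℚ.* growth r (D ℚ.* r ^ℚ k) j
      decay zero    b k = ≼-resp-≡
        (ℚS.solve 1 (λ x → x ℚS.:= x ℚS.:* ℚS.con 1ℚ ℚS.:* ℚS.con 1ℚ) ≡.refl (L ℚ.* r ^ℚ k))
        (e≼ b k)
      decay (suc j) b k = ≼-mono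
        (≼-resp-≋ {η = η′} (rec b k) 0<η′ (≼-+ (decay j (not b) (suc k))
          (≼-* (c≼ k) (≼-mono (decay j b (suc (suc k)))
            (*-monoˡ-≤ (L ℚ.* (r ℚ.* (r ℚ.* s)) ℚ.* p)
              (nonNeg* (nonNeg* (ℚ.<⇒≤ 0<L) (0≤r^ (suc (suc k)))) (0≤r^ j))
              (growth-mono 0<r r<1 (0≤D (suc (suc k))) D≤ j))))))
        (+⇒≤ (B ℚ.* s ℚ.* (L ℚ.* s ℚ.* r ℚ.* p ℚ.* v) ℚ.* (1ℚ ℚ.- r))
          (nonNeg* (ℚ.<⇒≤ 0<η′) 0≤1-r)
          (≡.trans (cong (L ℚ.* s ℚ.* (r ℚ.* p) ℚ.*_) growth≡)
            (ℚS.solve 6 (λ L s r p B v →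
                L ℚS.:* s ℚS.:* (r ℚS.:* p) ℚS.:* ((ℚS.con 1ℚ ℚS.:+ ℚS.con 2ℚ ℚS.:* B ℚS.:* s) ℚS.:* v)
                ℚS.:= L ℚS.:* (r ℚS.:* s) ℚS.:* p ℚS.:* v
                  ℚS.:+ B ℚS.:* s ℚS.:* (L ℚS.:* (r ℚS.:* (r ℚS.:* s)) ℚS.:* p ℚS.:* v)
                  ℚS.:+ B ℚS.:* s ℚS.:* (L ℚS.:* s ℚS.:* r ℚS.:* p ℚS.:* v)
                  ℚS.:+ B ℚS.:* s ℚS.:* (L ℚS.:* s ℚS.:* r ℚS.:* p ℚS.:* v) ℚS.:* (ℚS.con 1ℚ ℚS.:- r))
              ≡.refl L s r p B v)))
        where
        s p v η′ : ℚ
        s = r ^ℚ k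
        p = r ^ℚ j
        v = growth r (D ℚ.* (r ℚ.* s)) j
        η′ = B ℚ.* s ℚ.* (L ℚ.* s ℚ.* r ℚ.* p ℚ.* v)
        0<η′ : 0ℚ ℚ.< η′
        0<η′ = pos* (pos* 0<B (0<r^ k)) (pos* (pos* (pos* (pos* 0<L (0<r^ k)) 0<r) (0<r^ j))
          (ℚ.<-≤-trans 0<1 (1≤growth (0≤D (suc k)) j)))
        D≤ : D ℚ.* (r ℚ.* (r ℚ.* s)) ℚ.≤ D ℚ.* (r ℚ.* s)
        D≤ = subst (ℚ._≤ D ℚ.* (r ℚ.* s)) (ℚS.solve 3 (λ D r s → D ℚS.:* (r ℚS.:* s) ℚS.:* r
          ℚS.:= D ℚS.:* (r ℚS.:* (r ℚS.:* s))) ≡.refl D r s) (r*≤ (0≤D (suc k)))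
        growth≡ : growth r (D ℚ.* s) (suc j) ≡ (1ℚ ℚ.+ D ℚ.* s) ℚ.* v
        growth≡ = ≡.trans (growth-suc r (D ℚ.* s) j) (cong (λ x → (1ℚ ℚ.+ D ℚ.* s) ℚ.* growth r x j)
          (ℚS.solve 3 (λ D r s → D ℚS.:* s ℚS.:* r ℚS.:= D ℚS.:* (r ℚS.:* s)) ≡.refl D r s))

-- The recurrences in the limit

module Powers (𝓡 : NormedRing) (q : NormedRing.Carrier 𝓡) (p : ℕ → NormedRing.Carrier 𝓡)
  (p-zero : NormedRing._≈_ 𝓡 (p 0) (NormedRing.1# 𝓡))
  (p-suc : ∀ n → NormedRing._≈_ 𝓡 (p (suc n)) (NormedRing._*_ 𝓡 q (p n)))
  {r : ℚ} (0<r : 0ℚ ℚ.< r) (r<1 : r ℚ.< 1ℚ) (q≼r : NormedRing._≼_ 𝓡 q r)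
  where

  open NormedRing 𝓡
  open Limits 𝓡
  open Products 𝓡
  open Geometric 0<r r<1
  open SetoidReasoning setoid
  open import Algebra.Properties.Ring ring using (-‿distribˡ-*)

  P : ℕ → Carrier
  P n = p (suc n)

  p≼ : ∀ n → p n ≼ r ^ℚ n
  p≼ zero    = ≼-resp-≈ (sym p-zero) 1≼1
  p≼ (suc n) = ≼-resp-≈ (sym (p-suc n)) (≼-* q≼r (p≼ n))

  p≼1 : ∀ n → p n ≼ 1ℚ
  p≼1 n = ≼-mono (p≼ n) (r^≤1 n)

  P≼ : ∀ n → P n ≼ r
  P≼ n = ≼-mono (p≼ (suc n)) (subst (r ℚ.* r ^ℚ n ℚ.≤_) (ℚ.*-identityʳ r)
    (*-monoˡ-≤ r 0≤r (r^≤1 n)))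

  P≼r^ : ∀ n → P n ≼ 1ℚ ℚ.* r ^ℚ n
  P≼r^ n = ≼-mono (p≼ (suc n)) (subst₂ ℚ._≤_ (ℚ.*-comm (r ^ℚ n) r)
    (≡.sym (ℚ.*-identityˡ (r ^ℚ n))) (r*≤ (0≤r^ n)))

  PP≼r^ : ∀ n → P n * P n ≼ 1ℚ ℚ.* r ^ℚ n
  PP≼r^ n = ≼-resp-≡ (ℚ.*-identityˡ (1ℚ ℚ.* r ^ℚ n)) (≼-* (p≼1 (suc n)) (P≼r^ n))

  PP≼ : ∀ n → P n * P n ≼ r
  PP≼ n = ≼-resp-≡ (ℚ.*-identityˡ r) (≼-* (p≼1 (suc n)) (P≼ n))

  1-≽ : ∀ {z} → z ≼ r → ∃[ δ ] 0ℚ ℚ.< δ × 1# + - z ≽ δ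
  1-≽ z≼r = 1ℚ ℚ.- r , 0<1-r , ≽-+ (subst (1# ≽_)
    (ℚS.solve 1 (λ r → ℚS.con 1ℚ ℚS.:= ℚS.con 1ℚ ℚS.:- r ℚS.:+ r) ≡.refl r) 1≽1) (≼-neg z≼r) 0≤1-r

  product-f-≽ : BoundedBelow (product (λ n → - P n))
  product-f-≽ = product-≽ 0<r r<1 0≤1 (λ n → ≼-neg (P≼r^ n)) (λ n → 1-≽ (P≼ n))

  product-d-≽ : BoundedBelow (product (λ n → - (P n * P n)))
  product-d-≽ = product-≽ 0<r r<1 0≤1 (λ n → ≼-neg (PP≼r^ n)) (λ n → 1-≽ (PP≼ n))

  -- Brings `inverses-suc`, which involves a negation for factors 1 - z, into the subtraction-free
  -- form that the recurrences over a semiring assume.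
  move-neg : ∀ {x y z} → x ≈ y + - z * y → y ≈ x + z * y
  move-neg {x} {y} {z} e = sym (begin
    x + z * y                 ≈⟨ +-congʳ e ⟩
    y + - z * y + z * y       ≈⟨ +-congʳ (+-congˡ (sym (-‿distribˡ-* z y))) ⟩
    y + - (z * y) + z * y     ≈⟨ +-assoc y _ _ ⟩
    y + (- (z * y) + z * y)   ≈⟨ +-cancel y (z * y) ⟩
    y ∎)

module Identity (𝓡 : NormedRing) (a q : NormedRing.Carrier 𝓡) (p : ℕ → NormedRing.Carrier 𝓡)
  (p-zero : NormedRing._≈_ 𝓡 (p 0) (NormedRing.1# 𝓡))
  (p-suc : ∀ n → NormedRing._≈_ 𝓡 (p (suc n)) (NormedRing._*_ 𝓡 q (p n)))
  {r : ℚ} (0<r : 0ℚ ℚ.< r) (r<1 : r ℚ.< 1ℚ) (q≼r : NormedRing._≼_ 𝓡 q r)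
  {B : ℚ} (0<B : 0ℚ ℚ.< B) (a≼B : NormedRing._≼_ 𝓡 a B)
  where

  open NormedRing 𝓡
  open Limits 𝓡
  open Products 𝓡
  open Geometric 0<r r<1
  open Powers 𝓡 q p p-zero p-suc 0<r r<1 q≼r
  open Recurrences commutativeSemiring q p p-zero p-suc
  open NaturalSolver commutativeSemiring
  open SetoidReasoning setoid

  0≤B : 0ℚ ℚ.≤ B
  0≤B = ℚ.<⇒≤ 0<B

  scale : ℕ → ℚ
  scale k = B ℚ.* r ^ℚ k

  0<scale : ∀ k → 0ℚ ℚ.< scale k
  0<scale k = pos* 0<B (0<r^ k)

  scale≤B : ∀ k → scale k ℚ.≤ B
  scale≤B k = subst (scale k ℚ.≤_) (ℚ.*-identityʳ B) (*-monoˡ-≤ B 0≤B (r^≤1 k))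

  x : ℕ → Carrier
  x zero    = a
  x (suc k) = x k * q

  x≼ : ∀ k → x k ≼ scale k
  x≼ zero    = ≼-resp-≡ (≡.sym (ℚ.*-identityʳ B)) a≼B
  x≼ (suc k) = ≼-resp-≡ (ℚS.solve 3 (λ B s r → B ℚS.:* s ℚS.:* r ℚS.:= B ℚS.:* (r ℚS.:* s)) ≡.refl
    B (r ^ℚ k) r) (≼-* (x≼ k) q≼r)

  qpp≼ : ∀ n → q * (p n * p n) ≼ r ^ℚ n
  qpp≼ n = ≼-mono (≼-* q≼r (≼-* (p≼1 n) (p≼ n)))
    (ℚ.≤-trans (ℚ.≤-reflexive (ℚS.solve 2 (λ r s → r ℚS.:* (ℚS.con 1ℚ ℚS.:* s) ℚS.:= s ℚS.:* r)
      ≡.refl r (r ^ℚ n))) (r*≤ (0≤r^ n)))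

  -- `power n a` is the product of a q^(2j+1) over j < n, and each of these factors is at most B rʲ.
  power≼growth : ∀ n → power n a ≼ growth r B n
  power≼growth zero    = 1≼1
  power≼growth (suc n) = ≼-mono (≼-* (≼-* a≼B (qpp≼ n)) (power≼growth n))
    (*-monoʳ-≤ (growth r B n) (≼⇒0≤ (power≼growth n))
      (+⇒≤ {B ℚ.* r ^ℚ n} 1ℚ 0≤1 (ℚ.+-comm 1ℚ (B ℚ.* r ^ℚ n))))

  pp≼1 : ∀ n → p n * p n ≼ 1ℚ
  pp≼1 n = ≼-* (p≼1 n) (p≼1 n)

  module Bounds {K : ℚ} (growth≤K : ∀ n → growth r B n ℚ.≤ K) where

    0≤K : 0ℚ ℚ.≤ K
    0≤K = ℚ.≤-trans 0≤1 (growth≤K 0)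

    power≼ : ∀ k n → power n (x k) ≼ K
    power≼ zero    n = ≼-mono (power≼growth n) (growth≤K n)
    power≼ (suc k) n = ≼-resp-≈ (sym (power-shift n (x k)))
      (≼-resp-≡ (ℚ.*-identityˡ K) (≼-* (p≼1 n) (power≼ k n)))

    -- The factor `scale k` comes from the x split off in `power (suc n)`; the remaining power is
    -- bounded uniformly in k. The terms are thus proportional to the scale, as `product-limit`
    -- requires.
    term≼ : ∀ {e w : ℕ → Carrier} {C} k → (∀ n → e n ≼ 1ℚ) → (∀ n → w n ≼ C) →
            ∀ n → power (suc n) (x k) * e (suc n) * w (suc n)
              ≼ K ℚ.* C ℚ.* (scale k ℚ.* r ^ℚ n)
    term≼ {e} {w} {C} k e≼ w≼ n = ≼-resp-≡
      (ℚS.solve 4 (λ s p K C → s ℚS.:* p ℚS.:* K ℚS.:* ℚS.con 1ℚ ℚS.:* C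
        ℚS.:= K ℚS.:* C ℚS.:* (s ℚS.:* p)) ≡.refl (scale k) (r ^ℚ n) K C)
      (≼-* (≼-* (≼-* (≼-* (x≼ k) (qpp≼ n)) (power≼ k n)) (e≼ (suc n))) (w≼ (suc n)))

  -- At x = a qᵏ the factors of (-xq²; q²) and (-xq³; q²) are 1 + `gG k n` and 1 + `gH k n`.
  gG gH : ℕ → ℕ → Carrier
  gG k n = x k * (P n * P n)
  gH k n = x k * q * (P n * P n)

  gG≼ : ∀ k n → gG k n ≼ scale k ℚ.* r ^ℚ n
  gG≼ k n = ≼-resp-≡ (cong (scale k ℚ.*_) (ℚ.*-identityˡ (r ^ℚ n))) (≼-* (x≼ k) (PP≼r^ n))

  gH≼ : ∀ k n → gH k n ≼ scale k ℚ.* r ^ℚ n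
  gH≼ k n = ≼-mono (≼-* (≼-* (x≼ k) q≼r) (PP≼r^ n))
    (ℚ.≤-trans (ℚ.≤-reflexive (ℚS.solve 3 (λ s r p → s ℚS.:* r ℚS.:* (ℚS.con 1ℚ ℚS.:* p)
        ℚS.:= s ℚS.:* p ℚS.:* r) ≡.refl (scale k) r (r ^ℚ n)))
      (r*≤ (nonNeg* (ℚ.<⇒≤ (0<scale k)) (0≤r^ n))))

  Approaches : (ℕ → ℕ → Carrier) → (ℕ → Carrier) → ℚ → Set
  Approaches W l L = ∀ k → W k ⇝ l k × l k - 1# ≼ L ℚ.* scale k

  module _ {f d F∞ G∞ H∞ : ℕ → Carrier} {L₁ L₂ L₃ : ℚ}
    (f-zero : f 0 ≈ 1#) (f-suc : ∀ n → f (suc n) ≈ f n + p (suc n) * f (suc n))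
    (d-zero : d 0 ≈ 1#) (d-suc : ∀ n → d (suc n) ≈ d n + p (suc n) * p (suc n) * d (suc n))
    (0<L₁ : 0ℚ ℚ.< L₁) (0<L₂ : 0ℚ ℚ.< L₂) (0<L₃ : 0ℚ ℚ.< L₃)
    (hF : Approaches (λ k n → F f n (x k)) F∞ L₁)
    (hG : Approaches (λ k n → G d n (x k)) G∞ L₂)
    (hH : Approaches (λ k n → H d n (x k)) H∞ L₃)
    where

    F⇝ : ∀ k → (λ n → F f n (x k)) ⇝ F∞ k
    F⇝ k = proj₁ (hF k)

    G⇝ : ∀ k → (λ n → G d n (x k)) ⇝ G∞ k
    G⇝ k = proj₁ (hG k)

    H⇝ : ∀ k → (λ n → H d n (x k)) ⇝ H∞ k
    H⇝ k = proj₁ (hH k)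

    F∞-shift : ∀ k → F∞ k ≋ F∞ (suc k) + x (suc (suc k)) * F∞ (suc (suc k))
    F∞-shift k = ⇝-unique (⇝-suc (F⇝ k))
      (⇝-resp-≈ (λ n → sym (F-shift f f-zero f-suc n (x k)))
        (⇝-+ (⇝-suc (F⇝ (suc k))) (⇝-* (⇝-const _) (F⇝ (suc (suc k))))))

    H∞-shift : ∀ k → H∞ k ≋ G∞ (suc k) + x (suc (suc k)) * H∞ (suc (suc k))
    H∞-shift k = ⇝-unique (⇝-suc (H⇝ k))
      (⇝-resp-≈ (λ n → sym (H-shift d d-zero d-suc n (x k)))
        (⇝-+ (⇝-suc (G⇝ (suc k))) (⇝-* (⇝-const _) (H⇝ (suc (suc k))))))

    G∞-shift : ∀ k → G∞ k ≋ H∞ (suc k) + x (suc (suc k)) * G∞ (suc (suc k))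
    G∞-shift k = ≋-trans
      (≈⇒≋ (sym (trans (*-congʳ (+-identityʳ 1#)) (*-identityˡ (G∞ k)))))
      (⇝-unique (⇝-* (⇝-+ (⇝-const 1#) (vanishing⇒⇝0 0<r r<1 {gG k} {scale k} (gG≼ k))) (G⇝ k))
        (⇝-resp-≈ (λ n → sym (G-shift d n (x k)))
          (⇝-+ (H⇝ (suc k)) (⇝-* (⇝-const _) (G⇝ (suc (suc k)))))))

    e : Bool → ℕ → Carrier
    e false k = F∞ k - G∞ k
    e true  k = F∞ k - H∞ k

    difference : ∀ {u v u′ v′ c} y z → u ≋ u′ + c * y → v ≋ v′ + c * z →
                 u - v ≋ (u′ - v′) + c * (y - z)
    difference {u} {v} {u′} {v′} {c} y z h h′ = ≋-trans (≋-+ h (≋-neg h′)) (≈⇒≋ (begin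
      (u′ + c * y) - (v′ + c * z)      ≈⟨ diff-+-diff u′ (c * y) v′ (c * z) ⟨
      (u′ - v′) + (c * y - c * z)      ≈⟨ +-congˡ (*-diff c y z) ⟨
      (u′ - v′) + c * (y - z) ∎))

    e-shift : ∀ b k → e b k ≋ e (not b) (suc k) + x (suc (suc k)) * e b (suc (suc k))
    e-shift false k = difference _ _ (F∞-shift k) (G∞-shift k)
    e-shift true  k = difference _ _ (F∞-shift k) (H∞-shift k)

    e-null : ∀ b k η → 0ℚ ℚ.< η → e b k ≼ η
    e-null = recurrence-null 0<r r<1 {e} {λ k → x (suc (suc k))} {B} {L} 0<B
      (pos* (pos+ 0<L₁ (nonNeg+ (ℚ.<⇒≤ 0<L₂) (ℚ.<⇒≤ 0<L₃))) 0<B) e-shift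
      (λ k → ≼-mono (x≼ (suc (suc k))) (*-monoˡ-≤ B 0≤B (r²≤ k))) e≼
      where
      L : ℚ
      L = (L₁ ℚ.+ (L₂ ℚ.+ L₃)) ℚ.* B
      0≤ₖ : ∀ k → 0ℚ ℚ.≤ scale k
      0≤ₖ k = ℚ.<⇒≤ (0<scale k)
      r²≤ : ∀ k → r ℚ.* (r ℚ.* r ^ℚ k) ℚ.≤ r ^ℚ k
      r²≤ k = ℚ.≤-trans (ℚ.≤-reflexive (ℚ.*-comm r (r ℚ.* r ^ℚ k))) (ℚ.≤-trans
        (r*≤ (0≤r^ (suc k))) (ℚ.≤-trans (ℚ.≤-reflexive (ℚ.*-comm r (r ^ℚ k))) (r*≤ (0≤r^ k))))
      e≼ : ∀ b k → e b k ≼ L ℚ.* r ^ℚ k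
      e≼ false k = ≼-mono (≼-diff-trans (proj₂ (hF k)) (≼-diff-sym (proj₂ (hG k))))
        (+⇒≤ (L₃ ℚ.* scale k) (nonNeg* (ℚ.<⇒≤ 0<L₃) (0≤ₖ k))
          (ℚS.solve 5 (λ a b c B s → (a ℚS.:+ (b ℚS.:+ c)) ℚS.:* B ℚS.:* s
            ℚS.:= a ℚS.:* (B ℚS.:* s) ℚS.:+ b ℚS.:* (B ℚS.:* s) ℚS.:+ c ℚS.:* (B ℚS.:* s))
            ≡.refl L₁ L₂ L₃ B (r ^ℚ k)))
      e≼ true  k = ≼-mono (≼-diff-trans (proj₂ (hF k)) (≼-diff-sym (proj₂ (hH k))))
        (+⇒≤ (L₂ ℚ.* scale k) (nonNeg* (ℚ.<⇒≤ 0<L₂) (0≤ₖ k))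
          (ℚS.solve 5 (λ a b c B s → (a ℚS.:+ (b ℚS.:+ c)) ℚS.:* B ℚS.:* s
            ℚS.:= a ℚS.:* (B ℚS.:* s) ℚS.:+ c ℚS.:* (B ℚS.:* s) ℚS.:+ b ℚS.:* (B ℚS.:* s))
            ≡.refl L₁ L₂ L₃ B (r ^ℚ k)))

    limits-agree : ∀ b → F∞ 0 ≋ (if b then H∞ 0 else G∞ 0)
    limits-agree false = mk≋ (e-null false 0)
    limits-agree true  = mk≋ (e-null true 0)

  product-limit-from-1 : ∀ {C} → 0ℚ ℚ.≤ C → ∃[ L ] 0ℚ ℚ.< L ×
    (∀ {W g t : ℕ → ℕ → Carrier} → (∀ k → W k 0 ≈ 1#) →
      (∀ k n → W k (suc n) ≈ (1# + g k n) * W k n + t k n) →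
      (∀ k n → g k n ≼ scale k ℚ.* r ^ℚ n) → (∀ k n → t k n ≼ C ℚ.* (scale k ℚ.* r ^ℚ n)) →
      ∃[ l ] Approaches W l L)
  product-limit-from-1 0≤C =
    let L , 0<L , limit = product-limit 0<r r<1 0≤B 0≤C
    in L , 0<L , λ {W} {g} {t} W-zero W-suc g≼ t≼ →
      let h = λ k → limit {W k} {g k} {t k} (0<scale k) (scale≤B k)
                (≼-resp-≈ (sym (W-zero k)) 1≼1) (W-suc k) (g≼ k) (t≼ k)
      in (λ k → proj₁ (h k)) , λ k → proj₁ (proj₂ (h k))
         , ≼-resp-≈ (+-congˡ (-‿cong (W-zero k))) (proj₂ (proj₂ (h k)))

  -- Makes partial sums the case g = 0 of the recurrence in `product-limit`.
  1+0-* : ∀ u v → u + v ≈ (1# + 0#) * u + v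
  1+0-* u v = +-congʳ (sym (trans (*-congʳ (+-identityʳ 1#)) (*-identityˡ u)))

  0≼scale : ∀ k n → 0# ≼ scale k ℚ.* r ^ℚ n
  0≼scale k n = 0≼ (nonNeg* (ℚ.<⇒≤ (0<scale k)) (0≤r^ n))

  module _ {f d : ℕ → Carrier} {C D : ℚ}
    (f-zero : f 0 ≈ 1#) (f-suc : ∀ n → f (suc n) ≈ f n + p (suc n) * f (suc n))
    (d-zero : d 0 ≈ 1#) (d-suc : ∀ n → d (suc n) ≈ d n + p (suc n) * p (suc n) * d (suc n))
    (0≤C : 0ℚ ℚ.≤ C) (f≼ : ∀ n → f n ≼ C) (0≤D : 0ℚ ℚ.≤ D) (d≼ : ∀ n → d n ≼ D)
    where

    common-limit : ∃[ l ] (λ n → F f n a) ⇝ l × (λ n → G d n a) ⇝ l × (λ n → H d n a) ⇝ l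
    common-limit =
      let K , 1≤K , growth≤K = growth-bounded 0≤B
          open Bounds growth≤K
          L₁ , 0<L₁ , limF = product-limit-from-1 (nonNeg* 0≤K 0≤C)
          L₂ , 0<L₂ , limG = product-limit-from-1 (nonNeg* 0≤K 0≤D)
          F∞ , hF = limF {λ k n → F f n (x k)} {λ _ _ → 0#} (λ _ → refl)
            (λ k n → 1+0-* _ _) 0≼scale (λ k → term≼ {p} {f} k p≼1 f≼)
          G∞ , hG = limG {λ k n → G d n (x k)} {gG} (λ _ → refl)
            (λ k n → refl) gG≼ (λ k → term≼ {λ n → p n * p n} {d} k pp≼1 d≼)
          H∞ , hH = limG {λ k n → H d n (x k)} {gH} (λ _ → refl)
            (λ k n → refl) gH≼ (λ k → term≼ {p} {d} k p≼1 d≼)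
          agree = limits-agree f-zero f-suc d-zero d-suc 0<L₁ 0<L₂ 0<L₂ hF hG hH
      in F∞ 0 , proj₁ (hF 0) , ⇝-resp-≋ (≋-sym (agree false)) (proj₁ (hG 0))
         , ⇝-resp-≋ (≋-sym (agree true)) (proj₁ (hH 0))

  -- Partial sums start with the empty sum, `F` with the term for n = 0; hence the shift by one.
  F-sum : ∀ {f} → f 0 ≈ 1# → ∀ n → sum (λ n → power n a * p n * f n) (suc n) ≈ F f n a
  F-sum f-zero zero    = trans (+-identityˡ _)
    (trans (*-cong (trans (*-identityˡ (p 0)) p-zero) f-zero) (*-identityˡ 1#))
  F-sum f-zero (suc n) = +-congʳ (F-sum f-zero n)

  module _ {d : ℕ → Carrier} {D : ℚ}
    (d-zero : d 0 ≈ 1#) (0≤D : 0ℚ ℚ.≤ D) (d≼ : ∀ n → d n ≼ D)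
    where

    -- W n = product g n * sum t (suc n): multiplying the partial sum by the product
    -- cancels all denominators π.
    factorization : ∀ {g e W π : ℕ → Carrier} {l M} → 0ℚ ℚ.≤ M → (∀ n → g n ≼ B ℚ.* r ^ℚ n) →
      (∀ n → product g n * π n ≈ 1#) → (∀ n → π n ≼ M) →
      (∀ n → e n ≼ 1ℚ) → e 0 ≈ 1# → W 0 ≈ 1# →
      (∀ n → W (suc n) ≈ (1# + g n) * W n + power (suc n) a * e (suc n) * d (suc n)) → W ⇝ l →
      ∃[ Q ] ∃[ T ] product g ⇝ Q × sum (λ n → power n a * e n * (d n * π n)) ⇝ T × l ≋ Q * T
    factorization {g} {e} {W} {π} {l} {M} 0≤M g≼ π-inverse π≼ e≼ e-zero W-zero W-suc W⇝ =
      let K , 1≤K , growth≤K = growth-bounded 0≤B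
          open Bounds growth≤K
          _ , _ , limit = product-limit 0<r r<1 {B} {K ℚ.* (D ℚ.* M)} 0≤B
            (nonNeg* 0≤K (nonNeg* 0≤D 0≤M))
          -- One estimate gives both limits: the product is the case t = 0, the partial sums are the
          -- case g = 0.
          Q , product⇝ , _ = limit {product g} {g} {λ _ → 0#} (0<scale 0) (scale≤B 0) 1≼1
            (λ n → trans (*-comm (product g n) (1# + g n)) (sym (+-identityʳ _)))
            (λ n → ≼-resp-≡ (cong (ℚ._* r ^ℚ n) (≡.sym (ℚ.*-identityʳ B))) (g≼ n))
            (λ n → 0≼ (nonNeg* (nonNeg* 0≤K (nonNeg* 0≤D 0≤M))
              (nonNeg* (ℚ.<⇒≤ (0<scale 0)) (0≤r^ n))))
          T , sums⇝ , _ = limit {λ n → sum t (suc n)} {λ _ → 0#} {λ n → t (suc n)}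
            (0<scale 0) (scale≤B 0)
            (≼-resp-≈ (sym (trans (+-identityˡ (t 0)) t-zero)) 1≼1)
            (λ n → 1+0-* _ _) (0≼scale 0)
            (term≼ {e} {λ n → d n * π n} 0 e≼ (λ n → ≼-* (d≼ n) (π≼ n)))
      in Q , T , product⇝ , ⇝-pred sums⇝
         , ⇝-unique W⇝ (⇝-resp-≈ product*sum (⇝-* product⇝ sums⇝))
      where
      t : ℕ → Carrier
      t n = power n a * e n * (d n * π n)
      t-zero : t 0 ≈ 1#
      t-zero = trans (*-cong (trans (*-identityˡ (e 0)) e-zero)
        (trans (*-cong d-zero (inverses-zero {g} π-inverse)) (*-identityˡ 1#))) (*-identityˡ 1#)
      product*sum : ∀ n → product g n * sum t (suc n) ≈ W n
      product*sum zero    = trans (*-identityˡ _) (trans (+-identityˡ _) (trans t-zero (sym W-zero)))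
      product*sum (suc n) = begin
        product g (suc n) * (sum t (suc n) + t (suc n))
          ≈⟨ solve 7 (λ P g s a e d π → P :* (con 1 :+ g) :* (s :+ a :* e :* (d :* π))
               := (con 1 :+ g) :* (P :* s) :+ a :* e :* d :* (P :* (con 1 :+ g) :* π)) refl
               (product g n) (g n) (sum t (suc n)) (power (suc n) a) (e (suc n)) (d (suc n))
               (π (suc n)) ⟩
        (1# + g n) * (product g n * sum t (suc n))
          + power (suc n) a * e (suc n) * d (suc n) * (product g (suc n) * π (suc n))
          ≈⟨ +-cong (*-congˡ (product*sum n)) (trans (*-congˡ (π-inverse (suc n))) (*-identityʳ _)) ⟩
        (1# + g n) * W n + power (suc n) a * e (suc n) * d (suc n)
          ≈⟨ W-suc n ⟨
        W (suc n) ∎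

-- Powers, q-shifted factorials and the series with their denominators

module Series (𝓡 : NormedRing)
  (pow : NormedRing.Carrier 𝓡 → ℕ → NormedRing.Carrier 𝓡)
  (pow-zero : ∀ x → NormedRing._≈_ 𝓡 (pow x 0) (NormedRing.1# 𝓡))
  (pow-suc : ∀ x n → NormedRing._≈_ 𝓡 (pow x (suc n)) (NormedRing._*_ 𝓡 x (pow x n)))
  where

  open NormedRing 𝓡
  open Limits 𝓡
  open Products 𝓡
  open NaturalSolver commutativeSemiring
  open SetoidReasoning setoid
  open import Algebra.Properties.Ring ring using (-‿distribˡ-*)

  infixr 8 _^_
  _^_ : Carrier → ℕ → Carrier
  x ^ n = pow x n

  pochhammer : Carrier → Carrier → ℕ → Carrier
  pochhammer x y zero    = 1#
  pochhammer x y (suc n) = pochhammer x y n * (1# - x * y ^ n)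

  -- The inverses in the series over the complex numbers are built from proofs of apartness that
  -- arise only there; quantifying over all inverses of the denominators leaves their choice open.
  record Converges (b c : ℕ → Carrier) (s : Carrier) : Set where
    constructor converges
    field
      denominator : ∀ n → ∃[ δ ] 0ℚ ℚ.< δ × c n ≽ δ
      sums        : (i : ℕ → Carrier) → (∀ n → c n * i n ≈ 1#) → sum (λ n → b n * i n) ⇝ s

  sum-cong : ∀ {t u : ℕ → Carrier} → (∀ n → t n ≈ u n) → ∀ n → sum t n ≈ sum u n
  sum-cong e zero    = refl
  sum-cong e (suc n) = +-cong (sum-cong e n) (e n)

  converges-by : ∀ {b c t i : ℕ → Carrier} {s} → (∀ n → ∃[ δ ] 0ℚ ℚ.< δ × c n ≽ δ) →
                 (∀ n → c n * i n ≈ 1#) → (∀ n → t n ≈ b n) →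
                 sum (λ n → t n * i n) ⇝ s → Converges b c s
  converges-by c≽ ci≈1 t≈b h = converges c≽ λ j cj≈1 → ⇝-resp-≈
    (sum-cong (λ n → *-cong (t≈b n) (inverse-unique (ci≈1 n) (cj≈1 n)))) h

  sum-unique : ∀ {s t u : ℕ → Carrier} → s 0 ≈ 0# → (∀ n → s (suc n) ≈ s n + t n) →
               (∀ n → t n ≈ u n) → ∀ n → s n ≈ sum u n
  sum-unique s-zero s-suc e zero    = s-zero
  sum-unique s-zero s-suc e (suc n) =
    trans (s-suc n) (+-cong (sum-unique s-zero s-suc e n) (e n))

  pochhammer-unique : ∀ {P : ℕ → Carrier} {x y} → P 0 ≈ 1# →
                      (∀ n → P (suc n) ≈ P n * (1# - x * y ^ n)) → ∀ n → P n ≈ pochhammer x y n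
  pochhammer-unique P-zero P-suc zero    = P-zero
  pochhammer-unique P-zero P-suc (suc n) =
    trans (P-suc n) (*-congʳ (pochhammer-unique P-zero P-suc n))

  pochhammer≈product : ∀ {x y} {g : ℕ → Carrier} → (∀ n → - (x * y ^ n) ≈ g n) →
                       ∀ n → pochhammer x y n ≈ product g n
  pochhammer≈product e zero    = refl
  pochhammer≈product e (suc n) = *-cong (pochhammer≈product e n) (+-congˡ (e n))

  ^-+ : ∀ x m n → x ^ (m ℕ.+ n) ≈ x ^ m * x ^ n
  ^-+ x zero    n = sym (trans (*-congʳ (pow-zero x)) (*-identityˡ _))
  ^-+ x (suc m) n = begin
    x ^ suc (m ℕ.+ n)   ≈⟨ pow-suc x (m ℕ.+ n) ⟩
    x * x ^ (m ℕ.+ n)   ≈⟨ *-congˡ (^-+ x m n) ⟩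
    x * (x ^ m * x ^ n) ≈⟨ *-assoc x _ _ ⟨
    x * x ^ m * x ^ n   ≈⟨ *-congʳ (pow-suc x m) ⟨
    x ^ suc m * x ^ n ∎

  ^-≡ : ∀ x {m n} → m ≡ n → x ^ m ≈ x ^ n
  ^-≡ x ≡.refl = refl

  ^-1 : ∀ x → x ^ 1 ≈ x
  ^-1 x = trans (pow-suc x 0) (trans (*-congˡ (pow-zero x)) (*-identityʳ x))

  ^-2 : ∀ x → x ^ 2 ≈ x * x
  ^-2 x = trans (pow-suc x 1) (*-congˡ (^-1 x))

  ^2-^ : ∀ x n → (x ^ 2) ^ n ≈ x ^ n * x ^ n
  ^2-^ x zero    = trans (pow-zero _) (sym (trans (*-cong (pow-zero x) (pow-zero x)) (*-identityˡ 1#)))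
  ^2-^ x (suc n) = begin
    (x ^ 2) ^ suc n                    ≈⟨ pow-suc (x ^ 2) n ⟩
    x ^ 2 * (x ^ 2) ^ n                ≈⟨ *-cong (^-2 x) (^2-^ x n) ⟩
    x * x * (x ^ n * x ^ n)            ≈⟨ solve 2 (λ x y → x :* x :* (y :* y) := x :* y :* (x :* y)) refl x (x ^ n) ⟩
    x * x ^ n * (x * x ^ n)            ≈⟨ *-cong (pow-suc x n) (pow-suc x n) ⟨
    x ^ suc n * x ^ suc n ∎

  ^-≼ : ∀ {x s} → x ≼ s → ∀ n → x ^ n ≼ s ^ℚ n
  ^-≼ x≼s zero    = ≼-resp-≈ (sym (pow-zero _)) 1≼1
  ^-≼ x≼s (suc n) = ≼-resp-≈ (sym (pow-suc _ n)) (≼-* x≼s (^-≼ x≼s n))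

  ^-≽ : ∀ {x δ} → 0ℚ ℚ.< δ → x ≽ δ → ∀ n → ∃[ ε ] 0ℚ ℚ.< ε × x ^ n ≽ ε
  ^-≽ 0<δ x≽δ zero    = 1ℚ , 0<1 , ≽-resp-≈ (sym (pow-zero _)) 1≽1
  ^-≽ 0<δ x≽δ (suc n) = let ε , 0<ε , h = ^-≽ 0<δ x≽δ n in
    _ , pos* 0<δ 0<ε , ≽-resp-≈ (sym (pow-suc _ n)) (≽-* x≽δ h)

  ^-inverse : ∀ {x w} → x * w ≈ 1# → ∀ n → x ^ n * w ^ n ≈ 1#
  ^-inverse         e zero    = trans (*-cong (pow-zero _) (pow-zero _)) (*-identityˡ 1#)
  ^-inverse {x} {w} e (suc n) = begin
    x ^ suc n * w ^ suc n        ≈⟨ *-cong (pow-suc x n) (pow-suc w n) ⟩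
    x * x ^ n * (w * w ^ n)      ≈⟨ solve 4 (λ x y w v → x :* y :* (w :* v) := x :* w :* (y :* v)) refl
                                      x (x ^ n) w (w ^ n) ⟩
    x * w * (x ^ n * w ^ n)      ≈⟨ *-cong e (^-inverse e n) ⟩
    1# * 1#                      ≈⟨ *-identityˡ 1# ⟩
    1# ∎

  module _ (a q : Carrier) {r : ℚ} (0<r : 0ℚ ℚ.< r) (r<1 : r ℚ.< 1ℚ) (q≼r : q ≼ r) where

    open Geometric 0<r r<1
    open Powers 𝓡 q (q ^_) (pow-zero q) (pow-suc q) 0<r r<1 q≼r
    open Recurrences commutativeSemiring q (q ^_) (pow-zero q) (pow-suc q)

    -- a ≠ - q⁻ᵐ whenever q ≠ 0
    Avoids : ℕ → Set
    Avoids m = ∀ δ → 0ℚ ℚ.< δ → q ≽ δ →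
      ∃[ w ] q * w ≈ 1# × ∃[ ε ] 0ℚ ℚ.< ε × a - - (w ^ m) ≽ ε

    avoids⇒≽ : ∀ m → Avoids (suc m) → ∃[ δ ] 0ℚ ℚ.< δ × 1# + a * q ^ suc m ≽ δ
    avoids⇒≽ m avoids =
      let B , 0<B , a≼B = has-bound a
          -- s ≤ 1 / (2 B), so that ∣ q ∣ ≤ s makes ∣ a q^(m+1) ∣ at most 1/2.
          s , 0<s , s≤1 , s≤ = positive-lower-bound 0<1 (pos* 0<½ (0<inv 0<B))
      in Sum.[ small 0<B a≼B s≤ , apart (half 0<s) ]′ (small-or-apart q 0<s)
      where
      small : ∀ {B s} → 0ℚ ℚ.< B → a ≼ B → s ℚ.≤ ½ ℚ.* inv B → q ≼ s →
              ∃[ δ ] 0ℚ ℚ.< δ × 1# + a * q ^ suc m ≽ δ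
      small {B} {s} 0<B a≼B s≤ q≼s = ½ , 0<½ , ≽-+ {s = ½} 1≽1 (≼-mono
        (≼-resp-≈ (*-congˡ (sym (pow-suc q m))) (≼-* a≼B (≼-* q≼s (p≼1 m))))
        (subst (B ℚ.* (s ℚ.* 1ℚ) ℚ.≤_) (*-inv-cancel 0<B ½) (*-monoˡ-≤ B (ℚ.<⇒≤ 0<B)
          (subst (ℚ._≤ ½ ℚ.* inv B) (≡.sym (ℚ.*-identityʳ s)) s≤)))) (ℚ.<⇒≤ 0<½)
      apart : ∀ {δ} → 0ℚ ℚ.< δ → q ≽ δ → ∃[ δ ] 0ℚ ℚ.< δ × 1# + a * q ^ suc m ≽ δ
      -- 1 + a q^(m+1) = q^(m+1) (a + w^(m+1)) with w = 1/q, and both factors are bounded below.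
      apart 0<δ q≽δ =
        let w , qw≈1 , ε , 0<ε , h = avoids _ 0<δ q≽δ
            η , 0<η , k = ^-≽ 0<δ q≽δ (suc m)
        in _ , pos* 0<η 0<ε , ≽-resp-≈ (begin
          q ^ suc m * (a - - (w ^ suc m))
            ≈⟨ *-congˡ (+-congˡ (neg-neg (w ^ suc m))) ⟩
          q ^ suc m * (a + w ^ suc m)
            ≈⟨ solve 3 (λ x a w → x :* (a :+ w) := x :* w :+ a :* x) refl
                 (q ^ suc m) a (w ^ suc m) ⟩
          q ^ suc m * w ^ suc m + a * q ^ suc m
            ≈⟨ +-congʳ (^-inverse qw≈1 (suc m)) ⟩
          1# + a * q ^ suc m ∎) (≽-* k h)

    power≈ : ∀ n → power n a ≈ a ^ n * q ^ (n ℕ.^ 2)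
    power≈ zero    = sym (trans (*-cong (pow-zero a) (pow-zero q)) (*-identityˡ 1#))
    power≈ (suc n) = begin
      a * (q * (q ^ n * q ^ n)) * power n a
        ≈⟨ *-congˡ (power≈ n) ⟩
      a * (q * (q ^ n * q ^ n)) * (a ^ n * q ^ (n ℕ.^ 2))
        ≈⟨ solve 5 (λ a q p b c → a :* (q :* (p :* p)) :* (b :* c)
             := a :* b :* (q :* (p :* (p :* c)))) refl a q (q ^ n) (a ^ n) (q ^ (n ℕ.^ 2)) ⟩
      a * a ^ n * (q * (q ^ n * (q ^ n * q ^ (n ℕ.^ 2))))
        ≈⟨ *-cong (pow-suc a n) (trans (pow-suc q _) (*-congˡ (trans (^-+ q n _)
             (*-congˡ (^-+ q n _))))) ⟨
      a ^ suc n * q ^ suc (n ℕ.+ (n ℕ.+ n ℕ.^ 2))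
        -- `n ℕ.^ 2` unfolds to n * (n * 1), hence the factors 1 in the polynomials.
        ≈⟨ *-congˡ (^-≡ q (ℕ.+-*-Solver.solve 1 (λ n →
             con′ 1 +′ (n +′ (n +′ n *′ (n *′ con′ 1)))
             =′ (con′ 1 +′ n) *′ ((con′ 1 +′ n) *′ con′ 1)) ≡.refl n)) ⟩
      a ^ suc n * q ^ (suc n ℕ.^ 2) ∎
      where open ℕ.+-*-Solver using () renaming (con to con′; _:+_ to _+′_; _:*_ to _*′_; _:=_ to _=′_)

    numerator₁ : ∀ n → power n a * q ^ n ≈ a ^ n * q ^ (n ℕ.^ 2 ℕ.+ n)
    numerator₁ n = trans (*-congʳ (power≈ n)) (trans (*-assoc _ _ _)
      (*-congˡ (sym (^-+ q (n ℕ.^ 2) n))))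

    numerator₂ : ∀ n → power n a * (q ^ n * q ^ n) ≈ a ^ n * q ^ (n ℕ.^ 2 ℕ.+ 2 ℕ.* n)
    numerator₂ n = trans (*-congʳ (power≈ n)) (trans (*-assoc _ _ _)
      (*-congˡ (sym (trans (^-≡ q (cong (λ m → n ℕ.^ 2 ℕ.+ (n ℕ.+ m)) (ℕ.+-identityʳ n)))
        (trans (^-+ q (n ℕ.^ 2) (n ℕ.+ n)) (*-congˡ (^-+ q n n)))))))

    factor₁ : ∀ n → - (q * q ^ n) ≈ - P n
    factor₁ n = -‿cong (sym (pow-suc q n))

    q²-^ : ∀ n → q ^ 2 * (q ^ 2) ^ n ≈ P n * P n
    q²-^ n = trans (sym (pow-suc (q ^ 2) n)) (^2-^ q (suc n))

    factor₂ : ∀ n → - (q ^ 2 * (q ^ 2) ^ n) ≈ - (P n * P n)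
    factor₂ n = -‿cong (q²-^ n)

    factor₃ : ∀ n → - (- (a * q ^ 2) * (q ^ 2) ^ n) ≈ a * (P n * P n)
    factor₃ n = begin
      - (- (a * q ^ 2) * (q ^ 2) ^ n)   ≈⟨ -‿cong (-‿distribˡ-* _ _) ⟨
      - - (a * q ^ 2 * (q ^ 2) ^ n)     ≈⟨ neg-neg _ ⟩
      a * q ^ 2 * (q ^ 2) ^ n           ≈⟨ *-assoc a _ _ ⟩
      a * (q ^ 2 * (q ^ 2) ^ n)         ≈⟨ *-congˡ (q²-^ n) ⟩
      a * (P n * P n) ∎

    factor₄ : ∀ n → - (- (a * q ^ 3) * (q ^ 2) ^ n) ≈ a * q * (P n * P n)
    factor₄ n = begin
      - (- (a * q ^ 3) * (q ^ 2) ^ n)   ≈⟨ -‿cong (-‿distribˡ-* _ _) ⟨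
      - - (a * q ^ 3 * (q ^ 2) ^ n)     ≈⟨ neg-neg _ ⟩
      a * q ^ 3 * (q ^ 2) ^ n           ≈⟨ *-congʳ (*-congˡ (pow-suc q 2)) ⟩
      a * (q * q ^ 2) * (q ^ 2) ^ n     ≈⟨ solve 4 (λ a q s t → a :* (q :* s) :* t
                                             := a :* q :* (s :* t)) refl a q (q ^ 2) ((q ^ 2) ^ n) ⟩
      a * q * (q ^ 2 * (q ^ 2) ^ n)     ≈⟨ *-congˡ (q²-^ n) ⟩
      a * q * (P n * P n) ∎

    numer₁ numer₂ : ℕ → Carrier
    numer₁ n = a ^ n * q ^ (n ℕ.^ 2 ℕ.+ n)
    numer₂ n = a ^ n * q ^ (n ℕ.^ 2 ℕ.+ 2 ℕ.* n)

    denom : ℕ → ℕ → Carrier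
    denom m n = pochhammer (q ^ 2) (q ^ 2) n * pochhammer (- (a * q ^ m)) (q ^ 2) n

    Identities : Set
    Identities =
      ∃[ S ] ∃[ P₁ ] ∃[ T₁ ] Converges numer₁ (pochhammer q q) S
        × pochhammer (- (a * q ^ 2)) (q ^ 2) ⇝ P₁ × Converges numer₂ (denom 2) T₁ × S ≋ P₁ * T₁
        × ((∀ n → Avoids (2 ℕ.* suc n ℕ.+ 1)) → ∃[ P₂ ] ∃[ T₂ ]
            pochhammer (- (a * q ^ 3)) (q ^ 2) ⇝ P₂ × Converges numer₁ (denom 3) T₂ × S ≋ P₂ * T₂)

    q^2N : ∀ n → q ^ (2 ℕ.* suc n) ≈ P n * P n
    q^2N n = trans (^-≡ q (cong (suc n ℕ.+_) (ℕ.+-identityʳ (suc n)))) (^-+ q (suc n) (suc n))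

    avoids₂⇒≽ : ∀ n → Avoids (2 ℕ.* suc n) → ∃[ δ ] 0ℚ ℚ.< δ × 1# + a * (P n * P n) ≽ δ
    avoids₂⇒≽ n avoids =
      let δ , 0<δ , h = avoids⇒≽ (n ℕ.+ (suc n ℕ.+ 0)) avoids
      in δ , 0<δ , ≽-resp-≈ (+-congˡ (*-congˡ (q^2N n))) h

    avoids₃⇒≽ : ∀ n → Avoids (2 ℕ.* suc n ℕ.+ 1) →
                ∃[ δ ] 0ℚ ℚ.< δ × 1# + a * q * (P n * P n) ≽ δ
    avoids₃⇒≽ n avoids =
      let δ , 0<δ , h = avoids⇒≽ (n ℕ.+ (suc n ℕ.+ 0) ℕ.+ 1) avoids
      in δ , 0<δ , ≽-resp-≈ (+-congˡ (trans
           (*-congˡ (trans (^-+ q (2 ℕ.* suc n) 1) (*-cong (q^2N n) (^-1 q))))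
           (solve 3 (λ a q t → a :* (t :* q) := a :* q :* t) refl a q (P n * P n)))) h

    module _ {B : ℚ} (0<B : 0ℚ ℚ.< B) (a≼B : a ≼ B)
      {d : ℕ → Carrier} {D : ℚ} (0≤D : 0ℚ ℚ.≤ D) (d≼ : ∀ n → d n ≼ D)
      (d-inverse : ∀ n → product (λ n → - (P n * P n)) n * d n ≈ 1#)
      where

      open Identity 𝓡 a q (q ^_) (pow-zero q) (pow-suc q) 0<r r<1 q≼r 0<B a≼B

      d-zero : d 0 ≈ 1#
      d-zero = inverses-zero {λ n → - (P n * P n)} d-inverse

      B*r^ : ∀ {z} n → z ≼ scale 0 ℚ.* r ^ℚ n → z ≼ B ℚ.* r ^ℚ n
      B*r^ n = ≼-resp-≡ (cong (ℚ._* r ^ℚ n) (ℚ.*-identityʳ B))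

      -- Serves the second expression with m = 2 and `e n` = q^(2n), and the third with m = 3 and
      -- `e n` = qⁿ; `d n` is 1/(q²; q²)ₙ in both.
      series : ∀ {g e W numer : ℕ → Carrier} {m S} → (∀ n → ∃[ δ ] 0ℚ ℚ.< δ × 1# + g n ≽ δ) →
        (∀ n → g n ≼ scale 0 ℚ.* r ^ℚ n) → (∀ n → - (- (a * q ^ m) * (q ^ 2) ^ n) ≈ g n) →
        (∀ n → e n ≼ 1ℚ) → e 0 ≈ 1# → (∀ n → power n a * e n ≈ numer n) → W 0 ≈ 1# →
        (∀ n → W (suc n) ≈ (1# + g n) * W n + power (suc n) a * e (suc n) * d (suc n)) →
        W ⇝ S →
        ∃[ Q ] ∃[ T ] pochhammer (- (a * q ^ m)) (q ^ 2) ⇝ Q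
          × Converges numer (denom m) T × S ≋ Q * T
      series {g} {e} {W} {numer} {m} {S} factors g≼ g≈ e≼ e-zero numer≈ W-zero W-suc W⇝ =
        let product≽ = product-≽ 0<r r<1 0≤B (λ n → B*r^ n (g≼ n)) factors
            δ , 0<δ , δ≼ = product≽
            ε , 0<ε , ε≼ = product-d-≽
            π , π-inverse , M , 0<M , π≼ = bounded-inverses 0<r r<1 product≽
            Q , T , product⇝ , sum⇝ , S≋ = factorization d-zero 0≤D d≼ {g} {e} {W} {π}
              (ℚ.<⇒≤ 0<M) (λ n → B*r^ n (g≼ n)) π-inverse π≼ e≼ e-zero W-zero W-suc W⇝
        in Q , T
           , ⇝-resp-≈ (λ n → sym (pochhammer≈product g≈ n)) product⇝
           , converges-by
               (λ n → _ , pos* 0<ε 0<δ , ≽-resp-≈ (*-cong (sym (pochhammer≈product factor₂ n))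
                 (sym (pochhammer≈product g≈ n))) (≽-* (ε≼ n) (δ≼ n)))
               (λ n → trans (*-congʳ (*-cong (pochhammer≈product factor₂ n)
                   (pochhammer≈product g≈ n)))
                 (trans (solve 4 (λ x y u v → x :* y :* (u :* v) := x :* u :* (y :* v)) refl
                   _ _ (d n) (π n)) (trans (*-cong (d-inverse n) (π-inverse n)) (*-identityˡ 1#))))
               numer≈ sum⇝
           , S≋

      module _ {f : ℕ → Carrier} {C : ℚ} (0≤C : 0ℚ ℚ.≤ C) (f≼ : ∀ n → f n ≼ C)
        (f-inverse : ∀ n → product (λ n → - P n) n * f n ≈ 1#)
        where

        f-zero : f 0 ≈ 1#
        f-zero = inverses-zero {λ n → - P n} f-inverse

        f-suc : ∀ n → f (suc n) ≈ f n + P n * f (suc n)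
        f-suc n = move-neg (inverses-suc {λ n → - P n} f-inverse n)

        d-suc : ∀ n → d (suc n) ≈ d n + P n * P n * d (suc n)
        d-suc n = move-neg (inverses-suc {λ n → - (P n * P n)} d-inverse n)

        first : ∀ {S} → (λ n → F f n a) ⇝ S → Converges numer₁ (pochhammer q q) S
        first F⇝ =
          let δ , 0<δ , δ≼ = product-f-≽
          in converges-by
            (λ n → δ , 0<δ , ≽-resp-≈ (sym (pochhammer≈product factor₁ n)) (δ≼ n))
            (λ n → trans (*-congʳ (pochhammer≈product factor₁ n)) (f-inverse n))
            numerator₁ (⇝-pred (⇝-resp-≈ (λ n → sym (F-sum f-zero n)) F⇝))

        identities : (∀ n → Avoids (2 ℕ.* suc n)) → Identities
        identities avoids₂ =
          let S , F⇝ , G⇝ , H⇝ = common-limit f-zero f-suc d-zero d-suc 0≤C f≼ 0≤D d≼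
              P₁ , T₁ , P₁⇝ , T₁⇝ , S≋ = series {gG 0} {λ n → q ^ n * q ^ n} {m = 2}
                (λ n → avoids₂⇒≽ n (avoids₂ n)) (gG≼ 0) factor₃ pp≼1
                (trans (*-cong (pow-zero q) (pow-zero q)) (*-identityˡ 1#)) numerator₂ refl
                (λ n → refl) G⇝
          in S , P₁ , T₁ , first F⇝ , P₁⇝ , T₁⇝ , S≋ , λ avoids₃ →
             series {gH 0} {q ^_} {m = 3} (λ n → avoids₃⇒≽ n (avoids₃ n)) (gH≼ 0) factor₄ p≼1
               (pow-zero q) numerator₁ refl (λ n → refl) H⇝

    theorem : (∀ n → Avoids (2 ℕ.* suc n)) → Identities
    theorem =
      let B , 0<B , a≼B = has-bound a
          d , d-inverse , D , 0<D , d≼ = bounded-inverses 0<r r<1 product-d-≽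
          f , f-inverse , C , 0<C , f≼ = bounded-inverses 0<r r<1 product-f-≽
      in identities 0<B a≼B (ℚ.<⇒≤ 0<D) d≼ d-inverse (ℚ.<⇒≤ 0<C) f≼ f-inverse

-- The complex numbers as a complete normed ring

open import Defs
open ℚS

always : ∀ {P} → (∀ n → P n) → Eventually P
always p = 0 , λ n _ → p n

rₙ iₙ : ℂ → ℕ → ℚ
rₙ z = seq (re z)
iₙ z = seq (im z)

infix 4 _∼_ _≼_ _≽_

-- Equality from some index on: finer than ≈, respected by all algebraic
-- operations, and sufficient for z z⁻¹ = 1.
record _∼_ (z w : ℂ) : Set where
  constructor mk∼
  field
    eventually : Eventually λ n → rₙ z n ≡ rₙ w n × iₙ z n ≡ iₙ w n

pointwise : ∀ {z w} → (∀ n → rₙ z n ≡ rₙ w n) → (∀ n → iₙ z n ≡ iₙ w n) → z ∼ w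
pointwise r i = mk∼ (always λ n → r n , i n)

∼-refl : ∀ {z} → z ∼ z
∼-refl = pointwise (λ _ → ≡.refl) (λ _ → ≡.refl)

∼-sym : ∀ {z w} → z ∼ w → w ∼ z
∼-sym (mk∼ e) = mk∼ (ev-map (λ _ (r , i) → ≡.sym r , ≡.sym i) e)

∼-trans : ∀ {z w v} → z ∼ w → w ∼ v → z ∼ v
∼-trans (mk∼ e) (mk∼ f) =
  mk∼ (ev-map₂ (λ _ (r , i) (r′ , i′) → ≡.trans r r′ , ≡.trans i i′) e f)

+-∼ : ∀ {z z′ w w′} → z ∼ z′ → w ∼ w′ → z + w ∼ z′ + w′
+-∼ (mk∼ e) (mk∼ f) =
  mk∼ (ev-map₂ (λ _ (r , i) (r′ , i′) → cong₂ ℚ._+_ r r′ , cong₂ ℚ._+_ i i′) e f)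

*-∼ : ∀ {z z′ w w′} → z ∼ z′ → w ∼ w′ → z * w ∼ z′ * w′
*-∼ (mk∼ e) (mk∼ f) = mk∼ (ev-map₂ (λ _ (r , i) (r′ , i′) →
    cong₂ ℚ._-_ (cong₂ ℚ._*_ r r′) (cong₂ ℚ._*_ i i′)
  , cong₂ ℚ._+_ (cong₂ ℚ._*_ r i′) (cong₂ ℚ._*_ i r′)) e f)

+-comm-∼ : ∀ z w → z + w ∼ w + z
+-comm-∼ z w = pointwise (λ n → ℚ.+-comm (rₙ z n) (rₙ w n)) (λ n → ℚ.+-comm (iₙ z n) (iₙ w n))

*-comm-∼ : ∀ z w → z * w ∼ w * z
*-comm-∼ z w = pointwise
  (λ n → solve 4 (λ x y u v → x :* u :- y :* v := u :* x :- v :* y) ≡.refl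
    (rₙ z n) (iₙ z n) (rₙ w n) (iₙ w n))
  (λ n → solve 4 (λ x y u v → x :* v :+ y :* u := u :* y :+ v :* x) ≡.refl
    (rₙ z n) (iₙ z n) (rₙ w n) (iₙ w n))

*-identityˡ-∼ : ∀ z → 1ℂ * z ∼ z
*-identityˡ-∼ z = pointwise
  (λ n → solve 2 (λ x y → con 1ℚ :* x :- con 0ℚ :* y := x) ≡.refl (rₙ z n) (iₙ z n))
  (λ n → solve 2 (λ x y → con 1ℚ :* y :+ con 0ℚ :* x := y) ≡.refl (rₙ z n) (iₙ z n))

distribˡ-∼ : ∀ t z w → t * (z + w) ∼ t * z + t * w
distribˡ-∼ t z w = pointwise
  (λ n → solve 6 (λ a b x y u v → a :* (x :+ u) :- b :* (y :+ v)
      := (a :* x :- b :* y) :+ (a :* u :- b :* v)) ≡.refl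
    (rₙ t n) (iₙ t n) (rₙ z n) (iₙ z n) (rₙ w n) (iₙ w n))
  (λ n → solve 6 (λ a b x y u v → a :* (y :+ v) :+ b :* (x :+ u)
      := (a :* y :+ b :* x) :+ (a :* v :+ b :* u)) ≡.refl
    (rₙ t n) (iₙ t n) (rₙ z n) (iₙ z n) (rₙ w n) (iₙ w n))

*-identityʳ-∼ : ∀ z → z * 1ℂ ∼ z
*-identityʳ-∼ z = ∼-trans (*-comm-∼ z 1ℂ) (*-identityˡ-∼ z)

distribʳ-∼ : ∀ t z w → (z + w) * t ∼ z * t + w * t
distribʳ-∼ t z w = ∼-trans {(z + w) * t} {t * (z + w)} {z * t + w * t} (*-comm-∼ (z + w) t)
  (∼-trans {t * (z + w)} {t * z + t * w} {z * t + w * t} (distribˡ-∼ t z w)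
    (+-∼ {t * z} {z * t} {t * w} {w * t} (*-comm-∼ t z) (*-comm-∼ t w)))

+-assoc-∼ : ∀ z w v → (z + w) + v ∼ z + (w + v)
+-assoc-∼ z w v = pointwise
  (λ n → ℚ.+-assoc (rₙ z n) (rₙ w n) (rₙ v n)) (λ n → ℚ.+-assoc (iₙ z n) (iₙ w n) (iₙ v n))

+-identityˡ-∼ : ∀ z → 0ℂ + z ∼ z
+-identityˡ-∼ z = pointwise (λ n → ℚ.+-identityˡ (rₙ z n)) (λ n → ℚ.+-identityˡ (iₙ z n))

+-identityʳ-∼ : ∀ z → z + 0ℂ ∼ z
+-identityʳ-∼ z = pointwise (λ n → ℚ.+-identityʳ (rₙ z n)) (λ n → ℚ.+-identityʳ (iₙ z n))

+-inverseˡ-∼ : ∀ z → - z + z ∼ 0ℂ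
+-inverseˡ-∼ z = pointwise (λ n → ℚ.+-inverseˡ (rₙ z n)) (λ n → ℚ.+-inverseˡ (iₙ z n))

+-inverseʳ-∼ : ∀ z → z + - z ∼ 0ℂ
+-inverseʳ-∼ z = pointwise (λ n → ℚ.+-inverseʳ (rₙ z n)) (λ n → ℚ.+-inverseʳ (iₙ z n))

rₙ-* : ∀ z w n → rₙ (z * w) n ≡ rₙ z n ℚ.* rₙ w n ℚ.- iₙ z n ℚ.* iₙ w n
rₙ-* z w n = ≡.refl

iₙ-* : ∀ z w n → iₙ (z * w) n ≡ rₙ z n ℚ.* iₙ w n ℚ.+ iₙ z n ℚ.* rₙ w n
iₙ-* z w n = ≡.refl

*-assoc-∼ : ∀ z w v → (z * w) * v ∼ z * (w * v)
*-assoc-∼ z w v = pointwise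
  (λ n → begin
    rₙ ((z * w) * v) n
      ≡⟨ rₙ-* (z * w) v n ⟩
    rₙ (z * w) n ℚ.* rₙ v n ℚ.- iₙ (z * w) n ℚ.* iₙ v n
      ≡⟨ cong₂ (λ a b → a ℚ.* rₙ v n ℚ.- b ℚ.* iₙ v n) (rₙ-* z w n) (iₙ-* z w n) ⟩
    _
      ≡⟨ solve 6 (λ x y u v s t →
           (x :* u :- y :* v) :* s :- (x :* v :+ y :* u) :* t
           := x :* (u :* s :- v :* t) :- y :* (u :* t :+ v :* s)) ≡.refl
         (rₙ z n) (iₙ z n) (rₙ w n) (iₙ w n) (rₙ v n) (iₙ v n) ⟩
    _
      ≡⟨ cong₂ (λ a b → rₙ z n ℚ.* a ℚ.- iₙ z n ℚ.* b) (rₙ-* w v n) (iₙ-* w v n) ⟨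
    rₙ z n ℚ.* rₙ (w * v) n ℚ.- iₙ z n ℚ.* iₙ (w * v) n
      ≡⟨ rₙ-* z (w * v) n ⟨
    rₙ (z * (w * v)) n ∎)
  (λ n → begin
    iₙ ((z * w) * v) n
      ≡⟨ iₙ-* (z * w) v n ⟩
    rₙ (z * w) n ℚ.* iₙ v n ℚ.+ iₙ (z * w) n ℚ.* rₙ v n
      ≡⟨ cong₂ (λ a b → a ℚ.* iₙ v n ℚ.+ b ℚ.* rₙ v n) (rₙ-* z w n) (iₙ-* z w n) ⟩
    _
      ≡⟨ solve 6 (λ x y u v s t →
           (x :* u :- y :* v) :* t :+ (x :* v :+ y :* u) :* s
           := x :* (u :* t :+ v :* s) :+ y :* (u :* s :- v :* t)) ≡.refl
         (rₙ z n) (iₙ z n) (rₙ w n) (iₙ w n) (rₙ v n) (iₙ v n) ⟩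
    _
      ≡⟨ cong₂ (λ a b → rₙ z n ℚ.* b ℚ.+ iₙ z n ℚ.* a) (rₙ-* w v n) (iₙ-* w v n) ⟨
    rₙ z n ℚ.* iₙ (w * v) n ℚ.+ iₙ z n ℚ.* rₙ (w * v) n
      ≡⟨ iₙ-* z (w * v) n ⟨
    iₙ (z * (w * v)) n ∎)
  where open ≡.≡-Reasoning

∼-isEquivalence : IsEquivalence _∼_
∼-isEquivalence = record { refl = ∼-refl ; sym = ∼-sym ; trans = ∼-trans }

+-isMagma-∼ : IsMagma _∼_ _+_
+-isMagma-∼ = record
  { isEquivalence = ∼-isEquivalence ; ∙-cong = λ {x} {y} {u} {v} → +-∼ {x} {y} {u} {v} }

+-isSemigroup-∼ : IsSemigroup _∼_ _+_
+-isSemigroup-∼ = record { isMagma = +-isMagma-∼ ; assoc = +-assoc-∼ }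

+-isMonoid-∼ : IsMonoid _∼_ _+_ 0ℂ
+-isMonoid-∼ = record
  { isSemigroup = +-isSemigroup-∼ ; identity = +-identityˡ-∼ , +-identityʳ-∼ }

+-isGroup-∼ : IsGroup _∼_ _+_ 0ℂ (-_)
+-isGroup-∼ = record
  { isMonoid = +-isMonoid-∼
  ; inverse = +-inverseˡ-∼ , +-inverseʳ-∼
  ; ⁻¹-cong = λ { (mk∼ e) → mk∼ (ev-map (λ _ (r , i) → cong ℚ.-_ r , cong ℚ.-_ i) e) } }

+-*-isRing-∼ : IsRing _∼_ _+_ _*_ (-_) 0ℂ 1ℂ
+-*-isRing-∼ = record
  { +-isAbelianGroup = record { isGroup = +-isGroup-∼ ; comm = +-comm-∼ }
  ; *-cong = λ {x} {y} {u} {v} → *-∼ {x} {y} {u} {v}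
  ; *-assoc = *-assoc-∼
  ; *-identity = *-identityˡ-∼ , *-identityʳ-∼
  ; distrib = distribˡ-∼ , distribʳ-∼ }

infixl 6 _⊕_
infixl 7 _⊗_
infix  8 ⊖_

-- The operations of ℂ, made opaque so that the type checker never unfolds them
-- and compares the proofs of Cauchyness that they carry.
opaque
  _⊕_ _⊗_ : ℂ → ℂ → ℂ
  _⊕_ = _+_
  _⊗_ = _*_

  ⊖_ : ℂ → ℂ
  ⊖_ = -_

  ⊕-⊗-isRing : IsRing _∼_ _⊕_ _⊗_ ⊖_ 0ℂ 1ℂ
  ⊕-⊗-isRing = +-*-isRing-∼

  ⊗-comm : ∀ z w → z ⊗ w ∼ w ⊗ z
  ⊗-comm = *-comm-∼

  ⊕∼+ : ∀ z w → z ⊕ w ∼ z + w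
  ⊕∼+ z w = pointwise (λ _ → ≡.refl) (λ _ → ≡.refl)

  ⊗∼* : ∀ z w → z ⊗ w ∼ z * w
  ⊗∼* z w = pointwise (λ _ → ≡.refl) (λ _ → ≡.refl)

  ⊖∼- : ∀ z → ⊖ z ∼ - z
  ⊖∼- z = pointwise (λ _ → ≡.refl) (λ _ → ≡.refl)

  ⊕⊖∼- : ∀ z w → z ⊕ ⊖ w ∼ z - w
  ⊕⊖∼- z w = pointwise (λ _ → ≡.refl) (λ _ → ≡.refl)

  ⊗≡* : _⊗_ ≡ _*_
  ⊗≡* = ≡.refl

  ⊖≡- : ⊖_ ≡ (-_)
  ⊖≡- = ≡.refl

ℂ-commutativeRing : CommutativeRing 0ℓ 0ℓ
ℂ-commutativeRing = record
  { Carrier = ℂ ; _≈_ = _∼_ ; _+_ = _⊕_ ; _*_ = _⊗_ ; -_ = ⊖_ ; 0# = 0ℂ ; 1# = 1ℂ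
  ; isCommutativeRing = record { isRing = ⊕-⊗-isRing ; *-comm = ⊗-comm } }

normₙ : ℂ → ℕ → ℚ
normₙ z = seq (normSq z)

0≤normₙ : ∀ z n → 0ℚ ℚ.≤ normₙ z n
0≤normₙ z n = nonNeg+ (0≤p² (rₙ z n)) (0≤p² (iₙ z n))

normₙ-* : ∀ z w n → normₙ (z * w) n ≡ normₙ z n ℚ.* normₙ w n
normₙ-* z w n = solve 4 (λ x y u v →
    (x :* u :- y :* v) :* (x :* u :- y :* v) :+ (x :* v :+ y :* u) :* (x :* v :+ y :* u)
    := (x :* x :+ y :* y) :* (u :* u :+ v :* v)) ≡.refl
  (rₙ z n) (iₙ z n) (rₙ w n) (iₙ w n)

normₙ-≡ : ∀ {z w n} → rₙ z n ≡ rₙ w n × iₙ z n ≡ iₙ w n → normₙ z n ≡ normₙ w n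
normₙ-≡ (r , i) = cong₂ ℚ._+_ (cong sq r) (cong sq i)

-- By Lagrange's identity, (x² + y²) (u² + v²) exceeds (x u + y v)² by (x v - y u)².
cauchy-schwarz : ∀ {r s} x y u v → 0ℚ ℚ.≤ r → 0ℚ ℚ.≤ s →
                 sq x ℚ.+ sq y ℚ.≤ sq r → sq u ℚ.+ sq v ℚ.≤ sq s →
                 x ℚ.* u ℚ.+ y ℚ.* v ℚ.≤ r ℚ.* s
cauchy-schwarz {r} {s} x y u v 0≤r 0≤s h₁ h₂ = sq-cancel-≤ (nonNeg* 0≤r 0≤s) (begin
  sq (x ℚ.* u ℚ.+ y ℚ.* v)
    ≤⟨ +⇒≤ (sq (x ℚ.* v ℚ.- y ℚ.* u)) (0≤p² (x ℚ.* v ℚ.- y ℚ.* u))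
         (solve 4 (λ x y u v → (x :* x :+ y :* y) :* (u :* u :+ v :* v)
           := (x :* u :+ y :* v) :* (x :* u :+ y :* v)
              :+ (x :* v :- y :* u) :* (x :* v :- y :* u)) ≡.refl x y u v) ⟩
  (sq x ℚ.+ sq y) ℚ.* (sq u ℚ.+ sq v)
    ≤⟨ *-mono-nonNeg-≤ (nonNeg+ (0≤p² x) (0≤p² y)) (0≤p² s) h₁ h₂ ⟩
  sq r ℚ.* sq s
    ≡⟨ solve 2 (λ r s → (r :* r) :* (s :* s) := (r :* s) :* (r :* s)) ≡.refl r s ⟩
  sq (r ℚ.* s) ∎)
  where open ℚ.≤-Reasoning

-- The bound concerns the representing rationals from some index on, and their squares, so that no
-- square root occurs; the sign of r is recorded because squaring loses it. This is stronger than ∣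
-- z ∣ ≤ r, and it respects `_∼_` but not `_≈_`.
record _≼_ (z : ℂ) (r : ℚ) : Set where
  constructor mk≼
  field
    0≤bound : 0ℚ ℚ.≤ r
    bounded : Eventually λ n → normₙ z n ℚ.≤ sq r

record _≽_ (z : ℂ) (r : ℚ) : Set where
  constructor mk≽
  field
    0≤bound : 0ℚ ℚ.≤ r
    bounded : Eventually λ n → sq r ℚ.≤ normₙ z n

≼-resp-∼ : ∀ {z w r} → z ∼ w → z ≼ r → w ≼ r
≼-resp-∼ {z} {w} {r} (mk∼ e) (mk≼ 0≤r b) =
  mk≼ 0≤r (ev-map₂ (λ n e h → subst (ℚ._≤ sq r) (normₙ-≡ {z} {w} e) h) e b)

≽-resp-∼ : ∀ {z w r} → z ∼ w → z ≽ r → w ≽ r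
≽-resp-∼ {z} {w} {r} (mk∼ e) (mk≽ 0≤r b) =
  mk≽ 0≤r (ev-map₂ (λ n e h → subst (sq r ℚ.≤_) (normₙ-≡ {z} {w} e) h) e b)

≼-mono : ∀ {z r s} → z ≼ r → r ℚ.≤ s → z ≼ s
≼-mono (mk≼ 0≤r b) r≤s =
  mk≼ (ℚ.≤-trans 0≤r r≤s) (ev-map (λ n h → ℚ.≤-trans h (sq-mono-≤ 0≤r r≤s)) b)

≽-mono : ∀ {z r s} → z ≽ r → 0ℚ ℚ.≤ s → s ℚ.≤ r → z ≽ s
≽-mono (mk≽ 0≤r b) 0≤s s≤r =
  mk≽ 0≤s (ev-map (λ n h → ℚ.≤-trans (sq-mono-≤ 0≤s s≤r) h) b)

≼-+ : ∀ {z w r s} → z ≼ r → w ≼ s → z + w ≼ r ℚ.+ s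
≼-+ {z} {w} {r} {s} (mk≼ 0≤r b) (mk≼ 0≤s c) = mk≼ (nonNeg+ 0≤r 0≤s) (ev-map₂ (λ n h₁ h₂ →
  triangle (rₙ z n) (iₙ z n) (rₙ w n) (iₙ w n) h₁ h₂) b c)
  where
  triangle : ∀ x y u v → sq x ℚ.+ sq y ℚ.≤ sq r → sq u ℚ.+ sq v ℚ.≤ sq s →
             sq (x ℚ.+ u) ℚ.+ sq (y ℚ.+ v) ℚ.≤ sq (r ℚ.+ s)
  triangle x y u v h₁ h₂ = subst₂ ℚ._≤_
    (solve 4 (λ x y u v → (x :* x :+ y :* y) :+ (u :* u :+ v :* v)
        :+ ((x :* u :+ y :* v) :+ (x :* u :+ y :* v))
      := (x :+ u) :* (x :+ u) :+ (y :+ v) :* (y :+ v)) ≡.refl x y u v)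
    (solve 2 (λ r s → r :* r :+ s :* s :+ (r :* s :+ r :* s) := (r :+ s) :* (r :+ s)) ≡.refl r s)
    (ℚ.+-mono-≤ (ℚ.+-mono-≤ h₁ h₂) (ℚ.+-mono-≤ cs cs))
    where
    cs : x ℚ.* u ℚ.+ y ℚ.* v ℚ.≤ r ℚ.* s
    cs = cauchy-schwarz x y u v 0≤r 0≤s h₁ h₂

≼-* : ∀ {z w r s} → z ≼ r → w ≼ s → z * w ≼ r ℚ.* s
≼-* {z} {w} {r} {s} (mk≼ 0≤r b) (mk≼ 0≤s c) = mk≼ (nonNeg* 0≤r 0≤s) (ev-map₂ (λ n h₁ h₂ →
  subst₂ ℚ._≤_ (≡.sym (normₙ-* z w n))
    (solve 2 (λ r s → (r :* r) :* (s :* s) := (r :* s) :* (r :* s)) ≡.refl r s)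
    (*-mono-nonNeg-≤ (0≤normₙ z n) (0≤p² s) h₁ h₂)) b c)

≽-* : ∀ {z w r s} → z ≽ r → w ≽ s → z * w ≽ r ℚ.* s
≽-* {z} {w} {r} {s} (mk≽ 0≤r b) (mk≽ 0≤s c) = mk≽ (nonNeg* 0≤r 0≤s) (ev-map₂ (λ n h₁ h₂ →
  subst₂ ℚ._≤_ (solve 2 (λ r s → (r :* r) :* (s :* s) := (r :* s) :* (r :* s)) ≡.refl r s)
    (≡.sym (normₙ-* z w n))
    (*-mono-nonNeg-≤ (0≤p² r) (0≤normₙ w n) h₁ h₂)) b c)

≼-neg : ∀ {z r} → z ≼ r → - z ≼ r
≼-neg {z} {r} (mk≼ 0≤r b) = mk≼ 0≤r (ev-map (λ n → subst (ℚ._≤ sq r)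
  (solve 2 (λ x y → x :* x :+ y :* y := (:- x) :* (:- x) :+ (:- y) :* (:- y)) ≡.refl
    (rₙ z n) (iₙ z n))) b)

0≼ : ∀ {r} → 0ℚ ℚ.≤ r → 0ℂ ≼ r
0≼ {r} 0≤r = mk≼ 0≤r (always λ _ → 0≤p² r)

1≼1 : 1ℂ ≼ 1ℚ
1≼1 = mk≼ 0≤1 (always λ _ → ℚ.≤-refl)

-- If ∣ z + w ∣ were less than r, expanding ∣ (z + w) - w ∣² with `cauchy-schwarz` would give ∣ z ∣
-- < r + s. The contradiction is about rationals, whose order is decidable.
≽-+ : ∀ {z w r s} → z ≽ r ℚ.+ s → w ≼ s → 0ℚ ℚ.≤ r → z + w ≽ r
≽-+ {z} {w} {r} {s} (mk≽ _ b) (mk≼ 0≤s c) 0≤r = mk≽ 0≤r (ev-map₂ (λ n h₁ h₂ →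
  triangle (rₙ z n) (iₙ z n) (rₙ w n) (iₙ w n) h₁ h₂) b c)
  where
  triangle : ∀ x y u v → sq (r ℚ.+ s) ℚ.≤ sq x ℚ.+ sq y → sq u ℚ.+ sq v ℚ.≤ sq s →
             sq r ℚ.≤ sq (x ℚ.+ u) ℚ.+ sq (y ℚ.+ v)
  triangle x y u v h₁ h₂ = ℚ.≮⇒≥ λ h → ℚ.<-irrefl ≡.refl (ℚ.<-≤-trans (ℚ.≤-<-trans
    (ℚ.≤-trans h₁ (ℚ.≤-reflexive
      (solve 4 (λ x y u v → x :* x :+ y :* y
        := ((x :+ u) :* (x :+ u) :+ (y :+ v) :* (y :+ v)) :+ ((u :* u :+ v :* v)
          :+ (((x :+ u) :* (:- u) :+ (y :+ v) :* (:- v))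
          :+ ((x :+ u) :* (:- u) :+ (y :+ v) :* (:- v))))) ≡.refl x y u v)))
    (ℚ.+-mono-<-≤ h (ℚ.+-mono-≤ h₂ (ℚ.+-mono-≤ (cs h) (cs h)))))
    (ℚ.≤-reflexive (solve 2 (λ r s → r :* r :+ (s :* s :+ (r :* s :+ r :* s))
      := (r :+ s) :* (r :+ s)) ≡.refl r s)))
    where
    cs : sq (x ℚ.+ u) ℚ.+ sq (y ℚ.+ v) ℚ.< sq r →
         (x ℚ.+ u) ℚ.* (ℚ.- u) ℚ.+ (y ℚ.+ v) ℚ.* (ℚ.- v) ℚ.≤ r ℚ.* s
    cs h = cauchy-schwarz (x ℚ.+ u) (y ℚ.+ v) (ℚ.- u) (ℚ.- v) 0≤r 0≤s (ℚ.<⇒≤ h)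
      (subst (ℚ._≤ sq s) (solve 2 (λ x y → x :* x :+ y :* y
        := (:- x) :* (:- x) :+ (:- y) :* (:- y)) ≡.refl u v) h₂)

∣∣≤⇒sq≤ : ∀ {p r} → ℚ.∣ p ∣ ℚ.≤ r → sq p ℚ.≤ sq r
∣∣≤⇒sq≤ {p} h = subst (ℚ._≤ _) (∣p∣²≡p² p) (sq-mono-≤ (ℚ.0≤∣p∣ p) h)

sq≤⇒∣∣≤ : ∀ {p r} → 0ℚ ℚ.≤ r → sq p ℚ.≤ sq r → ℚ.∣ p ∣ ℚ.≤ r
sq≤⇒∣∣≤ {p} {r} 0≤r h = sq-cancel-≤ 0≤r (subst (ℚ._≤ sq r) (≡.sym (∣p∣²≡p² p)) h)

≼⇒∣re∣≤ : ∀ {z r} → z ≼ r → Eventually λ n → ℚ.∣ rₙ z n ∣ ℚ.≤ r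
≼⇒∣re∣≤ {z} (mk≼ 0≤r b) = ev-map (λ n h → sq≤⇒∣∣≤ 0≤r
  (ℚ.≤-trans (+⇒≤ (sq (iₙ z n)) (0≤p² (iₙ z n)) ≡.refl) h)) b

≼⇒∣im∣≤ : ∀ {z r} → z ≼ r → Eventually λ n → ℚ.∣ iₙ z n ∣ ℚ.≤ r
≼⇒∣im∣≤ {z} (mk≼ 0≤r b) = ev-map (λ n h → sq≤⇒∣∣≤ 0≤r
  (ℚ.≤-trans (+⇒≤ (sq (rₙ z n)) (0≤p² (rₙ z n)) (ℚ.+-comm (sq (rₙ z n)) (sq (iₙ z n)))) h)) b

∣re∣,∣im∣⇒≼ : ∀ {z r s} → 0ℚ ℚ.≤ r → 0ℚ ℚ.≤ s →
              Eventually (λ n → ℚ.∣ rₙ z n ∣ ℚ.≤ r) →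
              Eventually (λ n → ℚ.∣ iₙ z n ∣ ℚ.≤ s) → z ≼ r ℚ.+ s
∣re∣,∣im∣⇒≼ {z} {r} {s} 0≤r 0≤s b c = mk≼ (nonNeg+ 0≤r 0≤s) (ev-map₂ (λ n h₁ h₂ → ℚ.≤-trans
  (ℚ.+-mono-≤ (∣∣≤⇒sq≤ {rₙ z n} h₁) (∣∣≤⇒sq≤ {iₙ z n} h₂))
  (+⇒≤ (r ℚ.* s ℚ.+ r ℚ.* s) (nonNeg+ (nonNeg* 0≤r 0≤s) (nonNeg* 0≤r 0≤s))
    (solve 2 (λ r s → (r :+ s) :* (r :+ s) := r :* r :+ s :* s :+ (r :* s :+ r :* s))
      ≡.refl r s))) b c)

has-bound : ∀ z → ∃[ B ] 0ℚ ℚ.< B × z ≼ B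
has-bound z =
  let B , 0<B , b = cauchy-bound {seq (re z)} (isCauchy (re z))
      C , 0<C , c = cauchy-bound {seq (im z)} (isCauchy (im z))
  in B ℚ.+ C , pos+ 0<B (ℚ.<⇒≤ 0<C) , ∣re∣,∣im∣⇒≼ (ℚ.<⇒≤ 0<B) (ℚ.<⇒≤ 0<C) b c

∣x-y∣<⇒x<y+ : ∀ {ε} x y → ℚ.∣ x ℚ.- y ∣ ℚ.< ε → x ℚ.< y ℚ.+ ε
∣x-y∣<⇒x<y+ x y h = p-q<ε⇒p<q+ε {x} {y} (ℚ.≤-<-trans (p≤∣p∣ (x ℚ.- y)) h)

∣x-y∣-comm : ∀ x y → ℚ.∣ x ℚ.- y ∣ ≡ ℚ.∣ y ℚ.- x ∣
∣x-y∣-comm x y = ≡.trans (≡.sym (ℚ.∣-p∣≡∣p∣ (x ℚ.- y)))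
  (cong ℚ.∣_∣ (solve 2 (λ x y → :- (x :- y) := y :- x) ≡.refl x y))

∣x-z∣≤ : ∀ x y z → ℚ.∣ x ℚ.- z ∣ ℚ.≤ ℚ.∣ x ℚ.- y ∣ ℚ.+ ℚ.∣ y ℚ.- z ∣
∣x-z∣≤ x y z = subst (λ p → ℚ.∣ p ∣ ℚ.≤ ℚ.∣ x ℚ.- y ∣ ℚ.+ ℚ.∣ y ℚ.- z ∣)
  (solve 3 (λ x y z → (x :- y) :+ (y :- z) := x :- z) ≡.refl x y z)
  (ℚ.∣p+q∣≤∣p∣+∣q∣ (x ℚ.- y) (y ℚ.- z))

½ε<ε : ∀ {ε} → 0ℚ ℚ.< ε → ½ ℚ.* ε ℚ.< ε
½ε<ε {ε} 0<ε = subst₂ ℚ._<_ (ℚ.+-identityʳ (½ ℚ.* ε)) (½+½ ε)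
  (ℚ.+-monoʳ-< (½ ℚ.* ε) (pos* 0<½ 0<ε))

+-cancelʳ-≤ : ∀ {x y} z → x ℚ.+ z ℚ.≤ y ℚ.+ z → x ℚ.≤ y
+-cancelʳ-≤ {x} {y} z h = subst₂ ℚ._≤_ (cancel x) (cancel y) (ℚ.+-monoˡ-≤ (ℚ.- z) h)
  where
  cancel : ∀ x → x ℚ.+ z ℚ.- z ≡ x
  cancel x = solve 2 (λ x z → x :+ z :- z := x) ≡.refl x z

sq-diff : ∀ {ε} x y → 0ℚ ℚ.≤ ε → x ℚ.+ ε ℚ.≤ y → sq ε ℚ.≤ sq (x ℚ.- y)
sq-diff {ε} x y 0≤ε h = subst (sq ε ℚ.≤_)
  (solve 2 (λ x y → (y :- x) :* (y :- x) := (x :- y) :* (x :- y)) ≡.refl x y)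
  (sq-mono-≤ 0≤ε (subst (ℚ._≤ y ℚ.- x) (solve 2 (λ x e → x :+ e :- x := e) ≡.refl x ε)
    (ℚ.+-monoˡ-≤ (ℚ.- x) h)))

apart-sq : ∀ x y → x #ᴿ y →
  ∃[ δ ] 0ℚ ℚ.< δ × Eventually λ n → sq δ ℚ.≤ sq (seq x n ℚ.- seq y n)
apart-sq x y (inj₁ (δ , 0<δ , e)) =
  δ , 0<δ , ev-map (λ n → sq-diff (seq x n) (seq y n) (ℚ.<⇒≤ 0<δ)) e
apart-sq x y (inj₂ (δ , 0<δ , e)) =
  δ , 0<δ , ev-map (λ n h → subst (sq δ ℚ.≤_)
    (solve 2 (λ x y → (y :- x) :* (y :- x) := (x :- y) :* (x :- y)) ≡.refl (seq x n) (seq y n))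
    (sq-diff (seq y n) (seq x n) (ℚ.<⇒≤ 0<δ) h)) e

sq-re≤ : ∀ z n → sq (rₙ z n) ℚ.≤ normₙ z n
sq-re≤ z n = +⇒≤ {sq (rₙ z n)} {normₙ z n} (sq (iₙ z n)) (0≤p² (iₙ z n)) ≡.refl

sq-im≤ : ∀ z n → sq (iₙ z n) ℚ.≤ normₙ z n
sq-im≤ z n = +⇒≤ {sq (iₙ z n)} {normₙ z n} (sq (rₙ z n)) (0≤p² (rₙ z n))
  (ℚ.+-comm (sq (rₙ z n)) (sq (iₙ z n)))

#⇒≽ : ∀ z w → z # w → ∃[ δ ] 0ℚ ℚ.< δ × (z - w) ≽ δ
#⇒≽ z w (inj₁ x#u) =
  let δ , 0<δ , e = apart-sq (re z) (re w) x#u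
  in δ , 0<δ , mk≽ (ℚ.<⇒≤ 0<δ) (ev-map (λ n h →
       ℚ.≤-trans {sq δ} {sq (rₙ (z - w) n)} {normₙ (z - w) n} h (sq-re≤ (z - w) n)) e)
#⇒≽ z w (inj₂ y#v) =
  let δ , 0<δ , e = apart-sq (im z) (im w) y#v
  in δ , 0<δ , mk≽ (ℚ.<⇒≤ 0<δ) (ev-map (λ n h →
       ℚ.≤-trans {sq δ} {sq (iₙ (z - w) n)} {normₙ (z - w) n} h (sq-im≤ (z - w) n)) e)

-- A single rational of size at least 2 ε fixes the sign, and all later ones stay within ε of it.
persistently-apart : ∀ x {ε N} → 0ℚ ℚ.< ε →
  (∀ n → N ℕ.≤ n → ℚ.∣ seq x N ℚ.- seq x n ∣ ℚ.< ε) →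
  ε ℚ.+ ε ℚ.≤ ℚ.∣ seq x N ∣ → x #ᴿ 0ᴿ
persistently-apart x {ε} {N} 0<ε close far with ℚ.∣p∣≡p∨∣p∣≡-p (seq x N)
... | inj₁ e = inj₂ (ε , 0<ε , N , λ n N≤n → subst (ℚ._≤ seq x n) (≡.sym (ℚ.+-identityˡ ε))
  (+-cancelʳ-≤ ε (ℚ.≤-trans (subst (ε ℚ.+ ε ℚ.≤_) e far)
    (ℚ.<⇒≤ (∣x-y∣<⇒x<y+ (seq x N) (seq x n) (close n N≤n))))))
... | inj₂ e = inj₁ (ε , 0<ε , N , λ n N≤n → +-cancelʳ-≤ (ε ℚ.- seq x n)
  (subst₂ ℚ._≤_
    (solve 2 (λ x e → e :+ e := x :+ e :+ (e :- x)) ≡.refl (seq x n) ε)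
    (≡.trans (ℚ.+-comm (ℚ.- seq x n) ε) (≡.sym (ℚ.+-identityˡ (ε ℚ.- seq x n))))
    (ℚ.≤-trans (subst (ε ℚ.+ ε ℚ.≤_) e far)
      (ℚ.<⇒≤ (∣x-y∣<⇒x<y+ (ℚ.- seq x N) (ℚ.- seq x n)
        (subst (ℚ._< ε) (≡.trans (≡.sym (ℚ.∣-p∣≡∣p∣ (seq x N ℚ.- seq x n)))
          (cong ℚ.∣_∣ (solve 2 (λ a b → :- (a :- b) := (:- a) :- (:- b)) ≡.refl
            (seq x N) (seq x n)))) (close n N≤n)))))))

¼ : ℚ
¼ = ½ ℚ.* ½

0<¼ : 0ℚ ℚ.< ¼
0<¼ = ℚ.positive⁻¹ ¼

-- At one late index N the squared norm is at least δ², so the real or the imaginary part is at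
-- least δ/2 there; two smaller parts would give less than δ²/2. Which one it is gets decided on
-- rationals, and a Cauchy modulus for δ/4 keeps that part apart from 0.
≽⇒# : ∀ {z δ} → 0ℚ ℚ.< δ → z ≽ δ → z # 0ℂ
≽⇒# {z} {δ} 0<δ (mk≽ _ (N₀ , far)) = go (½ ℚ.* δ ℚ.≤? ℚ.∣ rₙ z N ∣)
  where
  0<ε : 0ℚ ℚ.< ¼ ℚ.* δ
  0<ε = pos* 0<¼ 0<δ
  N₁ = proj₁ (isCauchy (re z) _ 0<ε)
  N₂ = proj₁ (isCauchy (im z) _ 0<ε)
  N = N₀ ℕ.⊔ (N₁ ℕ.⊔ N₂)
  N₁≤N : N₁ ℕ.≤ N
  N₁≤N = ℕ.≤-trans (ℕ.m≤m⊔n N₁ N₂) (ℕ.m≤n⊔m N₀ _)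
  N₂≤N : N₂ ℕ.≤ N
  N₂≤N = ℕ.≤-trans (ℕ.m≤n⊔m N₁ N₂) (ℕ.m≤n⊔m N₀ _)
  half : ½ ℚ.* δ ≡ ¼ ℚ.* δ ℚ.+ ¼ ℚ.* δ
  half = solve 1 (λ d → con ½ :* d := con ¼ :* d :+ con ¼ :* d) ≡.refl δ
  go : _ → z # 0ℂ
  go (yes ½δ≤) = inj₁ (persistently-apart (re z) 0<ε
    (λ n N≤n → proj₂ (isCauchy (re z) _ 0<ε) N n N₁≤N (ℕ.≤-trans N₁≤N N≤n))
    (subst (ℚ._≤ ℚ.∣ rₙ z N ∣) half ½δ≤))
  go (no ½δ≰) = inj₂ (persistently-apart (im z) 0<ε
    (λ n N≤n → proj₂ (isCauchy (im z) _ 0<ε) N n N₂≤N (ℕ.≤-trans N₂≤N N≤n))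
    (subst (ℚ._≤ ℚ.∣ iₙ z N ∣) half (ℚ.≮⇒≥ λ im< → ℚ.<-irrefl ≡.refl
      (ℚ.<-≤-trans (ℚ.≤-<-trans (far N (ℕ.m≤m⊔n N₀ _))
        (ℚ.+-mono-< (square< (rₙ z N) (ℚ.≰⇒> ½δ≰)) (square< (iₙ z N) im<)))
        (+⇒≤ (½ ℚ.* sq δ) (nonNeg* (ℚ.<⇒≤ 0<½) (0≤p² δ))
          (solve 1 (λ d → d :* d := (con ½ :* d) :* (con ½ :* d)
            :+ (con ½ :* d) :* (con ½ :* d) :+ con ½ :* (d :* d)) ≡.refl δ))))))
    where
    square< : ∀ p → ℚ.∣ p ∣ ℚ.< ½ ℚ.* δ → sq p ℚ.< sq (½ ℚ.* δ)
    square< p h = subst (ℚ._< sq (½ ℚ.* δ)) (∣p∣²≡p² p)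
      (*-mono-nonNeg-< (pos* 0<½ 0<δ) (ℚ.0≤∣p∣ p) (ℚ.<⇒≤ h) h)

-- Beyond N the squared norm moves by less than s²/4. Comparing it with s²/2 at N therefore leaves
-- at most 3 s²/4 afterwards in one case and at least s²/4 in the other.
small-or-apart : ∀ z {s} → 0ℚ ℚ.< s → z ≼ s ⊎ z ≽ ½ ℚ.* s
small-or-apart z {s} 0<s = go (normₙ z N ℚ.≤? ½ ℚ.* sq s)
  where
  0<η : 0ℚ ℚ.< ¼ ℚ.* sq s
  0<η = pos* 0<¼ (pos* 0<s 0<s)
  N = proj₁ (isCauchy (normSq z) _ 0<η)
  close : ∀ m n → N ℕ.≤ m → N ℕ.≤ n → ℚ.∣ normₙ z m ℚ.- normₙ z n ∣ ℚ.< ¼ ℚ.* sq s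
  close = proj₂ (isCauchy (normSq z) _ 0<η)
  go : _ → z ≼ s ⊎ z ≽ ½ ℚ.* s
  go (yes small) = inj₁ (mk≼ (ℚ.<⇒≤ 0<s) (N , λ n N≤n → ℚ.≤-trans
    (ℚ.<⇒≤ (∣x-y∣<⇒x<y+ (normₙ z n) (normₙ z N) (close n N N≤n ℕ.≤-refl)))
    (ℚ.≤-trans (ℚ.+-monoˡ-≤ (¼ ℚ.* sq s) small)
      (+⇒≤ (¼ ℚ.* sq s) (ℚ.<⇒≤ 0<η)
        (solve 1 (λ s → s :* s := con ½ :* (s :* s) :+ con ¼ :* (s :* s) :+ con ¼ :* (s :* s))
          ≡.refl s)))))
  go (no large) = inj₂ (mk≽ (ℚ.<⇒≤ (pos* 0<½ 0<s)) (N , λ n N≤n →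
    +-cancelʳ-≤ (¼ ℚ.* sq s) (ℚ.≤-trans
      (subst (ℚ._≤ normₙ z N)
        (solve 1 (λ s → con ½ :* (s :* s) := (con ½ :* s) :* (con ½ :* s) :+ con ¼ :* (s :* s))
          ≡.refl s)
        (ℚ.<⇒≤ (ℚ.≰⇒> large)))
      (ℚ.<⇒≤ (∣x-y∣<⇒x<y+ (normₙ z N) (normₙ z n) (close N n ℕ.≤-refl N≤n))))))

rₙ-⁻¹ : ∀ z z#0 n → rₙ (z ⁻¹[ z#0 ]) n ≡ rₙ z n ℚ.* inv (normₙ z n)
rₙ-⁻¹ z z#0 n = ≡.refl

iₙ-⁻¹ : ∀ z z#0 n → iₙ (z ⁻¹[ z#0 ]) n ≡ (ℚ.- iₙ z n) ℚ.* inv (normₙ z n)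
iₙ-⁻¹ z z#0 n = ≡.refl

0<normₙ : ∀ z → z # 0ℂ → Eventually λ n → 0ℚ ℚ.< normₙ z n
0<normₙ z z#0 = proj₁ (proj₂ (proj₂ (normSq>0 z z#0))) , λ n N≤n → ℚ.<-≤-trans
  (subst (0ℚ ℚ.<_) (≡.sym (ℚ.+-identityˡ ε)) (proj₁ (proj₂ (normSq>0 z z#0))))
  (proj₂ (proj₂ (proj₂ (normSq>0 z z#0))) n N≤n)
  where
  ε : ℚ
  ε = proj₁ (normSq>0 z z#0)

rₙ-⁻¹-inverseʳ : ∀ z z#0 n → 0ℚ ℚ.< normₙ z n → rₙ (z * z ⁻¹[ z#0 ]) n ≡ 1ℚ
rₙ-⁻¹-inverseʳ z z#0 n 0<z = ≡.trans (rₙ-* z (z ⁻¹[ z#0 ]) n)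
  (≡.trans (cong₂ (λ a b → rₙ z n ℚ.* a ℚ.- iₙ z n ℚ.* b) (rₙ-⁻¹ z z#0 n) (iₙ-⁻¹ z z#0 n))
    (≡.trans (solve 3 (λ x y r → x :* (x :* r) :- y :* ((:- y) :* r) := (x :* x :+ y :* y) :* r)
      ≡.refl (rₙ z n) (iₙ z n) (inv (normₙ z n))) (*-inv-pos {normₙ z n} 0<z)))

iₙ-⁻¹-inverseʳ : ∀ z z#0 n → iₙ (z * z ⁻¹[ z#0 ]) n ≡ 0ℚ
iₙ-⁻¹-inverseʳ z z#0 n = ≡.trans (iₙ-* z (z ⁻¹[ z#0 ]) n)
  (≡.trans (cong₂ (λ a b → rₙ z n ℚ.* b ℚ.+ iₙ z n ℚ.* a) (rₙ-⁻¹ z z#0 n) (iₙ-⁻¹ z z#0 n))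
    (solve 3 (λ x y r → x :* ((:- y) :* r) :+ y :* (x :* r) := con 0ℚ)
      ≡.refl (rₙ z n) (iₙ z n) (inv (normₙ z n))))

⁻¹-inverseʳ : ∀ z (z#0 : z # 0ℂ) → z * z ⁻¹[ z#0 ] ∼ 1ℂ
⁻¹-inverseʳ z z#0 = mk∼ (proj₁ (0<normₙ z z#0) , λ n N≤n →
  real n (proj₂ (0<normₙ z z#0) n N≤n) , imag n)
  where
  real : ∀ n → 0ℚ ℚ.< normₙ z n → rₙ (z * z ⁻¹[ z#0 ]) n ≡ 1ℚ
  real n = rₙ-⁻¹-inverseʳ z z#0 n
  imag : ∀ n → iₙ (z * z ⁻¹[ z#0 ]) n ≡ 0ℚ
  imag n = iₙ-⁻¹-inverseʳ z z#0 n

inverse-≼ : ∀ {z w δ} → 0ℚ ℚ.< δ → z ≽ δ → z * w ∼ 1ℂ → w ≼ inv δ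
inverse-≼ {z} {w} {δ} 0<δ (mk≽ _ b) (mk∼ e) = mk≼ (ℚ.<⇒≤ (0<inv 0<δ))
  (ev-map₂ (λ n h e → bound n h (≡.trans (≡.sym (normₙ-* z w n)) (normₙ-≡ {z * w} {1ℂ} {n} e))) b e)
  where
  bound : ∀ n → sq δ ℚ.≤ normₙ z n → normₙ z n ℚ.* normₙ w n ≡ 1ℚ → normₙ w n ℚ.≤ sq (inv δ)
  bound n h e = subst₂ ℚ._≤_
    (≡.trans (solve 3 (λ d i w → (d :* d) :* w :* (i :* i) := w :* ((d :* i) :* (d :* i)))
        ≡.refl δ (inv δ) (normₙ w n))
      (≡.trans (cong (λ p → normₙ w n ℚ.* (p ℚ.* p)) (*-inv-pos {δ} 0<δ)) (ℚ.*-identityʳ (normₙ w n))))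
    (ℚ.*-identityˡ (sq (inv δ)))
    (*-monoʳ-≤ (sq (inv δ)) (0≤p² (inv δ)) (subst (sq δ ℚ.* normₙ w n ℚ.≤_) e
      (*-monoʳ-≤ (normₙ w n) (0≤normₙ w n) h)))

∣∣<1⇒≼ : ∀ q → ∣ q ∣ <ᴿ 1ᴿ → ∃[ r ] 0ℚ ℚ.< r × r ℚ.< 1ℚ × q ≼ r
∣∣<1⇒≼ q (ε , 0<ε , N , h) = r , 0<r , r<1 , mk≼ (ℚ.<⇒≤ 0<r)
  (ev-map₂ bound (N , h) (1/-small 0<½ε))
  where
  -- Half of the gap ε below 1 is kept; the other half absorbs the error 1/(n + 1) by which `rootℚ`
  -- may underestimate the root.
  r : ℚ
  r = 1ℚ ℚ.- ½ ℚ.* ε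
  0<½ε : 0ℚ ℚ.< ½ ℚ.* ε
  0<½ε = pos* 0<½ 0<ε
  ε≤1 : ε ℚ.≤ 1ℚ
  ε≤1 = ℚ.≤-trans (+⇒≤ (rootℚ N (normₙ q N)) (0≤rootℚ N (normₙ q N))
    (ℚ.+-comm (rootℚ N (normₙ q N)) ε)) (h N ℕ.≤-refl)
  0<r : 0ℚ ℚ.< r
  0<r = p<q⇒0<q-p (ℚ.<-≤-trans (½ε<ε 0<ε) ε≤1)
  r<1 : r ℚ.< 1ℚ
  r<1 = subst₂ ℚ._<_ (ℚ.+-identityʳ r)
    (solve 1 (λ e → con 1ℚ :- e :+ e := con 1ℚ) ≡.refl (½ ℚ.* ε)) (ℚ.+-monoʳ-< r 0<½ε)
  bound : ∀ n → rootℚ n (normₙ q n) ℚ.+ ε ℚ.≤ 1ℚ → 1/[1+ n ] ℚ.< ½ ℚ.* ε →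
          normₙ q n ℚ.≤ sq r
  bound n root≤ 1/< = ℚ.≤-trans (ℚ.<⇒≤ (rootℚ-upper n (normₙ q n)))
    (sq-mono-≤ (nonNeg+ (0≤rootℚ n (normₙ q n)) (ℚ.<⇒≤ (0<1/ n)))
      (+-cancelʳ-≤ {s ℚ.+ 1/[1+ n ]} {r} (½ ℚ.* ε) (begin
        s ℚ.+ 1/[1+ n ] ℚ.+ ½ ℚ.* ε
          ≤⟨ ℚ.+-monoˡ-≤ (½ ℚ.* ε) (ℚ.+-monoʳ-≤ s (ℚ.<⇒≤ 1/<)) ⟩
        s ℚ.+ ½ ℚ.* ε ℚ.+ ½ ℚ.* ε
          ≡⟨ solve 2 (λ s e → s :+ con ½ :* e :+ con ½ :* e := s :+ e) ≡.refl s ε ⟩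
        s ℚ.+ ε
          ≤⟨ root≤ ⟩
        1ℚ
          ≡⟨ solve 1 (λ e → con 1ℚ := con 1ℚ :- con ½ :* e :+ con ½ :* e) ≡.refl ε ⟩
        r ℚ.+ ½ ℚ.* ε ∎)))
    where
    open ℚ.≤-Reasoning
    s : ℚ
    s = rootℚ n (normₙ q n)

rootℚ≤ : ∀ {η} n v → 0ℚ ℚ.≤ η → v ℚ.≤ sq η → rootℚ n v ℚ.≤ η
rootℚ≤ {η} n v 0≤η h = Sum.[ (λ e → ℚ.≤-trans (ℚ.≤-reflexive e) 0≤η)
  , (λ le → sq-cancel-≤ 0≤η (ℚ.≤-trans le h)) ]′ (rootℚ-lower n v)

-- Half of η bounds ∣ z ∣, the other half is the gap that `_<ᴿ_` asks for.
≼⇒∣∣<ᴿ : ∀ {z ε η} → 0ℚ ℚ.< η → (Eventually λ n → 0ℚ ℚ.+ η ℚ.≤ seq ε n) →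
         z ≼ ½ ℚ.* η → ∣ z ∣ <ᴿ ε
≼⇒∣∣<ᴿ {z} {ε} {η} 0<η η≤ε (mk≼ 0≤½η b) =
  ½ ℚ.* η , pos* 0<½ 0<η , ev-map₂ close b η≤ε
  where
  close : ∀ k → normₙ z k ℚ.≤ sq (½ ℚ.* η) → 0ℚ ℚ.+ η ℚ.≤ seq ε k →
          seq ∣ z ∣ k ℚ.+ ½ ℚ.* η ℚ.≤ seq ε k
  close k h η≤ = ℚ.≤-trans (ℚ.+-monoˡ-≤ (½ ℚ.* η) (rootℚ≤ k (normₙ z k) 0≤½η h))
    (subst (ℚ._≤ seq ε k) (≡.trans (ℚ.+-identityˡ η) (≡.sym (½+½ η))) η≤)

⇝⇒⟶ : ∀ {z l} → (∀ η → 0ℚ ℚ.< η → Eventually λ n → (z n - l) ≼ η) → z ⟶ l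
⇝⇒⟶ {z} {l} lim ε (η , 0<η , η≤ε) =
  ev-map (λ n → ≼⇒∣∣<ᴿ {z n - l} {ε} 0<η η≤ε) (lim (½ ℚ.* η) (pos* 0<½ 0<η))

null⇒≈ : ∀ {z w} → (∀ η → 0ℚ ℚ.< η → (z - w) ≼ η) → z ≈ w
null⇒≈ {z} {w} null =
    (λ ε 0<ε → ev-map (λ n h → ℚ.≤-<-trans h (½ε<ε 0<ε))
      (≼⇒∣re∣≤ {z - w} (null (½ ℚ.* ε) (pos* 0<½ 0<ε))))
  , (λ ε 0<ε → ev-map (λ n h → ℚ.≤-<-trans h (½ε<ε 0<ε))
      (≼⇒∣im∣≤ {z - w} (null (½ ℚ.* ε) (pos* 0<½ 0<ε))))

-- The limit is a diagonal sequence whose entry `y n` approximates `x n` within 1/(n + 1). As the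
-- hypothesis speaks only of late indices, `y m` and `y n` are compared through `x m` and `x n` at a
-- common late index k.
real-complete : (x : ℕ → ℝ) →
  (∀ η → 0ℚ ℚ.< η → ∃[ N ] (∀ m n → N ℕ.≤ m → N ℕ.≤ n →
    Eventually λ k → ℚ.∣ seq (x m) k ℚ.- seq (x n) k ∣ ℚ.≤ η)) →
  ∃[ l ] (∀ η → 0ℚ ℚ.< η → Eventually λ n →
    Eventually λ k → ℚ.∣ seq (x n) k ℚ.- seq l k ∣ ℚ.≤ η)
real-complete x cx = mkℝ y cy , λ η 0<η → limit η 0<η
  where
  J : ℕ → ℕ
  J n = proj₁ (isCauchy (x n) 1/[1+ n ] (0<1/ n))
  y : ℕ → ℚ
  y n = seq (x n) (J n)
  near : ∀ n k → J n ℕ.≤ k → ℚ.∣ seq (x n) k ℚ.- y n ∣ ℚ.< 1/[1+ n ]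
  near n k J≤k = proj₂ (isCauchy (x n) 1/[1+ n ] (0<1/ n)) k (J n) J≤k ℕ.≤-refl
  cy : IsCauchy y
  cy ε 0<ε =
    let 0<η    = pos* 0<¼ 0<ε
        M , hM = cx (¼ ℚ.* ε) 0<η
        L , hL = 1/-small 0<η
    in M ℕ.⊔ L , λ m n N≤m N≤n →
      let K , hK = hM m n (ℕ.m⊔n≤o⇒m≤o M L N≤m) (ℕ.m⊔n≤o⇒m≤o M L N≤n)
          k = K ℕ.⊔ (J m ℕ.⊔ J n)
          Jm≤k = ℕ.≤-trans (ℕ.m≤m⊔n (J m) (J n)) (ℕ.m≤n⊔m K _)
          Jn≤k = ℕ.≤-trans (ℕ.m≤n⊔m (J m) (J n)) (ℕ.m≤n⊔m K _)
          a = ℚ.<-trans (subst (ℚ._< 1/[1+ m ]) (∣x-y∣-comm (seq (x m) k) (y m)) (near m k Jm≤k))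
                (hL m (ℕ.m⊔n≤o⇒n≤o M L N≤m))
          b = hK k (ℕ.m≤m⊔n K _)
          c = ℚ.<-trans (near n k Jn≤k) (hL n (ℕ.m⊔n≤o⇒n≤o M L N≤n))
      in ℚ.≤-<-trans (∣x-z∣≤ (y m) (seq (x m) k) (y n))
        (ℚ.<-≤-trans (ℚ.+-mono-<-≤ a (ℚ.≤-trans (∣x-z∣≤ (seq (x m) k) (seq (x n) k) (y n))
            (ℚ.+-mono-≤ b (ℚ.<⇒≤ c))))
          (+⇒≤ (¼ ℚ.* ε) (ℚ.<⇒≤ 0<η)
            (solve 1 (λ e → e := con ¼ :* e :+ (con ¼ :* e :+ con ¼ :* e) :+ con ¼ :* e) ≡.refl ε)))
  limit : ∀ η → 0ℚ ℚ.< η → Eventually λ n → Eventually λ k → ℚ.∣ seq (x n) k ℚ.- y k ∣ ℚ.≤ η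
  limit η 0<η =
    let 0<½η   = pos* 0<½ 0<η
        M , hM = cy (½ ℚ.* η) 0<½η
        L , hL = 1/-small 0<½η
    in M ℕ.⊔ L , λ n N≤n → J n ℕ.⊔ M , λ k K≤k →
      subst (ℚ.∣ seq (x n) k ℚ.- y k ∣ ℚ.≤_) (½+½ η) (ℚ.≤-trans
        (∣x-z∣≤ (seq (x n) k) (y n) (y k))
        (ℚ.+-mono-≤
          (ℚ.<⇒≤ (ℚ.<-trans (near n k (ℕ.m⊔n≤o⇒m≤o (J n) M K≤k)) (hL n (ℕ.m⊔n≤o⇒n≤o M L N≤n))))
          (ℚ.<⇒≤ (hM n k (ℕ.m⊔n≤o⇒m≤o M L N≤n) (ℕ.m⊔n≤o⇒n≤o (J n) M K≤k)))))

ℂ-complete : (z : ℕ → ℂ) →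
  (∀ η → 0ℚ ℚ.< η → ∃[ N ] (∀ m n → N ℕ.≤ m → N ℕ.≤ n → (z m - z n) ≼ η)) →
  ∃[ l ] (∀ η → 0ℚ ℚ.< η → Eventually λ n → (z n - l) ≼ η)
ℂ-complete z cz =
  let l , hl = real-complete (λ n → re (z n)) λ η 0<η →
        let N , h = cz η 0<η in N , λ m n N≤m N≤n → ≼⇒∣re∣≤ {z m - z n} (h m n N≤m N≤n)
      k , hk = real-complete (λ n → im (z n)) λ η 0<η →
        let N , h = cz η 0<η in N , λ m n N≤m N≤n → ≼⇒∣im∣≤ {z m - z n} (h m n N≤m N≤n)
  in (l +i k) , λ η 0<η →
    let 0<½η = pos* 0<½ 0<η
    in ev-map₂ (λ n a b → subst ((z n - (l +i k)) ≼_) (½+½ η)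
         (∣re∣,∣im∣⇒≼ {z n - (l +i k)} (ℚ.<⇒≤ 0<½η) (ℚ.<⇒≤ 0<½η) a b))
       (hl (½ ℚ.* η) 0<½η) (hk (½ ℚ.* η) 0<½η)

⊕⊖-≼⇒-≼ : ∀ z w {r} → (z ⊕ ⊖ w) ≼ r → (z - w) ≼ r
⊕⊖-≼⇒-≼ z w = ≼-resp-∼ {z ⊕ ⊖ w} {z - w} (⊕⊖∼- z w)

-≼⇒⊕⊖-≼ : ∀ z w {r} → (z - w) ≼ r → (z ⊕ ⊖ w) ≼ r
-≼⇒⊕⊖-≼ z w = ≼-resp-∼ {z - w} {z ⊕ ⊖ w} (∼-sym {z ⊕ ⊖ w} {z - w} (⊕⊖∼- z w))

⊕-complete : (z : ℕ → ℂ) →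
  (∀ η → 0ℚ ℚ.< η → ∃[ N ] (∀ m n → N ℕ.≤ m → N ℕ.≤ n → (z m ⊕ ⊖ z n) ≼ η)) →
  ∃[ l ] (∀ η → 0ℚ ℚ.< η → Eventually λ n → (z n ⊕ ⊖ l) ≼ η)
⊕-complete z cz =
  let l , limit = ℂ-complete z λ η 0<η → let N , h = cz η 0<η in
        N , λ m n N≤m N≤n → ⊕⊖-≼⇒-≼ (z m) (z n) {η} (h m n N≤m N≤n)
  in l , λ η 0<η → ev-map (λ n → -≼⇒⊕⊖-≼ (z n) l {η}) (limit η 0<η)

≼-⊕ : ∀ {z w r s} → z ≼ r → w ≼ s → (z ⊕ w) ≼ (r ℚ.+ s)
≼-⊕ {z} {w} h k = ≼-resp-∼ {z + w} {z ⊕ w} (∼-sym {z ⊕ w} {z + w} (⊕∼+ z w)) (≼-+ {z} {w} h k)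

≼-⊗ : ∀ {z w r s} → z ≼ r → w ≼ s → (z ⊗ w) ≼ (r ℚ.* s)
≼-⊗ {z} {w} h k = ≼-resp-∼ {z * w} {z ⊗ w} (∼-sym {z ⊗ w} {z * w} (⊗∼* z w)) (≼-* {z} {w} h k)

≼-⊖ : ∀ {z r} → z ≼ r → (⊖ z) ≼ r
≼-⊖ {z} h = ≼-resp-∼ { - z} {⊖ z} (∼-sym {⊖ z} { - z} (⊖∼- z)) (≼-neg {z} h)

≽-⊗ : ∀ {z w r s} → z ≽ r → w ≽ s → (z ⊗ w) ≽ (r ℚ.* s)
≽-⊗ {z} {w} h k = ≽-resp-∼ {z * w} {z ⊗ w} (∼-sym {z ⊗ w} {z * w} (⊗∼* z w)) (≽-* {z} {w} h k)

≽-⊕ : ∀ {z w r s} → z ≽ (r ℚ.+ s) → w ≼ s → 0ℚ ℚ.≤ r → (z ⊕ w) ≽ r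
≽-⊕ {z} {w} h k 0≤r =
  ≽-resp-∼ {z + w} {z ⊕ w} (∼-sym {z ⊕ w} {z + w} (⊕∼+ z w)) (≽-+ {z} {w} h k 0≤r)

⊗-inverseʳ : ∀ z (z#0 : z # 0ℂ) → z ⊗ z ⁻¹[ z#0 ] ∼ 1ℂ
⊗-inverseʳ z z#0 = ∼-trans {z ⊗ z ⁻¹[ z#0 ]} {z * z ⁻¹[ z#0 ]} {1ℂ}
  (⊗∼* z (z ⁻¹[ z#0 ])) (⁻¹-inverseʳ z z#0)

⊗-inverse-≼ : ∀ {z w δ} → 0ℚ ℚ.< δ → z ≽ δ → z ⊗ w ∼ 1ℂ → w ≼ inv δ
⊗-inverse-≼ {z} {w} 0<δ z≽δ e = inverse-≼ {z} {w} 0<δ z≽δ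
  (∼-trans {z * w} {z ⊗ w} {1ℂ} (∼-sym {z ⊗ w} {z * w} (⊗∼* z w)) e)

ℂ-normedRing : NormedRing
ℂ-normedRing = record
  { commutativeRing = ℂ-commutativeRing
  ; _≼_ = _≼_
  ; _≽_ = _≽_
  ; ≼⇒0≤ = λ {z} {r} → _≼_.0≤bound {z} {r}
  ; ≼-resp-≈ = λ {z} {w} {r} → ≼-resp-∼ {z} {w} {r}
  ; ≼-mono = λ {z} {r} {s} → ≼-mono {z} {r} {s}
  ; ≼-+ = λ {z} {w} {r} {s} → ≼-⊕ {z} {w} {r} {s}
  ; ≼-* = λ {z} {w} {r} {s} → ≼-⊗ {z} {w} {r} {s}
  ; ≼-neg = λ {z} {r} → ≼-⊖ {z} {r}
  ; 0≼ = λ {r} → 0≼ {r}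
  ; 1≼1 = 1≼1
  ; has-bound = has-bound
  ; ≽-resp-≈ = λ {z} {w} {r} → ≽-resp-∼ {z} {w} {r}
  ; ≽-mono = λ {z} {r} {s} → ≽-mono {z} {r} {s}
  ; ≽-* = λ {z} {w} {r} {s} → ≽-⊗ {z} {w} {r} {s}
  ; ≽-+ = λ {z} {w} {r} {s} → ≽-⊕ {z} {w} {r} {s}
  ; 1≽1 = mk≽ 0≤1 (always λ _ → ℚ.≤-refl)
  ; inverse = λ {z} 0<δ z≽δ →
      z ⁻¹[ ≽⇒# {z} 0<δ z≽δ ] , ⊗-inverseʳ z (≽⇒# {z} 0<δ z≽δ)
  ; inverse-≼ = λ {z} {w} {δ} → ⊗-inverse-≼ {z} {w} {δ}
  ; small-or-apart = small-or-apart
  ; complete = ⊕-complete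
  }

-- Transfer to the given definitions of series, products and limits

open Limits ℂ-normedRing using (_≋_; _⇝_; ⇝-resp-≈; ≋-trans; ≋-sym; ≈⇒≋)
module Ringℂ = NormedRing ℂ-normedRing

infixr 8 _↑_

opaque
  unfolding _⊗_ ⊖_

  _↑_ : ℂ → ℕ → ℂ
  _↑_ = _^_

  ↑≡^ : _↑_ ≡ _^_
  ↑≡^ = ≡.refl

  ↑-zero : ∀ x → x ↑ 0 ∼ 1ℂ
  ↑-zero x = pointwise (λ _ → ≡.refl) (λ _ → ≡.refl)

  ↑-suc : ∀ x n → x ↑ suc n ∼ x ⊗ x ↑ n
  ↑-suc x n = pointwise (λ _ → ≡.refl) (λ _ → ≡.refl)

  poch-suc : ∀ x y n → poch x y (suc n) ∼ poch x y n ⊗ (1ℂ ⊕ ⊖ (x ⊗ y ↑ n))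
  poch-suc x y n = pointwise (λ _ → ≡.refl) (λ _ → ≡.refl)

  partialSum-suc : ∀ t n → partialSum t (suc n) ∼ partialSum t n ⊕ t n
  partialSum-suc t n = pointwise (λ _ → ≡.refl) (λ _ → ≡.refl)

module Seriesℂ = Series ℂ-normedRing _↑_ ↑-zero ↑-suc
module Productsℂ = Products ℂ-normedRing

poch∼pochhammer : ∀ x y n → poch x y n ∼ Seriesℂ.pochhammer x y n
poch∼pochhammer x y = Seriesℂ.pochhammer-unique {poch x y} {x} {y} ∼-refl (poch-suc x y)

partialSum∼sum : ∀ {t u : ℕ → ℂ} → (∀ n → t n ∼ u n) → ∀ n → partialSum t n ∼ Productsℂ.sum u n
partialSum∼sum {t} {u} = Seriesℂ.sum-unique {partialSum t} {t} {u} ∼-refl (partialSum-suc t)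

⇝⇒⟶-resp : ∀ {z w : ℕ → ℂ} {l} → (∀ n → z n ∼ w n) → w ⇝ l → z ⟶ l
⇝⇒⟶-resp {z} {w} {l} e w⇝l = ⇝⇒⟶ {z} {l} λ η 0<η →
  ev-map (λ n → ⊕⊖-≼⇒-≼ (z n) l {η}) (_⇝_.close
    (⇝-resp-≈ {w} {z} {l} (λ n → ∼-sym {z n} {w n} (e n)) w⇝l) η 0<η)

≋⇒≈ : ∀ z w → z ≋ w → z ≈ w
≋⇒≈ z w h = null⇒≈ {z} {w} λ η 0<η → ⊕⊖-≼⇒-≼ z w {η} (_≋_.null h η 0<η)

inverse-resp : ∀ z z′ z#0 → z ∼ z′ → z′ ⊗ z ⁻¹[ z#0 ] ∼ 1ℂ
inverse-resp z z′ z#0 h = Ringℂ.trans {z′ ⊗ z ⁻¹[ z#0 ]} {z ⊗ z ⁻¹[ z#0 ]} {1ℂ}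
  (Ringℂ.*-congʳ {z ⁻¹[ z#0 ]} {z′} {z} (∼-sym {z} {z′} h)) (⊗-inverseʳ z z#0)

/∼⊗ : ∀ z w w#0 → z / w [ w#0 ] ∼ z ⊗ w ⁻¹[ w#0 ]
/∼⊗ z w w#0 = ∼-sym {z ⊗ w ⁻¹[ w#0 ]} {z / w [ w#0 ]} (⊗∼* z (w ⁻¹[ w#0 ]))

-- The inverses in the series are those built from `c#0`; since `sums` accepts every choice of
-- inverses, it applies to these.
converges⇒∑ : ∀ (b c c′ : ℕ → ℂ) {s} → (∀ n → c n ∼ c′ n) →
              Seriesℂ.Converges b c′ s → ∑ b / c ⟶ s
converges⇒∑ b c c′ {s} c∼ (Seriesℂ.converges c′≽ sums) =
  c#0 , ⇝⇒⟶-resp {partialSum (λ n → b n / c n [ c#0 n ])} {Productsℂ.sum (λ n → b n ⊗ i n)} {s}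
    (partialSum∼sum {λ n → b n / c n [ c#0 n ]} {λ n → b n ⊗ i n} (λ n → /∼⊗ (b n) (c n) (c#0 n)))
    (sums i (λ n → inverse-resp (c n) (c′ n) (c#0 n) (c∼ n)))
  where
  c#0 : ∀ n → c n # 0ℂ
  c#0 n = let δ , 0<δ , h = c′≽ n in
    ≽⇒# {c n} {δ} 0<δ (≽-resp-∼ {c′ n} {c n} {δ} (∼-sym {c n} {c′ n} (c∼ n)) h)
  i : ℕ → ℂ
  i n = c n ⁻¹[ c#0 n ]

denom∼ : ∀ x y n → poch x x n ⊗ poch y x n ∼ Seriesℂ.pochhammer x x n ⊗ Seriesℂ.pochhammer y x n
denom∼ x y n = Ringℂ.*-cong {poch x x n} {Seriesℂ.pochhammer x x n} {poch y x n} {Seriesℂ.pochhammer y x n}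
  (poch∼pochhammer x x n) (poch∼pochhammer y x n)

poch-limit : ∀ x y {l} → Seriesℂ.pochhammer y x ⇝ l → poch∞ y x l
poch-limit x y {l} = ⇝⇒⟶-resp {poch y x} {Seriesℂ.pochhammer y x} {l} (poch∼pochhammer y x)

-- `q ≽ δ` yields an actual proof of q # 0, to which the hypothesis on a can be applied; w is the
-- inverse built from that same proof.
avoids : ∀ a q m → ((q#0 : q # 0ℂ) → a # ⊖ ((q ⁻¹[ q#0 ]) ↑ m)) →
  ∀ δ → 0ℚ ℚ.< δ → q ≽ δ →
  ∃[ w ] q ⊗ w ∼ 1ℂ × ∃[ ε ] 0ℚ ℚ.< ε × (a ⊕ ⊖ ⊖ (w ↑ m)) ≽ ε
avoids a q m a# δ 0<δ q≽δ =
  let ε , 0<ε , h = #⇒≽ a (⊖ (w ↑ m)) (a# q#0)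
  in w , ⊗-inverseʳ q q#0 , ε , 0<ε
   , ≽-resp-∼ {a - ⊖ (w ↑ m)} {a ⊕ ⊖ ⊖ (w ↑ m)} {ε}
       (∼-sym {a ⊕ ⊖ ⊖ (w ↑ m)} {a - ⊖ (w ↑ m)} (⊕⊖∼- a (⊖ (w ↑ m)))) h
  where
  q#0 : q # 0ℂ
  q#0 = ≽⇒# {q} {δ} 0<δ q≽δ
  w : ℂ
  w = q ⁻¹[ q#0 ]

-- Stated for arbitrary operations, so that a single substitution leads from the
-- opaque operations to those of ℂ.
Identities : (ℂ → ℂ → ℂ) → (ℂ → ℂ) → (ℂ → ℕ → ℂ) → Set
Identities _∙_ neg pow = ∀ (a q : ℂ) → ∣ q ∣ <ᴿ 1ᴿ →
  (∀ N → 0 ℕ.< N → (q#0 : q # 0ℂ) → a # neg (pow (q ⁻¹[ q#0 ]) (2 ℕ.* N))) →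
  ∃[ S ] ∃[ P₁ ] ∃[ T₁ ]
    ∑ (λ n → pow a n ∙ pow q (n ℕ.^ 2 ℕ.+ n)) / (λ n → poch q q n) ⟶ S
    × poch∞ (neg (a ∙ pow q 2)) (pow q 2) P₁
    × ∑ (λ n → pow a n ∙ pow q (n ℕ.^ 2 ℕ.+ 2 ℕ.* n))
        / (λ n → poch (pow q 2) (pow q 2) n ∙ poch (neg (a ∙ pow q 2)) (pow q 2) n) ⟶ T₁
    × S ≈ P₁ ∙ T₁
    × ((∀ N → 0 ℕ.< N → (q#0 : q # 0ℂ) → a # neg (pow (q ⁻¹[ q#0 ]) (2 ℕ.* N ℕ.+ 1))) →
      ∃[ P₂ ] ∃[ T₂ ]
        poch∞ (neg (a ∙ pow q 3)) (pow q 2) P₂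
        × ∑ (λ n → pow a n ∙ pow q (n ℕ.^ 2 ℕ.+ n))
            / (λ n → poch (pow q 2) (pow q 2) n ∙ poch (neg (a ∙ pow q 3)) (pow q 2) n) ⟶ T₂
        × (P₁ ∙ T₁) ≈ (P₂ ∙ T₂))

identities : Identities _⊗_ ⊖_ _↑_
identities a q ∣q∣<1 a≠ =
  let r , 0<r , r<1 , q≼r = ∣∣<1⇒≼ q ∣q∣<1
      S , P₁ , T₁ , S-converges , P₁-limit , T₁-converges , S≋ , third =
        Seriesℂ.theorem a q 0<r r<1 q≼r λ n → avoids a q (2 ℕ.* suc n) (a≠ (suc n) (ℕ.s≤s ℕ.z≤n))
  in S , P₁ , T₁
   , converges⇒∑ (λ n → a ↑ n ⊗ q ↑ (n ℕ.^ 2 ℕ.+ n)) (λ n → poch q q n)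
       (Seriesℂ.pochhammer q q) (poch∼pochhammer q q) S-converges
   , poch-limit (q ↑ 2) (⊖ (a ⊗ q ↑ 2)) P₁-limit
   , converges⇒∑ (λ n → a ↑ n ⊗ q ↑ (n ℕ.^ 2 ℕ.+ 2 ℕ.* n))
       (λ n → poch (q ↑ 2) (q ↑ 2) n ⊗ poch (⊖ (a ⊗ q ↑ 2)) (q ↑ 2) n) (denom 2)
       (denom∼ (q ↑ 2) (⊖ (a ⊗ q ↑ 2))) T₁-converges
   , ≋⇒≈ S (P₁ ⊗ T₁) S≋
   , λ a≠′ →
     let P₂ , T₂ , P₂-limit , T₂-converges , S≋′ = third λ n →
           avoids a q (2 ℕ.* suc n ℕ.+ 1) (a≠′ (suc n) (ℕ.s≤s ℕ.z≤n))
     in P₂ , T₂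
      , poch-limit (q ↑ 2) (⊖ (a ⊗ q ↑ 3)) P₂-limit
      , converges⇒∑ (λ n → a ↑ n ⊗ q ↑ (n ℕ.^ 2 ℕ.+ n))
          (λ n → poch (q ↑ 2) (q ↑ 2) n ⊗ poch (⊖ (a ⊗ q ↑ 3)) (q ↑ 2) n) (denom 3)
          (denom∼ (q ↑ 2) (⊖ (a ⊗ q ↑ 3))) T₂-converges
      , ≋⇒≈ (P₁ ⊗ T₁) (P₂ ⊗ T₂) (≋-trans {P₁ ⊗ T₁} {S} {P₂ ⊗ T₂} (≋-sym {S} {P₁ ⊗ T₁} S≋) S≋′)
  where
  denom : ℕ → ℕ → ℂ
  denom m n = Seriesℂ.pochhammer (q ↑ 2) (q ↑ 2) n ⊗ Seriesℂ.pochhammer (⊖ (a ⊗ q ↑ m)) (q ↑ 2) n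

theorem3 : ∀ (a q : ℂ) → ∣ q ∣ <ᴿ 1ᴿ →
  -- a ≠ -q^(-2N); no condition when q = 0
  (∀ N → 0 ℕ.< N → (q#0 : q # 0ℂ) → a # - ((q ⁻¹[ q#0 ]) ^ (2 ℕ.* N))) →
  ∃[ S ] ∃[ P₁ ] ∃[ T₁ ]
    ∑ (λ n → a ^ n * q ^ (n ℕ.^ 2 ℕ.+ n)) / (λ n → poch q q n) ⟶ S
    × poch∞ (- (a * q ^ 2)) (q ^ 2) P₁
    × ∑ (λ n → a ^ n * q ^ (n ℕ.^ 2 ℕ.+ 2 ℕ.* n))
        / (λ n → poch (q ^ 2) (q ^ 2) n * poch (- (a * q ^ 2)) (q ^ 2) n) ⟶ T₁
    × S ≈ P₁ * T₁
    × -- the third expression is defined only if also a ≠ -q^(-(2N+1))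
      ((∀ N → 0 ℕ.< N → (q#0 : q # 0ℂ) → a # - ((q ⁻¹[ q#0 ]) ^ (2 ℕ.* N ℕ.+ 1))) →
        ∃[ P₂ ] ∃[ T₂ ]
          poch∞ (- (a * q ^ 3)) (q ^ 2) P₂
          × ∑ (λ n → a ^ n * q ^ (n ℕ.^ 2 ℕ.+ n))
              / (λ n → poch (q ^ 2) (q ^ 2) n * poch (- (a * q ^ 3)) (q ^ 2) n) ⟶ T₂
          × P₁ * T₁ ≈ P₂ * T₂)
theorem3 = subst (λ pow → Identities _*_ (-_) pow) ↑≡^
  (subst₂ (λ _∙_ neg → Identities _∙_ neg _↑_) ⊗≡* ⊖≡- identities)
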